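{- Let $q$ be a layered pattern of length $k$. Then $L(q)\ge (k-1)^2$; equivalently, $L(q)\ge L(12\cdots k)$.
   Context: A permutation $p=p_1\cdots p_n$ of $[n]$ contains a pattern $q=q_1\cdots q_k$ (a permutation of $[k]$) if there are indices $i_1<\dots<i_k$ with $p_{i_a}<p_{i_b}$ iff $q_a<q_b$; otherwise $p$ avoids $q$. $S_n(q)$ is the number of permutations of length $n$ avoiding $q$, and $L(q)=\lim_{n\to\infty}\sqrt[n]{S_n(q)}$ (this limit is known to exist for every pattern $q$). A pattern is layered if it is a concatenation of decreasing sequences of consecutive integers (the layers) such that every entry of a layer is larger than every entry of each earlier layer; e.g. $3217654$. -}

module Defs where

open import Data.Nat using (ℕ; zero; suc; _+_; _<ᵇ_)
open import Data.Bool using (Bool; true; false; _∧_; not; if_then_else_)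
open import Data.Bool.Properties using () renaming (_≟_ to _≟ᵇ_)
open import Data.List using (List; []; _∷_; _++_; map; concatMap; length; filterᵇ; zip; applyDownFrom)
open import Data.Bool.ListAction using (all; any)
open import Data.Product using (_×_; _,_)
open import Relation.Nullary.Decidable using (⌊_⌋)

-- Permutations of [n] = {1,…,n}, written in one-line notation as lists.

insertAll : ℕ → List ℕ → List (List ℕ)
insertAll x [] = (x ∷ []) ∷ []
insertAll x (y ∷ ys) = (x ∷ y ∷ ys) ∷ map (y ∷_) (insertAll x ys)

perms : ℕ → List (List ℕ)
perms zero = [] ∷ []
perms (suc n) = concatMap (insertAll (suc n)) (perms n)

subseqs : ℕ → List ℕ → List (List ℕ)
subseqs zero _ = [] ∷ []
subseqs (suc k) [] = []
subseqs (suc k) (x ∷ xs) = map (x ∷_) (subseqs k xs) ++ subseqs (suc k) xs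

-- order-isomorphism of two sequences of distinct numbers:
-- same length, and for all positions a<b:  u_a < u_b  iff  v_a < v_b
_eqb_ : Bool → Bool → Bool
b eqb c = ⌊ b ≟ᵇ c ⌋

sameOrder : List ℕ → List ℕ → Bool
sameOrder [] [] = true
sameOrder (x ∷ xs) (y ∷ ys) =
  all (λ { (x' , y') → (x <ᵇ x') eqb (y <ᵇ y') }) (zip xs ys) ∧ sameOrder xs ys
sameOrder _ _ = false

contains : List ℕ → List ℕ → Bool
contains p q = any (λ s → sameOrder s q) (subseqs (length q) p)

avoids : List ℕ → List ℕ → Bool
avoids p q = not (contains p q)

S : ℕ → List ℕ → ℕ
S n q = length (filterᵇ (λ p → avoids p q) (perms n))

-- Layered pattern with layer sizes a₁,…,a_m (listed in order):
-- layer i is the decreasing run  s+aᵢ, s+aᵢ-1, …, s+1  where s = a₁+…+a_{i-1}.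
layeredFrom : ℕ → List ℕ → List ℕ
layeredFrom s [] = []
layeredFrom s (a ∷ as) = map (λ j → s + suc j) (applyDownFrom (λ j → j) a) ++ layeredFrom (s + a) as

layered : List ℕ → List ℕ
layered = layeredFrom 0

Layered : List ℕ → Set
Layered q = Data.Product.∃ λ sizes → layered sizes ≡ q
  where open import Relation.Binary.PropositionalEquality using (_≡_)

{-# OPTIONS --safe #-}

-- Write g(q) for the square root of the growth rate of Av(q); the aim is
-- g(q) ≥ k - 1.  Two facts suffice.
--
-- (1) If q is not a skew sum then g(1 ⊕ q) ≥ g(q) + 1.  A decreasing sequence
-- can be merged into a q-avoider so that its entries become left-to-right minima
-- and the q-avoider lies above them; the result avoids 1 ⊕ q and determines both
-- parts.  Working in blocks of bounded size, the number of merges loses only a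
-- subexponential factor against C(n,d)², and Σ C(n,d) g^(n-d) = (g + 1)^n.
--
-- (2) The number of permutations avoiding δ ⊕ q, for a decreasing layer δ, is at
-- least the number avoiding ι ⊕ q with ι increasing of the same size (Backelin,
-- West and Xin).  The entries below and to the left of a copy of q fill a Ferrers
-- board.  Fomin's local rules encode a filling of the board by the sequence of
-- partitions along its boundary; conjugating these partitions turns fillings
-- without ι into fillings without δ.
--
-- By (2) the first layer may be replaced by layers of size 1, which (1) strips
-- off, until two layers remain.  Reverse complementation turns the pattern
-- 1 ⊕ δ into δ ⊕ 1, to which (2) and (1) apply once more.
module Submission where

open import Defs
import Algebra.Solver.CommutativeMonoid as CommutativeMonoidSolver
open import Data.Bool using (Bool; true; false; if_then_else_; T)
open import Data.Bool.ListAction using (all)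
open import Data.Bool.Properties using (T-≡; T-∧)
open import Data.Empty using (⊥; ⊥-elim)
open import Data.Fin using (#_)
open import Data.List
  using (List; []; _∷_; [_]; _++_; _ʳ++_; map; concatMap; length; filterᵇ; filter; zip; applyDownFrom; applyUpTo;
         replicate; reverse; take; cartesianProductWith; cartesianProduct)
open import Data.List.Membership.Propositional using (_∈_; _∉_; find; lose)
open import Data.List.Membership.Propositional.Properties
  using (∈-++⁺ˡ; ∈-++⁺ʳ; ∈-++⁻; ∈-∃++; ∈-map⁺; ∈-map⁻; ∈-concatMap⁺; ∈-concatMap⁻; ∈-filter⁺; ∈-filter⁻;
         ∈-cartesianProductWith⁻; ∈-cartesianProduct⁻; ∈-length)
open import Data.List.Properties
  using (length-map; length-++; length-replicate; length-reverse; length-take; length-applyDownFrom; ++-identityʳ;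
         ++-conicalˡ; ++-conicalʳ; map-++; map-∘; map-id-local; map-applyDownFrom; ∷-injective; ∷-injectiveˡ;
         ∷-injectiveʳ; filter-all; unfold-reverse; reverse-involutive; reverse-injective; reverse-map;
         reverse-applyDownFrom)
open import Data.List.Relation.Binary.Permutation.Propositional
  using (_↭_; prep; swap; ↭-refl; ↭-reflexive; ↭-sym; ↭-trans)
open import Data.List.Relation.Binary.Permutation.Propositional.Properties
  using (∈-resp-↭; All-resp-↭; ↭-length; ↭-empty-inv; ↭-reverse; shift; drop-mid; drop-∷; map⁺; ++⁺ˡ; ++⁺ʳ; ++-comm;
         ++-commutativeMonoid)
open import Data.List.Relation.Binary.Pointwise as Pointwiseₚ using (Pointwise; []; _∷_)
open import Data.List.Relation.Binary.Sublist.Propositional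
  using (_⊆_; []; _∷_; _∷ʳ_; ⊆-refl; ⊆-trans; minimum)
open import Data.List.Relation.Binary.Sublist.Propositional.Properties
  using (All-resp-⊆; Any-resp-⊆; take-⊆; filter-⊆; reverse⁺) renaming (map⁺ to map⁺-⊆; ++⁺ˡ to ⊆-++⁺ˡ)
open import Data.List.Relation.Unary.All as All using (All; []; _∷_)
import Data.List.Relation.Unary.All.Properties as Allₚ
open import Data.List.Relation.Unary.AllPairs as AllPairs using (AllPairs; []; _∷_)
import Data.List.Relation.Unary.AllPairs.Properties as AllPairsₚ
open import Data.List.Relation.Unary.Any as Any using (Any; here; there)
open import Data.List.Relation.Unary.Any.Properties using (any⁺; any⁻)
open import Data.List.Relation.Unary.Linked using (Linked; _∷_)
open import Data.List.Relation.Unary.Linked.Properties using (Linked⇒AllPairs; AllPairs⇒Linked)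
open import Data.List.Relation.Unary.Unique.Propositional using (Unique)
import Data.List.Relation.Unary.Unique.Propositional.Properties as Uniqueₚ
open import Data.Nat
  using (ℕ; zero; suc; _+_; _*_; _^_; _∸_; _≤_; _<_; _>_; z≤n; s≤s; _≟_; _<ᵇ_; _<?_; _≤?_; NonZero; nonZero;
         >-nonZero; >-nonZero⁻¹)
open import Data.Nat.DivMod using (_/_; _%_; m≡m%n+[m/n]*n; m%n<n)
open import Data.Nat.ListAction using (sum)
open import Data.Nat.ListAction.Properties using (sum-++)
open import Data.Nat.Properties
open import Data.Nat.Tactic.RingSolver using (solve-∀)
open import Data.Product using (∃; ∃-syntax; _×_; _,_; proj₁; proj₂)
open import Data.Sum using (_⊎_; inj₁; inj₂)
open import Data.Unit using (⊤; tt)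
import Data.Vec as Vec
open import Function using (_∘_; id)
open import Function.Bundles using (Equivalence)
open import Relation.Binary.Definitions using (tri<; tri≈; tri>)
open import Relation.Binary.PropositionalEquality
  using (_≡_; _≢_; refl; sym; trans; cong; cong₂; subst; subst₂; module ≡-Reasoning)
open import Relation.Nullary using (¬_; Dec; yes; no; does)
open import Relation.Nullary.Decidable using (dec-true; dec-false; T?; ¬?)

-- Label words and local rules

-- Only inequalities between counts are needed, so every comparison is an injection and Greene's
-- theorem is bypassed. Two one-sided bounds replace it: many labels 0 exhibit a long decreasing
-- chain, and a long increasing chain of open values forces a large label. Conjugation of the shapes
-- joins the two. A standard tableau is stored as its lattice word, one row label per open value,
-- the newest and largest value first. In this form local rules are recursions on lists, and shapes
-- are mere counts of labels. In the merging step the square of the binomial coefficient arises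
-- because the minima are chosen twice, once by position and once by value. Unrestricted choices
-- could push the avoider below the current minimum; fixed block sizes and a bounded delay prevent
-- this. The `δ` below is the Kronecker delta, not a layer.

δ : ℕ → ℕ → ℕ
δ s t = if does (s ≟ t) then 1 else 0

δ-refl : ∀ s → δ s s ≡ 1
δ-refl s rewrite dec-true (s ≟ s) refl = refl

δ-≢ : ∀ {s t} → s ≢ t → δ s t ≡ 0
δ-≢ {s} {t} s≢t rewrite dec-false (s ≟ t) s≢t = refl

cnt : ℕ → List ℕ → ℕ
cnt t [] = 0
cnt t (x ∷ L) = δ x t + cnt t L

cnt-here : ∀ s L → cnt s (s ∷ L) ≡ suc (cnt s L)
cnt-here s L rewrite δ-refl s = refl

cnt-there : ∀ x t L → x ≢ t → cnt t (x ∷ L) ≡ cnt t L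
cnt-there x t L x≢t rewrite δ-≢ x≢t = refl

-- Closing with carry s.  The carry travels from the most recent entry (the
-- head) towards older ones; at the first entry with its own label it lowers
-- that label and continues as s - 1, until an entry labelled 0 is removed.
-- Read backwards this is Fomin's local rule for growth diagrams.
data Close : ℕ → List ℕ → ℕ → List ℕ → Set where
  hit  : ∀ {L} → Close 0 (0 ∷ L) 0 L
  bump : ∀ {s L i L′} → Close s L i L′ → Close (suc s) (suc s ∷ L) (suc i) (s ∷ L′)
  pass : ∀ {s x L i L′} → x ≢ s → Close s L i L′ → Close s (x ∷ L) (suc i) (x ∷ L′)

Close-cnt : ∀ {s L i L′} → Close s L i L′ → ∀ t → cnt t L ≡ δ s t + cnt t L′
Close-cnt hit t = refl
Close-cnt (bump {s} {L} {L′ = L′} c) t rewrite Close-cnt c t = refl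
Close-cnt (pass {s} {x} {L} {L′ = L′} _ c) t rewrite Close-cnt c t = begin
    δ x t + (δ s t + cnt t L′) ≡⟨ +-assoc (δ x t) _ _ ⟨
    δ x t + δ s t + cnt t L′   ≡⟨ cong (_+ cnt t L′) (+-comm (δ x t) _) ⟩
    δ s t + δ x t + cnt t L′   ≡⟨ +-assoc (δ s t) _ _ ⟩
    δ s t + (δ x t + cnt t L′) ∎
  where open ≡-Reasoning

Close-length : ∀ {s L i L′} → Close s L i L′ → length L ≡ suc (length L′)
Close-length hit = refl
Close-length (bump c) = cong suc (Close-length c)
Close-length (pass _ c) = cong suc (Close-length c)

Close-forward-unique : ∀ {s L i L′ j L″} → Close s L i L′ → Close s L j L″ → i ≡ j × L′ ≡ L″
Close-forward-unique hit hit = refl , refl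
Close-forward-unique hit (pass ne _) = ⊥-elim (ne refl)
Close-forward-unique (bump c) (bump d) with Close-forward-unique c d
... | refl , refl = refl , refl
Close-forward-unique (bump c) (pass ne d) = ⊥-elim (ne refl)
Close-forward-unique (pass ne c) hit = ⊥-elim (ne refl)
Close-forward-unique (pass ne c) (bump d) = ⊥-elim (ne refl)
Close-forward-unique (pass ne c) (pass _ d) with Close-forward-unique c d
... | refl , refl = refl , refl

Close-backward-unique : ∀ {s L i L′ t M} → Close s L i L′ → Close t M i L′ → s ≡ t × L ≡ M
Close-backward-unique hit hit = refl , refl
Close-backward-unique (bump c) (bump d) with Close-backward-unique c d
... | refl , refl = refl , refl
Close-backward-unique (bump c) (pass ne d) with Close-backward-unique c d
... | refl , refl = ⊥-elim (ne refl)
Close-backward-unique (pass ne c) (bump d) with Close-backward-unique c d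
... | refl , refl = ⊥-elim (ne refl)
Close-backward-unique (pass ne c) (pass _ d) with Close-backward-unique c d
... | refl , refl = refl , refl

-- This direction is Schensted row insertion of a value with `i` larger open values: the carry is
-- the current row, and the next larger entry of that row is bumped to the next row.
Close-backward : ∀ i L′ → i ≤ length L′ → ∃[ s ] ∃[ L ] Close s L i L′
Close-backward zero L′ _ = 0 , 0 ∷ L′ , hit
Close-backward (suc i) (x ∷ L′) (s≤s i≤) with Close-backward i L′ i≤
... | s , L , c with x ≟ s
...   | yes refl = suc s , suc s ∷ L , bump c
...   | no x≢s = s , x ∷ L , pass x≢s c

-- The label counts are then the row lengths of a Young diagram; `Room s` below says that row s can
-- take another box.
record Decreasing-cnt (L : List ℕ) : Set where
  constructor decreasing
  field at : ∀ s → cnt (suc s) L ≤ cnt s L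
open Decreasing-cnt

-- Lattice words, read from the tail.
data Lattice : List ℕ → Set where
  []  : Lattice []
  _∷_ : ∀ {x L} → Decreasing-cnt (x ∷ L) → Lattice L → Lattice (x ∷ L)

lattice-cnt : ∀ {L} → Lattice L → Decreasing-cnt L
lattice-cnt [] = decreasing (λ _ → z≤n)
lattice-cnt (d ∷ _) = d

lattice-tail : ∀ {x L} → Lattice (x ∷ L) → Lattice L
lattice-tail (_ ∷ l) = l

Room : ℕ → List ℕ → Set
Room zero L = ⊤
Room (suc s) L = cnt (suc s) L < cnt s L

decreasing-remove : ∀ {s L i L′} → Close s L i L′ →
  cnt (suc s) L < cnt s L → Decreasing-cnt L → Decreasing-cnt L′
decreasing-remove {s} {L} {i} {L′} c lt dec = decreasing go
  where
  eq = Close-cnt c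
  go : ∀ t → cnt (suc t) L′ ≤ cnt t L′
  go t with s ≟ t
  ... | yes refl = ≤-pred (subst₂ _<_ e₁ e₂ lt)
    where
    e₁ : cnt (suc s) L ≡ cnt (suc s) L′
    e₁ = trans (eq (suc s)) (cong (_+ cnt (suc s) L′) (δ-≢ {s} {suc s} (λ ())))
    e₂ : cnt s L ≡ suc (cnt s L′)
    e₂ = trans (eq s) (cong (_+ cnt s L′) (δ-refl s))
  ... | no s≢t = ≤-trans (≤-trans (m≤n+m _ (δ s (suc t))) (≤-reflexive (sym (eq (suc t)))))
      (≤-trans (dec .at t) (≤-reflexive (trans (eq t) (cong (_+ cnt t L′) (δ-≢ s≢t)))))

decreasing-add : ∀ {s L i L′} → Close s L i L′ →
  Room s L′ → Decreasing-cnt L′ → Decreasing-cnt L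
decreasing-add {s} {L} {i} {L′} c room dec = decreasing go
  where
  eq = Close-cnt c
  go : ∀ t → cnt (suc t) L ≤ cnt t L
  go t with s ≟ suc t
  ... | yes refl = subst₂ _≤_ (sym (trans (eq (suc t)) (cong (_+ cnt (suc t) L′) (δ-refl (suc t))))) (sym (eq t))
      (≤-trans (room) (m≤n+m _ (δ (suc t) t)))
  ... | no s≢ = subst₂ _≤_ (sym (trans (eq (suc t)) (cong (_+ cnt (suc t) L′) (δ-≢ s≢)))) (sym (eq t))
      (≤-trans (dec .at t) (m≤n+m _ (δ s t)))

-- Reverse insertion can start at any corner. The hypothesis reproduces itself: when a label s + 1
-- is lowered, the partition condition on the whole word makes row s strictly longer than row s + 1
-- in the tail.
Close-forward : ∀ {s L} → Lattice L → cnt (suc s) L < cnt s L →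
  ∃[ i ] ∃[ L′ ] (Close s L i L′ × Lattice L′)
Close-forward {s} {x ∷ L} (dec ∷ lat) lt with x ≟ s
Close-forward {zero} {x ∷ L} (dec ∷ lat) lt | yes refl = 0 , L , hit , lat
Close-forward {suc s} {x ∷ L} (dec ∷ lat) lt | yes refl
  with i , L′ , c , lat′ ← Close-forward {s} {L} lat
         (subst₂ _≤_ (cnt-here (suc s) L) (cnt-there (suc s) s L (λ ())) (dec .at s))
  = suc i , s ∷ L′ , bump c
  , decreasing-remove (bump c)
      lt dec ∷ lat′
Close-forward {s} {x ∷ L} (dec ∷ lat) lt | no x≢s
  with i , L′ , c , lat′ ← Close-forward {s} {L} lat (≤-<-trans (m≤n+m _ (δ x (suc s))) (subst (cnt (suc s) (x ∷ L) <_) (cnt-there x s L x≢s) lt))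
  = suc i , x ∷ L′ , pass x≢s c
  , decreasing-remove (pass x≢s c) lt dec ∷ lat′

-- Insertion ends at an addable box: a carry s + 1 comes from an entry labelled s that is about to
-- be bumped, and this entry gives row s one box beyond what the older entries guarantee.
Close-room : ∀ {s L i L′} → Close s L i L′ → Lattice L′ → Room s L′
Close-room hit _ = tt
Close-room (bump {s} {L} {L′ = L′} c) (dec ∷ lat) =
  subst₂ _<_ (sym (cnt-there s (suc s) L′ (λ ()))) (sym (cnt-here s L′)) (s≤s (lattice-cnt lat .at s))
Close-room (pass {zero} _ c) _ = tt
Close-room (pass {suc s} {x} {L′ = L′} x≢ c) (_ ∷ lat) =
  subst (_< cnt s (x ∷ L′)) (sym (cnt-there x (suc s) L′ x≢)) (<-≤-trans (Close-room c lat) (m≤n+m _ (δ x s)))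

Close-lattice : ∀ {s L i L′} → Close s L i L′ → Lattice L′ → Lattice L
Close-lattice c@hit lat = decreasing-add c tt (lattice-cnt lat) ∷ lat
Close-lattice c@(bump d) lat = decreasing-add c (Close-room c lat) (lattice-cnt lat) ∷ Close-lattice d (lattice-tail lat)
Close-lattice c@(pass _ d) lat = decreasing-add c (Close-room c lat) (lattice-cnt lat) ∷ Close-lattice d (lattice-tail lat)

-- Runs, conjugate shapes and dual runs

data Move : Set where
  opens  : Move
  closes : ℕ → Move

-- Read from the end, the moves determine the states: `closes i` inserts an entry at index i, and
-- `opens` deletes the newest entry. The shapes met on the way are the partitions along the boundary
-- of the board.
data Run : List ℕ → List Move → Set where
  done : Run [] []
  op   : ∀ {s L a} → Run (s ∷ L) a → Run L (opens ∷ a)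
  cl   : ∀ {s L i L′ a} → Close s L i L′ → Run L′ a → Run L (closes i ∷ a)

Run-lattice : ∀ {L a} → Run L a → Lattice L
Run-lattice done = []
Run-lattice (op r) = lattice-tail (Run-lattice r)
Run-lattice (cl c r) = Close-lattice c (Run-lattice r)

Run-unique : ∀ {L M a} → Run L a → Run M a → L ≡ M
Run-unique done done = refl
Run-unique (op r) (op q) = ∷-injectiveʳ (Run-unique r q)
Run-unique (cl c r) (cl d q) with Run-unique r q
... | refl = proj₂ (Close-backward-unique c d)

-- L and K are conjugate partitions: row s of L has length cnt s L.
record Conjugate (L K : List ℕ) : Set where
  constructor conjugate
  field
    to   : ∀ s c → c < cnt s L → s < cnt c K
    from : ∀ s c → s < cnt c K → c < cnt s L
open Conjugate

Conjugate-sym : ∀ {L K} → Conjugate L K → Conjugate K L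
Conjugate-sym cj = conjugate (λ c s → cj .from s c) (λ c s → cj .to s c)

record Adds (s : ℕ) (L L⁺ : List ℕ) : Set where
  constructor adds
  field counts : ∀ t → cnt t L⁺ ≡ δ s t + cnt t L
open Adds

Close-adds : ∀ {s L i L′} → Close s L i L′ → Adds s L′ L
Close-adds c = adds (Close-cnt c)

Adds-here : ∀ {s L L⁺} → Adds s L L⁺ → cnt s L⁺ ≡ suc (cnt s L)
Adds-here {s} {L} a = trans (a .counts s) (cong (_+ cnt s L) (δ-refl s))

Adds-there : ∀ {s L L⁺ t} → Adds s L L⁺ → s ≢ t → cnt t L⁺ ≡ cnt t L
Adds-there {s} {L} {t = t} a ne = trans (a .counts t) (cong (_+ cnt t L) (δ-≢ ne))

addBox-to : ∀ {L L⁺ K K⁺ s c} → Adds s L L⁺ → Adds c K K⁺ → cnt s L ≡ c → cnt c K ≡ s →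
  Conjugate L K → ∀ s′ c′ → c′ < cnt s′ L⁺ → s′ < cnt c′ K⁺
addBox-to {L} {L⁺} {K} {K⁺} {s} {c} aL aK eL eK cj s′ c′ lt with s ≟ s′ | c ≟ c′
... | yes refl | yes refl = subst (s <_) (sym (Adds-here aK)) (s≤s (≤-reflexive (sym eK)))
... | yes refl | no c≢ = subst (s <_) (sym (Adds-there aK c≢)) (cj .to s c′
      (≤∧≢⇒< (≤-pred (subst (c′ <_) (Adds-here aL) lt))
             (λ e → c≢ (trans (sym eL) (sym e)))))
... | no s≢ | _ = ≤-trans (cj .to s′ c′ (subst (c′ <_) (Adds-there aL s≢) lt))
      (≤-trans (m≤n+m _ (δ c c′)) (≤-reflexive (sym (aK .counts c′))))

addBox : ∀ {L L⁺ K K⁺ s c} → Adds s L L⁺ → Adds c K K⁺ → cnt s L ≡ c → cnt c K ≡ s →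
  Conjugate L K → Conjugate L⁺ K⁺
addBox aL aK eL eK cj = conjugate (addBox-to aL aK eL eK cj)
  (λ s c → addBox-to aK aL eK eL (Conjugate-sym cj) c s)

removeBox-to : ∀ {L L⁺ K K⁺ s c} → Adds s L L⁺ → Adds c K K⁺ → cnt s L ≡ c → cnt c K ≡ s →
  Conjugate L⁺ K⁺ → ∀ s′ c′ → c′ < cnt s′ L → s′ < cnt c′ K
removeBox-to {L} {L⁺} {K} {K⁺} {s} {c} aL aK eL eK cj s′ c′ lt with s ≟ s′ | c ≟ c′
... | yes refl | yes refl = ⊥-elim (<-irrefl (sym eL) lt)
... | _ | no c≢ = subst (s′ <_) (Adds-there aK c≢)
      (cj .to s′ c′ (≤-trans lt (≤-trans (m≤n+m _ (δ s s′)) (≤-reflexive (sym (aL .counts s′))))))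
... | no s≢ | yes refl = ≤∧≢⇒<
      (≤-pred (subst (s′ <_) (Adds-here aK) (cj .to s′ c
        (≤-trans lt (≤-trans (m≤n+m _ (δ s s′)) (≤-reflexive (sym (aL .counts s′))))))))
      (λ e → s≢ (trans (sym eK) (sym e)))

removeBox : ∀ {L L⁺ K K⁺ s c} → Adds s L L⁺ → Adds c K K⁺ → cnt s L ≡ c → cnt c K ≡ s →
  Conjugate L⁺ K⁺ → Conjugate L K
removeBox aL aK eL eK cj = conjugate (removeBox-to aL aK eL eK cj)
  (λ s c → removeBox-to aK aL eK eL (Conjugate-sym cj) c s)

-- The next free box of row s lies in column `cnt s L`; it is addable only if this column, which is
-- a row of `K`, has height exactly s.
addable : ∀ {L K s} → Conjugate L K → Decreasing-cnt (s ∷ L) → cnt (cnt s L) K ≡ s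
addable {L} {K} {s} cj dec = ≤-antisym
  (≮⇒≥ (λ lt → <-irrefl refl (cj .from s (cnt s L) lt))) (below s refl)
  where
  below : ∀ t → t ≡ s → t ≤ cnt (cnt s L) K
  below zero _ = z≤n
  below (suc t) refl = cj .to t (cnt (suc t) L)
    (subst₂ _≤_ (cnt-here (suc t) L) (cnt-there (suc t) t L (λ ())) (dec .at t))

addable-room : ∀ {L K s} → Conjugate L K → Decreasing-cnt K → cnt (cnt s L) K ≡ s → Decreasing-cnt (cnt s L ∷ K)
addable-room {L} {K} {s} cj dec e = decreasing go
  where
  c = cnt s L
  go : ∀ t → cnt (suc t) (c ∷ K) ≤ cnt t (c ∷ K)
  go t with c ≟ suc t
  ... | yes p = ≤-trans (≤-reflexive (trans (cong (λ z → cnt z (c ∷ K)) (sym p)) (trans (cnt-here c K) (cong suc e))))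
        (≤-trans (cj .to s t (≤-reflexive (sym p))) (m≤n+m _ (δ c t)))
  ... | no ne = ≤-trans (≤-reflexive (cnt-there c (suc t) K ne)) (≤-trans (dec .at t) (m≤n+m _ (δ c t)))

-- The states stay conjugate because the same box (s , c) is added or removed in
-- both runs.
data Dual : List ℕ → List Move → List ℕ → List Move → Set where
  done : Dual [] [] [] []
  op   : ∀ {s c L K a a′} → cnt s L ≡ c → cnt c K ≡ s → Dual (s ∷ L) a (c ∷ K) a′ →
         Dual L (opens ∷ a) K (opens ∷ a′)
  cl   : ∀ {s c L K L′ K′ i j a a′} → cnt s L′ ≡ c → cnt c K′ ≡ s → Close s L i L′ → Close c K j K′ →
         Dual L′ a K′ a′ → Dual L (closes i ∷ a) K (closes j ∷ a′)

Dual-left : ∀ {L a K a′} → Dual L a K a′ → Run L a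
Dual-left done = done
Dual-left (op _ _ d) = op (Dual-left d)
Dual-left (cl _ _ c _ d) = cl c (Dual-left d)

Dual-right : ∀ {L a K a′} → Dual L a K a′ → Run K a′
Dual-right done = done
Dual-right (op _ _ d) = op (Dual-right d)
Dual-right (cl _ _ _ c d) = cl c (Dual-right d)

-- The moves on the right fix all states on the right, hence each column `c`; the row is then the
-- height of that column, and `Close` is deterministic once its carry is known.
Dual-injective : ∀ {L a b K a′} → Dual L a K a′ → Dual L b K a′ → a ≡ b
Dual-injective done done = refl
Dual-injective (op e₁ e₂ d) (op f₁ f₂ d′) with Run-unique (Dual-right d) (Dual-right d′)
... | refl with trans (sym e₂) f₂
...   | refl = cong (opens ∷_) (Dual-injective d d′)
Dual-injective (cl e₁ e₂ x y d) (cl f₁ f₂ x′ y′ d′) with Run-unique (Dual-right d) (Dual-right d′)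
... | refl with Close-backward-unique y y′
...   | refl , _ with trans (sym e₂) f₂
...     | refl with Close-forward-unique x x′
...       | refl , refl = cong (closes _ ∷_) (Dual-injective d d′)

Conjugate-empty : ∀ {K} → Conjugate [] K → K ≡ []
Conjugate-empty {[]} cj = refl
Conjugate-empty {x ∷ K} cj with () ← cj .from 0 x (subst (0 <_) (sym (cnt-here x K)) (s≤s z≤n))

-- `L` dictates the box and `K` follows. A closing removes a corner of `L`, and its transpose is a
-- corner of `K`, which is what `Close-forward` asks for.
dualize : ∀ {L a K} → Run L a → Conjugate L K → Lattice K → ∃[ a′ ] Dual L a K a′
dualize {K = K} done cj lat with refl ← Conjugate-empty cj = [] , done
dualize {L} {K = K} (op {s} r) cj lat = _ , op refl e (proj₂ rest)
  where
  e = addable cj (lattice-cnt (Run-lattice r))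
  rest = dualize {K = cnt s L ∷ K} r (addBox (adds λ _ → refl) (adds λ _ → refl) refl e cj) (addable-room cj (lattice-cnt lat) e ∷ lat)
dualize {L} {K = K} (cl {s} {L′ = L′} c r) cj lat = _ , cl refl eK c d (proj₂ rest)
  where
  row : cnt s L ≡ suc (cnt s L′)
  row = Adds-here (Close-adds c)
  up : s < cnt (cnt s L′) K
  up = cj .to s (cnt s L′) (≤-reflexive (sym row))
  lt : cnt (suc (cnt s L′)) K < suc s
  lt = s≤s (≮⇒≥ (λ z → <-irrefl refl (subst (suc (cnt s L′) <_) row (cj .from s _ z))))
  fw = Close-forward {cnt s L′} lat (<-≤-trans lt up)
  d = proj₁ (proj₂ (proj₂ fw))
  K′ = proj₁ (proj₂ fw)
  -- Row s + 1 is untouched by the closing and no longer than row s of `L′`, so the column ends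
  -- exactly at the removed box.
  top : cnt (cnt s L′) K ≤ suc s
  top = ≮⇒≥ λ z → <-irrefl refl (≤-trans (subst (cnt s L′ <_)
    (Adds-there (Close-adds c) (λ e → <-irrefl e (n<1+n s))) (cj .from (suc s) (cnt s L′) z))
    (lattice-cnt (Run-lattice r) .at s))
  eK : cnt (cnt s L′) K′ ≡ s
  eK = suc-injective (trans (sym (Adds-here (Close-adds d))) (≤-antisym top up))
  rest = dualize r (removeBox (Close-adds c) (Close-adds d) refl eK cj) (proj₂ (proj₂ (proj₂ fw)))

-- Fillings of Ferrers boards

data Remove : ℕ → List ℕ → ℕ → List ℕ → Set where
  here  : ∀ {y O} → Remove 0 (y ∷ O) y O
  there : ∀ {i x O y O′} → Remove i O y O′ → Remove (suc i) (x ∷ O) y (x ∷ O′)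

Remove-↭ : ∀ {i O y O′} → Remove i O y O′ → O ↭ y ∷ O′
Remove-↭ here = ↭-refl
Remove-↭ {y = y} (there {x = x} r) = ↭-trans (prep x (Remove-↭ r)) (swap x y ↭-refl)

Remove-∈ : ∀ {y O} → y ∈ O → ∃[ i ] ∃[ O′ ] Remove i O y O′
Remove-∈ (here refl) = _ , _ , here
Remove-∈ (there m) with _ , _ , r ← Remove-∈ m = _ , _ , there r

Remove-< : ∀ i O → i < length O → ∃[ y ] ∃[ O′ ] Remove i O y O′
Remove-< zero (y ∷ O) _ = y , O , here
Remove-< (suc i) (x ∷ O) (s≤s lt) with _ , _ , r ← Remove-< i O lt = _ , _ , there r

Remove-unique : ∀ {i O y O′ z O″} → Remove i O y O′ → Remove i O z O″ → y ≡ z × O′ ≡ O″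
Remove-unique here here = refl , refl
Remove-unique (there r) (there q) with Remove-unique r q
... | refl , refl = refl , refl

Remove-member : ∀ {i O y O′} → Remove i O y O′ → y ∈ O
Remove-member here = here refl
Remove-member (there r) = there (Remove-member r)

Remove-index : ∀ {i O y O′} → Remove i O y O′ → i ≤ length O′
Remove-index here = z≤n
Remove-index (there r) = s≤s (Remove-index r)

Remove-⊆ : ∀ {i O y O′} → Remove i O y O′ → O′ ⊆ O
Remove-⊆ here = _ ∷ʳ ⊆-refl
Remove-⊆ (there r) = refl ∷ Remove-⊆ r

AllPairs-⊆ : ∀ {R : ℕ → ℕ → Set} {xs ys} → xs ⊆ ys → AllPairs R ys → AllPairs R xs
AllPairs-⊆ [] [] = []
AllPairs-⊆ (_ ∷ʳ τ) (_ ∷ ps) = AllPairs-⊆ τ ps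
AllPairs-⊆ (refl ∷ τ) (p ∷ ps) = All-resp-⊆ τ p ∷ AllPairs-⊆ τ ps

Remove-index-unique : ∀ {i O y O′ j O″} → AllPairs _>_ O → Remove i O y O′ → Remove j O y O″ → i ≡ j × O′ ≡ O″
Remove-index-unique _ here here = refl , refl
Remove-index-unique (p ∷ _) here (there q) = ⊥-elim (<-irrefl refl (All.lookup p (Remove-member q)))
Remove-index-unique (p ∷ _) (there r) here = ⊥-elim (<-irrefl refl (All.lookup p (Remove-member r)))
Remove-index-unique (_ ∷ d) (there r) (there q) with Remove-index-unique d r q
... | refl , refl = refl , refl

-- Fill O R θs ys a: the columns are visited in the order of their bounds θs;
-- the values R (ascending) are opened as soon as they are below the bound of
-- the next column, and each column closes one of the open values O.
data Fill : List ℕ → List ℕ → List ℕ → List ℕ → List Move → Set where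
  done : Fill [] [] [] [] []
  op   : ∀ {r θ O R θs ys a} → r < θ → Fill (r ∷ O) R (θ ∷ θs) ys a → Fill O (r ∷ R) (θ ∷ θs) ys (opens ∷ a)
  cl   : ∀ {θ y i O O′ R θs ys a} → All (θ ≤_) R → Remove i O y O′ → Fill O′ R θs ys a →
         Fill O R (θ ∷ θs) (y ∷ ys) (closes i ∷ a)

Fill-↭ : ∀ {O R θs ys a} → Fill O R θs ys a → ys ↭ O ++ R
Fill-↭ done = ↭-refl
Fill-↭ (op {r} {O = O} {R} _ f) = ↭-trans (Fill-↭ f) (↭-sym (shift r O R))
Fill-↭ (cl {y = y} {R = R} _ rm f) = ↭-trans (prep y (Fill-↭ f)) (++⁺ʳ R (↭-sym (Remove-↭ rm)))

-- The labels are computed from the empty end by insertion, which succeeds because the index of a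
-- closing never exceeds the number of values left open.
Fill-Run : ∀ {O R θs ys a} → Fill O R θs ys a → ∃[ L ] (Run L a × length L ≡ length O)
Fill-Run done = [] , done , refl
Fill-Run (op _ f) with (s ∷ L) , r , e ← Fill-Run f = L , op r , suc-injective e
Fill-Run (cl {i = i} {O} {O′} _ rm f) with L , r , e ← Fill-Run f
  with s , M , c ← Close-backward i L (subst (i ≤_) (sym e) (Remove-index rm))
  = M , cl c r , trans (Close-length c) (trans (cong suc e) (sym (↭-length (Remove-↭ rm))))

Close-index : ∀ {s L i L′} → Close s L i L′ → i < length L
Close-index hit = s≤s z≤n
Close-index (bump c) = s≤s (Close-index c)
Close-index (pass _ c) = s≤s (Close-index c)

-- The bounds see only when values open and when columns close, and dual runs agree on both. The
-- state `K` has one label per open value, so each new index denotes an open value.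
refill : ∀ {O R θs ys a L K a′ Q} → Fill O R θs ys a → Dual L a K a′ → length Q ≡ length K →
  ∃[ ys′ ] Fill Q R θs ys′ a′
refill {Q = []} done done _ = [] , done
refill (op lt f) (op _ _ d) e with ys′ , f′ ← refill f d (cong suc e) = ys′ , op lt f′
refill {Q = Q} (cl al rm f) (cl {j = j} _ _ _ c d) e
  with y , Q′ , rm′ ← Remove-< j Q (subst (j <_) (sym e) (Close-index c))
  with ys′ , f′ ← refill f d (suc-injective (trans (sym (↭-length (Remove-↭ rm′))) (trans e (Close-length c))))
  = y ∷ ys′ , cl al rm′ f′

next-open : ∀ {θ R y} O → All (θ ≤_) R → y ∈ O ++ R → y < θ → y ∈ O
next-open O θ≤R y∈ y<θ with ∈-++⁻ O y∈
... | inj₁ y∈O = y∈O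
... | inj₂ y∈R = ⊥-elim (<⇒≱ y<θ (All.lookup θ≤R y∈R))

Fillable : List ℕ → List ℕ → Set
Fillable θs ys = ∀ O R → AllPairs _<_ R → ys ↭ O ++ R → ∃[ a ] Fill O R θs ys a

fill-close : ∀ {θ y θs ys} → Fillable θs ys → y < θ → ∀ O R → AllPairs _<_ R → All (θ ≤_) R →
  y ∷ ys ↭ O ++ R → ∃[ a ] Fill O R (θ ∷ θs) (y ∷ ys) a
fill-close next y<θ O R asc θ≤R p
  with i , O′ , rm ← Remove-∈ (next-open O θ≤R (∈-resp-↭ p (here refl)) y<θ)
  with a , f ← next O′ R asc (drop-∷ (↭-trans p (++⁺ʳ R (Remove-↭ rm))))
  = closes i ∷ a , cl θ≤R rm f

fill-column : ∀ {θ y θs ys} → Fillable θs ys → y < θ → Fillable (θ ∷ θs) (y ∷ ys)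
fill-column next y<θ O [] asc p = fill-close next y<θ O [] asc [] p
fill-column {θ} next y<θ O (r ∷ R) (r<R ∷ asc) p with r <? θ
... | yes r<θ with a , f ← fill-column next y<θ (r ∷ O) R asc (↭-trans p (shift r O R)) = opens ∷ a , op r<θ f
... | no r≮θ = fill-close next y<θ O (r ∷ R) (r<R ∷ asc)
      (≮⇒≥ r≮θ ∷ All.map (λ r<z → ≤-trans (≮⇒≥ r≮θ) (<⇒≤ r<z)) r<R) p

fill : ∀ {θs ys} → Pointwise _<_ ys θs → Fillable θs ys
fill [] O R asc p
  with refl ← ++-conicalˡ O R (↭-empty-inv (↭-sym p)) | refl ← ++-conicalʳ O R (↭-empty-inv (↭-sym p)) = [] , done
fill (lt ∷ pw) = fill-column (fill pw) lt

Fill-values-unique : ∀ {O R θs ys zs a} → Fill O R θs ys a → Fill O R θs zs a → ys ≡ zs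
Fill-values-unique done done = refl
Fill-values-unique (op _ f) (op _ g) = Fill-values-unique f g
Fill-values-unique (cl _ rm f) (cl _ rm′ g) with Remove-unique rm rm′
... | refl , refl = cong (_ ∷_) (Fill-values-unique f g)

record Separated (O R : List ℕ) : Set where
  constructor separated
  field
    desc  : AllPairs _>_ O
    asc   : AllPairs _<_ R
    below : All (λ o → All (o <_) R) O
open Separated

separated-open : ∀ {r O R} → Separated O (r ∷ R) → Separated (r ∷ O) R
separated-open (separated d (r<R ∷ a) b) =
  separated (All.map All.head b ∷ d) a (r<R ∷ All.map All.tail b)

separated-close : ∀ {i y O O′ R} → Remove i O y O′ → Separated O R → Separated O′ R
separated-close rm (separated d a b) =
  separated (AllPairs-⊆ (Remove-⊆ rm) d) a (All-resp-⊆ (Remove-⊆ rm) b)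

Fill-moves-unique : ∀ {O R θs ys a b} → Separated O R → Fill O R θs ys a → Fill O R θs ys b → a ≡ b
Fill-moves-unique s done done = refl
Fill-moves-unique s (op _ f) (op _ g) = cong (opens ∷_) (Fill-moves-unique (separated-open s) f g)
Fill-moves-unique s (op lt f) (cl (le ∷ _) _ _) = ⊥-elim (<⇒≱ lt le)
Fill-moves-unique s (cl (le ∷ _) _ _) (op lt _) = ⊥-elim (<⇒≱ lt le)
Fill-moves-unique s (cl _ rm f) (cl _ rm′ g) with Remove-index-unique (s .desc) rm rm′
... | refl , refl = cong (closes _ ∷_) (Fill-moves-unique (separated-close rm s) f g)

-- Since the bounds ascend, a value below the bound at which it opened is below every later bound
-- too.
Fill-bounded : ∀ {O R θ θs ys a} → Linked _≤_ (θ ∷ θs) → All (_< θ) O → Fill O R (θ ∷ θs) ys a → Pointwise _<_ ys (θ ∷ θs)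
Fill-bounded lk b (op lt f) = Fill-bounded lk (lt ∷ b) f
Fill-bounded {θs = []} lk b (cl _ rm done) = All.lookup b (Remove-member rm) ∷ []
Fill-bounded {θs = _ ∷ _} (θ≤ ∷ lk) b (cl _ rm f) = All.lookup b (Remove-member rm) ∷
  Fill-bounded lk (All.map (λ o<θ → <-≤-trans o<θ θ≤) (All-resp-⊆ (Remove-⊆ rm) b)) f

-- Entries labelled 0 behave as in patience sorting.
Chain : List ℕ → ℕ → ℕ → Set
Chain ys x n = ∃[ c ] ((x ∷ c) ⊆ ys × AllPairs _>_ (x ∷ c) × length (x ∷ c) ≡ n)

data Ranked (ys : List ℕ) : List ℕ → List ℕ → Set where
  []  : Ranked ys [] []
  _∷_ : ∀ {l L x O} → (l ≡ 0 → Chain ys x (suc (cnt 0 L))) → Ranked ys L O → Ranked ys (l ∷ L) (x ∷ O)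

Ranked-longest : ∀ {ys L O} → Ranked ys L O → ∃[ c ] (c ⊆ ys × AllPairs _>_ c × length c ≡ cnt 0 L ×
  (∀ {y} → All (_< y) O → All (_< y) c))
Ranked-longest {ys} [] = [] , minimum ys , [] , refl , λ _ → []
Ranked-longest {ys} (_∷_ {zero} {L} {x} f r) with f refl
... | c , τ , d@(x>c ∷ _) , e = x ∷ c , τ , d , e , λ { (x<y ∷ _) → x<y ∷ All.map (λ z<x → <-trans z<x x<y) x>c }
Ranked-longest (_∷_ {suc l} f r) with c , τ , d , e , b ← Ranked-longest r = c , τ , d , e , λ { (_ ∷ al) → b al }

Chain-weaken : ∀ {ys x n} y → Chain ys x n → Chain (y ∷ ys) x n
Chain-weaken y (c , τ , d , e) = c , y ∷ʳ τ , d , e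

Ranked-weaken : ∀ {ys L O} y → Ranked ys L O → Ranked (y ∷ ys) L O
Ranked-weaken y [] = []
Ranked-weaken y (f ∷ r) = (λ e → Chain-weaken y (f e)) ∷ Ranked-weaken y r

-- At the hit, `y` exceeds the older open values and precedes them in the sequence, so it extends
-- their longest recorded chain. Above the hit a bumped entry ends with a positive label, and an
-- entry labelled 0 is passed only by a positive carry, which leaves the number of zeros below it
-- unchanged.
Ranked-close : ∀ {s L i L′ O y O′ ys} → Close s L i L′ → Remove i O y O′ → AllPairs _>_ O →
  Ranked ys L′ O′ → Ranked (y ∷ ys) L O
Ranked-close {y = y} hit here (y>O ∷ _) r with c , τ , d , e , b ← Ranked-longest r
  = (λ _ → c , refl ∷ τ , b y>O ∷ d , cong suc e) ∷ Ranked-weaken y r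
Ranked-close (bump c) (there rm) (_ ∷ d) (_ ∷ r) = (λ ()) ∷ Ranked-close c rm d r
Ranked-close {ys = ys} (pass {s} {L = L} {L′ = L′} x≢s c) (there {x = x} {y = y} rm) (_ ∷ d) (f ∷ r) =
  (λ { refl → Chain-weaken y (subst (Chain ys x) (cong suc (sym (Adds-there (Close-adds c) (λ e → x≢s (sym e))))) (f refl)) })
  ∷ Ranked-close c rm d r

Fill-Ranked : ∀ {O R θs ys a L} → Separated O R → Run L a → Fill O R θs ys a → Ranked ys L O
Fill-Ranked s done done = []
Fill-Ranked s (op r) (op _ f) with _ ∷ rk ← Fill-Ranked (separated-open s) r f = rk
Fill-Ranked s (cl c r) (cl _ rm f) = Ranked-close c rm (s .desc) (Fill-Ranked (separated-close rm s) r f)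

-- Labels and decreasing chains

-- The history of an open entry lists the times at which the (time-reversed)
-- procedure raised its label, latest first; an entry labelled l has l + 1 of them.
Histories : Set
Histories = List (List ℕ)

-- Label 0 is reached when the entry is inserted, so each time stands above as many older times as
-- the label that it brought.
data At : List ℕ → ℕ → ℕ → Set where
  here  : ∀ {t h} → At (t ∷ h) (length h) t
  there : ∀ {u h s t} → At h s t → At (u ∷ h) s t

At-level : ∀ {h s t} → At h s t → s < length h
At-level here = ≤-refl
At-level (there a) = m<n⇒m<1+n (At-level a)

At-∈ : ∀ {h s t} → At h s t → t ∈ h
At-∈ here = here refl
At-∈ (there a) = there (At-∈ a)

At-next : ∀ {h s t} → AllPairs _>_ h → At h s t → suc s < length h → ∃[ ε ] (At h (suc s) ε × t < ε)
At-next d here lt = ⊥-elim (<-irrefl refl lt)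
At-next {u ∷ h} {s} (u> ∷ d) (there a) lt with suc s ≟ length h
... | yes e = u , subst (λ z → At (u ∷ h) z u) (sym e) here , All.lookup u> (At-∈ a)
... | no ne with ε , a′ , t<ε ← At-next d a (≤∧≢⇒< (≤-pred lt) ne) = ε , there a′ , t<ε

data HClose (τ : ℕ) : ℕ → Histories → ℕ → Histories → Set where
  hit  : ∀ {H} → HClose τ 0 ([ τ ] ∷ H) 0 H
  bump : ∀ {s h H i H′} → length h ≡ suc s → HClose τ s H i H′ → HClose τ (suc s) ((τ ∷ h) ∷ H) (suc i) (h ∷ H′)
  pass : ∀ {s h H i H′} → length h ≢ suc s → HClose τ s H i H′ → HClose τ s (h ∷ H) (suc i) (h ∷ H′)

Labelled : List ℕ → Histories → Set
Labelled = Pointwise (λ l h → length h ≡ suc l)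

lift-Close : ∀ {s L i L′ H′} τ → Close s L i L′ → Labelled L′ H′ → ∃[ H ] (HClose τ s H i H′ × Labelled L H)
lift-Close τ hit lab = _ , hit , refl ∷ lab
lift-Close τ (bump c) (e ∷ lab) with _ , hc , lab′ ← lift-Close τ c lab = _ , bump e hc , cong suc e ∷ lab′
lift-Close τ (pass ne c) (e ∷ lab) with _ , hc , lab′ ← lift-Close τ c lab =
  _ , pass (λ e′ → ne (suc-injective (trans (sym e) e′))) hc , e ∷ lab′

Past : ℕ → Histories → Set
Past τ = All (All (_< τ))

Sorted-histories : Histories → Set
Sorted-histories = All (AllPairs _>_)

HClose-sorted : ∀ {τ s H i H′} → HClose τ s H i H′ → Past τ H′ → Sorted-histories H′ → Sorted-histories H
HClose-sorted hit p d = ([] ∷ []) ∷ d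
HClose-sorted (bump _ c) (p ∷ ps) (d ∷ ds) = (p ∷ d) ∷ HClose-sorted c ps ds
HClose-sorted (pass _ c) (p ∷ ps) (d ∷ ds) = d ∷ HClose-sorted c ps ds

HClose-past : ∀ {τ s H i H′} → HClose τ s H i H′ → Past τ H′ → Past (suc τ) H
HClose-past hit ps = (≤-refl ∷ []) ∷ All.map (All.map m<n⇒m<1+n) ps
HClose-past (bump _ c) (p ∷ ps) = (≤-refl ∷ All.map m<n⇒m<1+n p) ∷ HClose-past c ps
HClose-past (pass _ c) (p ∷ ps) = All.map m<n⇒m<1+n p ∷ HClose-past c ps

Raised : ℕ → ℕ → ℕ → List ℕ → Set
Raised s t u h = ∃[ ε ] (At h (suc s) ε × t < ε × ε ≤ u)

-- An older entry that reached level s at time u must be preceded by an entry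
-- that satisfies Raised s t u, or else F holds.
Covered : ℕ → ℕ → ℕ → Set → Histories → Set
Covered s t u F [] = ⊤
Covered s t u F (h ∷ H) = (At h s u → F) × Covered s t u (F ⊎ Raised s t u h) H

-- Whenever two open entries reached level s at times t < u, the older one at
-- time u, some entry between them reached level s + 1 at a time in (t , u]:
-- the carry released by the older entry cannot pass the younger one.
Interlaced : Histories → Set
Interlaced [] = ⊤
Interlaced (h ∷ H) = Interlaced H × (∀ s t u → At h s t → t < u → Covered s t u (Raised s t u h) H)

covered-map : ∀ {s t u F G} H → (F → G) → Covered s t u F H → Covered s t u G H
covered-map [] f _ = tt
covered-map (h ∷ H) f (a , c) = f ∘ a , covered-map H (λ { (inj₁ x) → inj₁ (f x) ; (inj₂ y) → inj₂ y }) c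

covered-true : ∀ {s t u F} H → F → Covered s t u F H
covered-true [] f = tt
covered-true (h ∷ H) f = (λ _ → f) , covered-true H (inj₁ f)

covered-future : ∀ {s t u F} H → Past u H → Covered s t u F H
covered-future [] _ = tt
covered-future (h ∷ H) (p ∷ ps) = (λ a → ⊥-elim (<-irrefl refl (All.lookup p (At-∈ a)))) , covered-future H ps

raised-there : ∀ {s t u τ h} → Raised s t u h → Raised s t u (τ ∷ h)
raised-there (ε , a , r) = ε , there a , r

covered-past : ∀ {τ c M i M′ s t u F G} → HClose τ c M i M′ → u < τ → (F → G) →
  Covered s t u F M′ → Covered s t u G M
covered-past {M = _ ∷ M} hit u<τ f cov = (λ { here → ⊥-elim (<-irrefl refl u<τ) ; (there ()) }) , covered-map M (λ x → inj₁ (f x)) cov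
covered-past (bump _ c) u<τ f (a , cov) =
  (λ { here → ⊥-elim (<-irrefl refl u<τ) ; (there x) → f (a x) }) ,
  covered-past c u<τ (λ { (inj₁ x) → inj₁ (f x) ; (inj₂ y) → inj₂ (raised-there y) }) cov
covered-past (pass _ c) u<τ f (a , cov) =
  f ∘ a , covered-past c u<τ (λ { (inj₁ x) → inj₁ (f x) ; (inj₂ y) → inj₂ y }) cov

-- An older entry raised to level s at time τ sends on the carry s. If the carry arriving at this
-- point is another one, an entry in between was raised to level s + 1 at the same time.
covered-now : ∀ {τ c M i M′ s t F} → HClose τ c M i M′ → Past τ M′ → c ≢ s → t < τ → Covered s t τ F M
covered-now {M = _ ∷ M} hit ps c≢s t<τ = (λ { here → ⊥-elim (c≢s refl) ; (there ()) }) , covered-future M ps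
covered-now {τ} {M = _ ∷ M} {s = s} (bump {c} {h} e hc) (p ∷ ps) c≢s t<τ =
  (λ { here → ⊥-elim (c≢s (sym e)) ; (there a) → ⊥-elim (<-irrefl refl (All.lookup p (At-∈ a))) }) , rest
  where
  rest : Covered s _ τ _ M
  rest with c ≟ s
  ... | yes refl = covered-true M (inj₂ (τ , subst (λ z → At (τ ∷ h) z τ) e here , t<τ , ≤-refl))
  ... | no c′≢s = covered-now hc ps c′≢s t<τ
covered-now (pass _ hc) (p ∷ ps) c≢s t<τ =
  (λ a → ⊥-elim (<-irrefl refl (All.lookup p (At-∈ a)))) , covered-now hc ps c≢s t<τ

past-weaken : ∀ {τ u H} → τ ≤ u → Past τ H → Past u H
past-weaken τ≤u = All.map (All.map (λ x<τ → <-≤-trans x<τ τ≤u))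

-- Only the case u = τ is new. A younger entry beyond level s rose to s + 1 between t and τ. One
-- still at level s is either raised now, or passed by a carry different from s, and then
-- `covered-now` applies.
HClose-interlaced : ∀ {τ s H i H′} → HClose τ s H i H′ → Past τ H′ → Sorted-histories H′ → Interlaced H′ → Interlaced H
HClose-interlaced {H′ = H′} hit ps ds il = il , λ where
  .0 t u here t<u → covered-future H′ (past-weaken (<⇒≤ t<u) ps)
  s t u (there ()) t<u
HClose-interlaced {τ} (bump {c} {h} {M} e hc) (p ∷ ps) (d ∷ ds) (il , cov) =
  HClose-interlaced hc ps ds il , new
  where
  new : ∀ s t u → At (τ ∷ h) s t → t < u → Covered s t u (Raised s t u (τ ∷ h)) M
  new s t u a t<u with <-cmp u τ
  new s t u here t<u | tri< u<τ _ _ = ⊥-elim (<-irrefl refl (<-trans u<τ t<u))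
  new s t u (there a) t<u | tri< u<τ _ _ = covered-past hc u<τ raised-there (cov s t u a t<u)
  new s t u here t<u | tri≈ _ refl _ = ⊥-elim (<-irrefl refl t<u)
  new s t u (there a) t<u | tri≈ _ refl _ with suc s <? length h
  ... | yes lt with ε , a′ , t<ε ← At-next d a lt =
        covered-true M (ε , there a′ , t<ε , <⇒≤ (All.lookup p (At-∈ a′)))
  ... | no ¬lt = covered-true M (τ , subst (λ z → At (τ ∷ h) z τ) (≤-antisym (≮⇒≥ ¬lt) (At-level a)) here , t<u , ≤-refl)
  new s t u a t<u | tri> _ _ τ<u = covered-future M (past-weaken τ<u (HClose-past hc ps))
HClose-interlaced {τ} (pass {c} {h} {M} ne hc) (p ∷ ps) (d ∷ ds) (il , cov) =
  HClose-interlaced hc ps ds il , new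
  where
  new : ∀ s t u → At h s t → t < u → Covered s t u (Raised s t u h) M
  new s t u a t<u with <-cmp u τ
  ... | tri< u<τ _ _ = covered-past hc u<τ id (cov s t u a t<u)
  ... | tri> _ _ τ<u = covered-future M (past-weaken τ<u (HClose-past hc ps))
  ... | tri≈ _ refl _ with suc s <? length h
  ...   | yes lt with ε , a′ , t<ε ← At-next d a lt =
          covered-true M (ε , a′ , t<ε , <⇒≤ (All.lookup p (At-∈ a′)))
  ...   | no ¬lt = covered-now hc ps (λ { refl → ne (≤-antisym (≮⇒≥ ¬lt) (At-level a)) }) t<u

-- Going down the list the entries get smaller and the times later. Times are counted from the end
-- of the run, so for s = 0 a climb is an increasing chain of the sequence, read backwards.
data Climb (s : ℕ) : ℕ → Histories → ℕ → Set where
  stop : ∀ {lo H} → Climb s lo H 0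
  skip : ∀ {lo h H n} → Climb s lo H n → Climb s lo (h ∷ H) n
  climb : ∀ {lo h H n t} → At h s t → lo < t → Climb s t H n → Climb s lo (h ∷ H) (suc n)

climb-weaken : ∀ {s lo lo′ H n} → lo′ ≤ lo → Climb s lo H n → Climb s lo′ H n
climb-weaken le stop = stop
climb-weaken le (skip c) = skip (climb-weaken le c)
climb-weaken le (climb a lt c) = climb a (≤-<-trans le lt) c

mutual
  -- Two consecutive members of a climb at level s, with times t < u, have by `Interlaced` an entry
  -- between them raised to s + 1 in (t , u]. These intervals are disjoint, so the new entries climb
  -- again; only one member is lost.
  climb-next : ∀ {s t h H n} → Interlaced (h ∷ H) → At h s t → Climb s t H n → Climb (suc s) t (h ∷ H) n
  climb-next {n = zero} _ _ _ = stop
  climb-next {s} {t} {h} {n = suc n} (il , cov) a c with climb-between (λ u → Raised s t u h) il (λ u t<u → cov s t u a t<u) c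
  ... | inj₁ (u , (ε , a′ , t<ε , ε≤u) , c′) = climb a′ t<ε (climb-weaken ε≤u c′)
  ... | inj₂ c′ = skip c′

  -- `F u` stands for a suitable entry among those already passed. Whether it is used is known only
  -- when the next member of the climb, and with it u, is reached; hence the two outcomes.
  climb-between : ∀ {s t H n} (F : ℕ → Set) → Interlaced H → (∀ u → t < u → Covered s t u (F u) H) →
    Climb s t H (suc n) → (∃[ u ] (F u × Climb (suc s) u H n)) ⊎ Climb (suc s) t H (suc n)
  climb-between F il cov (climb {t = u} a t<u c) = inj₁ (u , proj₁ (cov u t<u) a , climb-next il a c)
  climb-between {s} {t} F (il , _) cov (skip {h = x} c)
    with climb-between (λ u → F u ⊎ Raised s t u x) il (λ u t<u → proj₂ (cov u t<u)) c
  ... | inj₁ (u , inj₁ f , c′) = inj₁ (u , f , skip c′)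
  ... | inj₁ (u , inj₂ (ε , a , t<ε , ε≤u) , c′) = inj₂ (climb a t<ε (climb-weaken ε≤u c′))
  ... | inj₂ c′ = inj₂ (skip c′)

climb-up : ∀ {s lo H n} → Interlaced H → Climb s lo H (suc n) → Climb (suc s) lo H n
climb-up (il , _) (skip c) = skip (climb-up il c)
climb-up il (climb a lo<t c) = climb-weaken (<⇒≤ lo<t) (climb-next il a c)

-- Half of Schensted's theorem: n + 1 visits to one row at increasing times by ever smaller values
-- cause n such visits to the next row, and so on down to a single visit n rows further.
climb-level : ∀ {s lo H} n → Interlaced H → Climb s lo H (suc n) → Any (λ h → n + s < length h) H
climb-level zero il (skip c) = there (climb-level zero (proj₁ il) c)
climb-level zero il (climb a _ _) = here (At-level a)
climb-level {s} {H = H} (suc n) il c = subst (λ z → Any (λ h → z < length h) H) (+-suc n s) (climb-level n il (climb-up il c))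

-- The time of a closing is counted from the end of the run.
data ClosedAt : List ℕ → ℕ → ℕ → Set where
  here  : ∀ {y ys} → ClosedAt (y ∷ ys) y (suc (length ys))
  there : ∀ {z ys y τ} → ClosedAt ys y τ → ClosedAt (z ∷ ys) y τ

ClosedAt-∈ : ∀ {ys y τ} → ClosedAt ys y τ → y ∈ ys
ClosedAt-∈ here = here refl
ClosedAt-∈ (there c) = there (ClosedAt-∈ c)

ClosedAt-unique : ∀ {ys y τ σ} → Unique ys → ClosedAt ys y τ → ClosedAt ys y σ → τ ≡ σ
ClosedAt-unique u here here = refl
ClosedAt-unique (y∉ ∷ _) here (there c) = ⊥-elim (All.lookup y∉ (ClosedAt-∈ c) refl)
ClosedAt-unique (y∉ ∷ _) (there c) here = ⊥-elim (All.lookup y∉ (ClosedAt-∈ c) refl)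
ClosedAt-unique (_ ∷ u) (there c) (there d) = ClosedAt-unique u c d

record Traced (O ys K : List ℕ) : Set where
  constructor traced
  field
    histories  : Histories
    labelled   : Labelled K histories
    interlaced : Interlaced histories
    sorted     : Sorted-histories histories
    past       : Past (suc (length ys)) histories
    closing    : Pointwise (λ y h → ∃[ τ ] (ClosedAt ys y τ × At h 0 τ)) O histories
open Traced

Fill-Traced : ∀ {O R θs ys a K} → Run K a → Fill O R θs ys a → Traced O ys K
Fill-Traced done done = traced [] [] tt [] [] []
Fill-Traced (op r) (op _ f) with traced _ (_ ∷ l) (i , _) (_ ∷ s) (_ ∷ p) (_ ∷ c) ← Fill-Traced r f
  = traced _ l i s p c
Fill-Traced {ys = y ∷ ys} (cl c r) (cl _ rm f)
  with traced H l i s p cs ← Fill-Traced r f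
  with H⁺ , hc , l⁺ ← lift-Close (suc (length ys)) c l
  = traced H⁺ l⁺ (HClose-interlaced hc p s i) (HClose-sorted hc p s) (HClose-past hc p) (closings hc rm cs)
  where
  later : ∀ {O H} → Pointwise (λ y h → ∃[ τ ] (ClosedAt ys y τ × At h 0 τ)) O H →
    Pointwise (λ z h → ∃[ τ ] (ClosedAt (y ∷ ys) z τ × At h 0 τ)) O H
  later [] = []
  later ((τ , x , a) ∷ pw) = (τ , there x , a) ∷ later pw
  closings : ∀ {s H i H′ O O′} → HClose (suc (length ys)) s H i H′ → Remove i O y O′ →
    Pointwise (λ y h → ∃[ τ ] (ClosedAt ys y τ × At h 0 τ)) O′ H′ →
    Pointwise (λ z h → ∃[ τ ] (ClosedAt (y ∷ ys) z τ × At h 0 τ)) O H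
  closings hit here pw = (_ , here , here) ∷ later pw
  closings (bump _ hc) (there rm) ((τ , x , a) ∷ pw) = (τ , there x , there a) ∷ closings hc rm pw
  closings (pass _ hc) (there rm) ((τ , x , a) ∷ pw) = (τ , there x , a) ∷ closings hc rm pw

data Earlier (ys : List ℕ) : ℕ → List ℕ → Set where
  []  : ∀ {lo} → Earlier ys lo []
  _∷_ : ∀ {lo y τ e} → ClosedAt ys y τ × lo < τ → Earlier ys τ e → Earlier ys lo (y ∷ e)

earlier-weaken : ∀ {ys lo lo′ e} → lo′ ≤ lo → Earlier ys lo e → Earlier ys lo′ e
earlier-weaken le [] = []
earlier-weaken le ((c , lt) ∷ e) = (c , ≤-<-trans le lt) ∷ e

reverse-staircase : ∀ {ys c zs acc} → (∀ {y τ} → ClosedAt zs y τ → ClosedAt ys y τ) → c ⊆ zs →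
  AllPairs _<_ c → All (λ x → All (_< x) acc) c → AllPairs _>_ acc →
  Earlier ys (length zs) acc → Earlier ys 0 (c ʳ++ acc) × AllPairs _>_ (c ʳ++ acc)
reverse-staircase f [] _ _ d e = e , d
reverse-staircase f (z ∷ʳ τ) asc above d e =
  reverse-staircase (f ∘ there) τ asc above d (earlier-weaken (n≤1+n _) e)
reverse-staircase f (refl ∷ τ) (x<c ∷ asc) (acc<x ∷ above) d e =
  reverse-staircase (f ∘ there) τ asc (All.zipWith (λ { (p , q) → p ∷ q }) (x<c , above)) (acc<x ∷ d)
    ((f here , ≤-refl) ∷ e)

climb-closings : ∀ {ys O H lo e} → Unique ys → AllPairs _>_ O →
  Pointwise (λ y h → ∃[ τ ] (ClosedAt ys y τ × At h 0 τ)) O H →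
  AllPairs _>_ e → All (_∈ O) e → Earlier ys lo e → Climb 0 lo H (length e)
climb-closings u dO pw [] [] [] = stop
climb-closings u (x>O ∷ dO) ((τ , c , a) ∷ pw) (y>e ∷ de) (here refl ∷ m) ((c′ , lo<τ) ∷ er)
  with refl ← ClosedAt-unique u c c′
  = climb a lo<τ (climb-closings u dO pw de (All.zipWith (λ { (lt , here refl) → ⊥-elim (<-irrefl refl lt) ; (_ , there z) → z }) (y>e , m)) er)
climb-closings u (x>O ∷ dO) (_ ∷ pw) (y>e ∷ de) (there y∈O ∷ m) er =
  skip (climb-closings u dO pw (y>e ∷ de) (y∈O ∷ All.zipWith smaller (y>e , m)) er)
  where
  smaller : ∀ {z} → _ × z ∈ _ → z ∈ _
  smaller (lt , here refl) = ⊥-elim (<-asym lt (All.lookup x>O y∈O))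
  smaller (_ , there z) = z

-- Increasing chains inside the board

NoDecreasing NoIncreasing : ℕ → List ℕ → Set
NoDecreasing b ys = ∀ {c} → c ⊆ ys → AllPairs _>_ c → length c ≢ b
NoIncreasing b ys = ∀ {c} → c ⊆ ys → AllPairs _<_ c → length c ≢ b

noDecreasing-⊆ : ∀ {b xs ys} → xs ⊆ ys → NoDecreasing b ys → NoDecreasing b xs
noDecreasing-⊆ τ nd σ = nd (⊆-trans σ τ)

noDecreasing-< : ∀ {b ys} → NoDecreasing b ys → ∀ {c} → c ⊆ ys → AllPairs _>_ c → length c < b
noDecreasing-< {b} nd {c} τ d with b ≤? length c
... | yes b≤ = ⊥-elim (nd (⊆-trans (take-⊆ b c) τ) (AllPairs-⊆ (take-⊆ b c) d) (trans (length-take b c) (m≤n⇒m⊓n≡m b≤)))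
... | no b≰ = ≰⇒> b≰

Labelled-any : ∀ {K H n} → Labelled K H → Any (λ h → n < length h) H → Any (n ≤_) K
Labelled-any {n = n} (e ∷ _) (here lt) = here (≤-pred (subst (n <_) e lt))
Labelled-any (_ ∷ l) (there a) = there (Labelled-any l a)

cnt-any : ∀ {K n} → Any (n ≤_) K → ∃[ l ] (n ≤ l × 0 < cnt l K)
cnt-any {x ∷ K} (here le) = x , le , subst (0 <_) (sym (cnt-here x K)) (s≤s z≤n)
cnt-any {x ∷ K} (there a) with l , le , pos ← cnt-any a = l , le , <-≤-trans pos (m≤n+m _ (δ x l))

-- An increasing chain whose bounding rectangle lies in the board. The bounds will ascend, so the
-- bound of the chain's first column decides.
data Violation (b : ℕ) : List ℕ → List ℕ → Set where
  here  : ∀ {θ θs x c ys} → c ⊆ ys → AllPairs _<_ (x ∷ c) → All (_< θ) (x ∷ c) → length (x ∷ c) ≡ b →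
          Violation b (θ ∷ θs) (x ∷ ys)
  there : ∀ {θ θs y ys} → Violation b θs ys → Violation b (θ ∷ θs) (y ∷ ys)

open-increasing : ∀ {Q ys K c x} → AllPairs _>_ Q → Unique ys → Traced Q ys K → x ∷ c ⊆ ys → AllPairs _<_ (x ∷ c) →
  All (_∈ Q) (x ∷ c) → ∃[ l ] (length c ≤ l × 0 < cnt l K)
open-increasing {Q} {ys} {K} {c} {x} dQ u tr τ asc mem
  with er , d ← reverse-staircase id τ asc (All.universal (λ _ → []) _) [] []
  = cnt-any (Labelled-any (tr .labelled)
      (subst (λ z → Any (λ h → z < length h) (tr .histories)) (+-identityʳ (length c)) (climb-level (length c) (tr .interlaced)
        (subst (Climb 0 0 (tr .histories)) (length-reverse (x ∷ c))
          (climb-closings u dQ (tr .closing) d (All-resp-↭ (↭-sym (↭-reverse (x ∷ c))) mem) er)))))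

-- When the first column of a violation is about to close, all values of the chain are below its
-- bound and hence open together. They force a label at least b - 1 in `K`; transposed, `L` has b
-- labels 0, and these yield a decreasing chain of length b in `ys`.
no-violation : ∀ {b O Q R θs ys ys′ a a′ L K} → Conjugate L K → Dual L a K a′ →
  Fill O R θs ys a → Fill Q R θs ys′ a′ → Separated O R → Separated Q R →
  Unique ys′ → NoDecreasing b ys → ¬ Violation b θs ys′
no-violation _ done done done _ _ _ _ ()
no-violation cj (op e₁ e₂ d) (op _ f) (op _ g) sO sQ u nd v =
  no-violation (addBox (adds λ _ → refl) (adds λ _ → refl) e₁ e₂ cj) d f g (separated-open sO) (separated-open sQ) u nd v
no-violation cj (cl e₁ e₂ c c′ d) (cl _ rm f) (cl _ rm′ g) sO sQ (_ ∷ u) nd (there v) =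
  no-violation (removeBox (Close-adds c) (Close-adds c′) e₁ e₂ cj) d f g
    (separated-close rm sO) (separated-close rm′ sQ) u (noDecreasing-⊆ (_ ∷ʳ ⊆-refl) nd) v
no-violation {Q = Q} cj d f@(cl _ _ _) g@(cl θ≤R _ _) sO sQ u nd (here {θ} {x = x} {c} {ys} τ asc bd refl)
  with l , le , pos ← open-increasing (sQ .desc) u (Fill-Traced (Dual-right d) g) (refl ∷ τ) asc
         (All.zipWith (λ { (m , lt) → next-open Q θ≤R (∈-resp-↭ (Fill-↭ g) m) lt })
           (All.tabulate (λ m → Any-resp-⊆ (refl ∷ τ) m) , bd))
  with _ , σ , dec , e , _ ← Ranked-longest (Fill-Ranked sO (Dual-left d) f)
  = <⇒≱ (noDecreasing-< nd σ dec) (≤-trans (≤-trans (s≤s le) (cj .from 0 l pos)) (≤-reflexive (sym e)))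

-- Partner fillings

unique-↭ : ∀ {xs ys : List ℕ} → xs ↭ ys → Unique xs → Unique ys
unique-↭ _↭_.refl u = u
unique-↭ (prep x p) (x∉ ∷ u) = All-resp-↭ p x∉ ∷ unique-↭ p u
unique-↭ (swap x y p) ((x≢y ∷ x∉) ∷ y∉ ∷ u) = ((x≢y ∘ sym) ∷ All-resp-↭ p y∉) ∷ All-resp-↭ p x∉ ∷ unique-↭ p u
unique-↭ (_↭_.trans p q) u = unique-↭ q (unique-↭ p u)

ascending-unique : ∀ {xs ys} → AllPairs _<_ xs → AllPairs _<_ ys → xs ↭ ys → xs ≡ ys
ascending-unique {[]} {ys} _ _ p = sym (↭-empty-inv (↭-sym p))
ascending-unique {x ∷ xs} {[]} _ _ p with () ← ↭-empty-inv p
ascending-unique {x ∷ xs} {y ∷ ys} (x< ∷ a) (y< ∷ b) p with ∈-resp-↭ p (here refl) | ∈-resp-↭ (↭-sym p) (here refl)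
... | here refl | _ = cong (x ∷_) (ascending-unique a b (drop-∷ p))
... | there _ | here refl = cong (x ∷_) (ascending-unique a b (drop-∷ p))
... | there m | there m′ = ⊥-elim (<-asym (All.lookup y< m) (All.lookup x< m′))

ascend : ∀ ys → Unique ys → ∃[ R ] (R ↭ ys × AllPairs _<_ R)
ascend ys u = sort ys , sort-↭ ys , strict (unique-↭ (↭-sym (sort-↭ ys)) u) (Linked⇒AllPairs ≤-trans (sort-↗ ys))
  where
  open import Data.List.Sort ≤-decTotalOrder using (sort; sort-↭; sort-↗)
  strict : ∀ {xs} → Unique xs → AllPairs _≤_ xs → AllPairs _<_ xs
  strict [] [] = []
  strict (x∉ ∷ u) (x≤ ∷ a) = All.zipWith (λ { (ne , le) → ≤∧≢⇒< le ne }) (x∉ , x≤) ∷ strict u a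

record Partner (θs ys ys′ : List ℕ) : Set where
  constructor partner
  field
    {values}     : List ℕ
    {left right} : List Move
    isAscending  : AllPairs _<_ values
    fillˡ        : Fill [] values θs ys left
    fillʳ        : Fill [] values θs ys′ right
    dual         : Dual [] left [] right
open Partner

partner-exists : ∀ {θs ys} → Unique ys → Pointwise _<_ ys θs → ∃[ ys′ ] Partner θs ys ys′
partner-exists {θs} {ys} u pw
  with R , p , asc ← ascend ys u
  with a , f ← fill pw [] R asc (↭-sym p)
  with [] , r , refl ← Fill-Run f
  with a′ , d ← dualize r (conjugate (λ _ _ ()) (λ _ _ ())) []
  with ys′ , f′ ← refill {Q = []} f d refl
  = ys′ , partner asc f f′ d

partner-↭ : ∀ {θs ys ys′} → Partner θs ys ys′ → ys′ ↭ ys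
partner-↭ (partner _ f f′ _) = ↭-trans (Fill-↭ f′) (↭-sym (Fill-↭ f))

partner-bounded : ∀ {θs ys ys′} → Linked _≤_ θs → Partner θs ys ys′ → Pointwise _<_ ys′ θs
partner-bounded _ (partner _ _ done _) = []
partner-bounded lk (partner _ _ f@(op _ _) _) = Fill-bounded lk [] f
partner-bounded lk (partner _ _ f@(cl _ _ _) _) = Fill-bounded lk [] f

separated-start : ∀ {R} → AllPairs _<_ R → Separated [] R
separated-start a = separated [] a []

partner-injective : ∀ {θs xs ys zs} → Partner θs xs zs → Partner θs ys zs → xs ≡ ys
partner-injective (partner a₁ f₁ g₁ d₁) (partner a₂ f₂ g₂ d₂)
  with refl ← ascending-unique a₁ a₂ (↭-trans (↭-sym (Fill-↭ g₁)) (Fill-↭ g₂))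
  with refl ← Fill-moves-unique (separated-start a₁) g₁ g₂
  with refl ← Dual-injective d₁ d₂
  = Fill-values-unique f₁ f₂

partner-avoids : ∀ {b θs ys ys′} → Unique ys → Partner θs ys ys′ → NoDecreasing b ys → ¬ Violation b θs ys′
partner-avoids u p@(partner a f g d) nd =
  no-violation (conjugate (λ _ _ ()) (λ _ _ ())) d f g (separated-start a) (separated-start a) (unique-↭ (↭-sym (partner-↭ p)) u) nd

-- Permutations and patterns as lists

-- A relation takes the place of a function because the images below come out of existential proofs;
-- being total into `zs` and injective is enough.
inject-length : ∀ {A B : Set} {xs : List A} {zs : List B} (_∼_ : A → B → Set) → Unique xs →
  (∀ {x} → x ∈ xs → ∃[ z ] (z ∈ zs × x ∼ z)) →
  (∀ {x y z} → x ∈ xs → y ∈ xs → x ∼ z → y ∼ z → x ≡ y) → length xs ≤ length zs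
inject-length {xs = []} _∼_ u f inj = z≤n
inject-length {xs = x ∷ xs} _∼_ (x∉ ∷ u) f inj with f (here refl)
... | z , z∈ , x∼z with ∈-∃++ z∈
...   | zs₁ , zs₂ , refl = subst (suc (length xs) ≤_) (sym len) (s≤s (inject-length _∼_ u rest λ p q → inj (there p) (there q)))
  where
  len : length (zs₁ ++ z ∷ zs₂) ≡ suc (length (zs₁ ++ zs₂))
  len = trans (length-++ zs₁) (trans (+-suc _ _) (cong suc (sym (length-++ zs₁))))
  rest : ∀ {y} → y ∈ xs → ∃[ w ] (w ∈ zs₁ ++ zs₂ × y ∼ w)
  rest {y} y∈ with w , w∈ , y∼w ← f (there y∈) with ∈-++⁻ zs₁ w∈
  ... | inj₁ w∈₁ = w , ∈-++⁺ˡ w∈₁ , y∼w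
  ... | inj₂ (here refl) = ⊥-elim (All.lookup x∉ y∈ (inj (here refl) (there y∈) x∼z y∼w))
  ... | inj₂ (there w∈₂) = w , ∈-++⁺ʳ zs₁ w∈₂ , y∼w

downs : ℕ → List ℕ
downs = applyDownFrom suc

downs-unique : ∀ n → Unique (downs n)
downs-unique n = Uniqueₚ.applyDownFrom⁺₁ suc n (λ j<i _ e → <-irrefl (sym (suc-injective e)) j<i)

downs-bounded : ∀ n → All (λ v → 1 ≤ v × v ≤ n) (downs n)
downs-bounded n = Allₚ.applyDownFrom⁺₁ suc n (λ i<n → s≤s z≤n , i<n)

insertAll-sound : ∀ {x p} ys → p ∈ insertAll x ys → p ↭ x ∷ ys
insertAll-sound [] (here refl) = ↭-refl
insertAll-sound (y ∷ ys) (here refl) = ↭-refl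
insertAll-sound {x} (y ∷ ys) (there m) with q , q∈ , refl ← ∈-map⁻ (y ∷_) m
  = ↭-trans (prep y (insertAll-sound ys q∈)) (swap y x ↭-refl)

insertAll-complete : ∀ x ys zs → ys ++ x ∷ zs ∈ insertAll x (ys ++ zs)
insertAll-complete x [] [] = here refl
insertAll-complete x [] (z ∷ zs) = here refl
insertAll-complete x (y ∷ ys) zs = there (∈-map⁺ (y ∷_) (insertAll-complete x ys zs))

perms-sound : ∀ n {p} → p ∈ perms n → p ↭ downs n
perms-sound zero (here refl) = ↭-refl
perms-sound (suc n) m with find (∈-concatMap⁻ (insertAll (suc n)) {xs = perms n} m)
... | q , q∈ , p∈ = ↭-trans (insertAll-sound q p∈) (prep (suc n) (perms-sound n q∈))

perms-complete : ∀ n {p} → p ↭ downs n → p ∈ perms n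
perms-complete zero p↭ with refl ← ↭-empty-inv p↭ = here refl
perms-complete (suc n) p↭ with ys , zs , refl ← ∈-∃++ (∈-resp-↭ (↭-sym p↭) (here refl))
  = ∈-concatMap⁺ (insertAll (suc n)) (lose (perms-complete n (drop-mid ys [] p↭)) (insertAll-complete (suc n) ys zs))

insertAll-unique : ∀ {x} ys → x ∉ ys → Unique (insertAll x ys)
insertAll-unique [] _ = [] ∷ []
insertAll-unique {x} (y ∷ ys) x∉ = All.tabulate differ ∷ Uniqueₚ.map⁺ ∷-injectiveʳ (insertAll-unique ys (x∉ ∘ there))
  where
  differ : ∀ {q} → q ∈ map (y ∷_) (insertAll x ys) → x ∷ y ∷ ys ≢ q
  differ m refl with _ , _ , e ← ∈-map⁻ (y ∷_) m = x∉ (here (∷-injectiveˡ e))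

insertAll-injective : ∀ {x p} ys zs → x ∉ ys → x ∉ zs → p ∈ insertAll x ys → p ∈ insertAll x zs → ys ≡ zs
insertAll-injective [] [] _ _ _ _ = refl
insertAll-injective [] (z ∷ zs) _ _ (here refl) (here ())
insertAll-injective [] (z ∷ zs) _ x∉zs (here refl) (there m) with _ , _ , e ← ∈-map⁻ (z ∷_) m = ⊥-elim (x∉zs (here (∷-injectiveˡ e)))
insertAll-injective (y ∷ ys) [] x∉ys _ (there m) (here refl) with _ , _ , e ← ∈-map⁻ (y ∷_) m = ⊥-elim (x∉ys (here (∷-injectiveˡ e)))
insertAll-injective (y ∷ ys) (z ∷ zs) _ _ (here refl) (here e) = ∷-injectiveʳ e
insertAll-injective (y ∷ ys) (z ∷ zs) _ x∉zs (here refl) (there m) with _ , _ , e ← ∈-map⁻ (z ∷_) m = ⊥-elim (x∉zs (here (∷-injectiveˡ e)))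
insertAll-injective (y ∷ ys) (z ∷ zs) x∉ys _ (there m) (here refl) with _ , _ , e ← ∈-map⁻ (y ∷_) m = ⊥-elim (x∉ys (here (∷-injectiveˡ e)))
insertAll-injective (y ∷ ys) (z ∷ zs) x∉ys x∉zs (there m) (there m′)
  with p , p∈ , refl ← ∈-map⁻ (y ∷_) m | q , q∈ , e ← ∈-map⁻ (z ∷_) m′
  with refl ← ∷-injectiveˡ e | refl ← ∷-injectiveʳ e
  = cong (y ∷_) (insertAll-injective ys zs (x∉ys ∘ there) (x∉zs ∘ there) p∈ q∈)

concatMap-unique : ∀ {A B : Set} (f : A → List B) {xs} → Unique xs → (∀ {x} → x ∈ xs → Unique (f x)) →
  (∀ {x y z} → x ∈ xs → y ∈ xs → z ∈ f x → z ∈ f y → x ≡ y) → Unique (concatMap f xs)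
concatMap-unique f [] _ _ = []
concatMap-unique f {x ∷ xs} (x∉ ∷ u) uf inj =
  Uniqueₚ.++⁺ (uf (here refl)) (concatMap-unique f u (uf ∘ there) λ p q → inj (there p) (there q)) disjoint
  where
  disjoint : ∀ {z} → z ∈ f x × z ∈ concatMap f xs → ⊥
  disjoint (z∈ , z∈′) with y , y∈ , z∈″ ← find (∈-concatMap⁻ f {xs = xs} z∈′)
    = All.lookup x∉ y∈ (inj (here refl) (there y∈) z∈ z∈″)

perms-unique : ∀ n → Unique (perms n)
perms-unique zero = [] ∷ []
perms-unique (suc n) = concatMap-unique (insertAll (suc n)) (perms-unique n)
  (λ p∈ → insertAll-unique _ (fresh p∈)) (λ p∈ q∈ → insertAll-injective _ _ (fresh p∈) (fresh q∈))
  where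
  fresh : ∀ {p} → p ∈ perms n → suc n ∉ p
  fresh p∈ m = <-irrefl refl (proj₂ (All.lookup (downs-bounded n) (∈-resp-↭ (perms-sound n p∈) m)))

subseqs-sound : ∀ k p {s} → s ∈ subseqs k p → s ⊆ p × length s ≡ k
subseqs-sound zero p (here refl) = minimum p , refl
subseqs-sound (suc k) (x ∷ p) m with ∈-++⁻ (map (x ∷_) (subseqs k p)) m
... | inj₁ m′ with s , s∈ , refl ← ∈-map⁻ (x ∷_) m′ with τ , e ← subseqs-sound k p s∈ = refl ∷ τ , cong suc e
... | inj₂ m′ with τ , e ← subseqs-sound (suc k) p m′ = x ∷ʳ τ , e

subseqs-complete : ∀ {s p} → s ⊆ p → s ∈ subseqs (length s) p
subseqs-complete [] = here refl
subseqs-complete {[]} (y ∷ʳ τ) = here refl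
subseqs-complete {x ∷ s} {y ∷ p} (y ∷ʳ τ) = ∈-++⁺ʳ (map (y ∷_) (subseqs (length s) p)) (subseqs-complete τ)
subseqs-complete {x ∷ s} {x ∷ p} (refl ∷ τ) = ∈-++⁺ˡ (∈-map⁺ (x ∷_) (subseqs-complete τ))

data Iso : List ℕ → List ℕ → Set where
  []  : Iso [] []
  _∷_ : ∀ {x y xs ys} → Pointwise (λ x′ y′ → (x <ᵇ x′) ≡ (y <ᵇ y′)) xs ys → Iso xs ys → Iso (x ∷ xs) (y ∷ ys)

Iso-length : ∀ {s q} → Iso s q → length s ≡ length q
Iso-length [] = refl
Iso-length (_ ∷ i) = cong suc (Iso-length i)

eqb-sound : ∀ {b c} → T (b eqb c) → b ≡ c
eqb-sound {false} {false} _ = refl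
eqb-sound {true} {true} _ = refl

eqb-complete : ∀ b → T (b eqb b)
eqb-complete false = tt
eqb-complete true = tt

zip-sound : ∀ x y xs ys → length xs ≡ length ys →
  T (all (λ { (x′ , y′) → (x <ᵇ x′) eqb (y <ᵇ y′) }) (zip xs ys)) →
  Pointwise (λ x′ y′ → (x <ᵇ x′) ≡ (y <ᵇ y′)) xs ys
zip-sound x y [] [] _ _ = []
zip-sound x y (x′ ∷ xs) (y′ ∷ ys) e t with h , r ← Equivalence.to T-∧ t
  = eqb-sound h ∷ zip-sound x y xs ys (suc-injective e) r

zip-complete : ∀ {x y xs ys} → Pointwise (λ x′ y′ → (x <ᵇ x′) ≡ (y <ᵇ y′)) xs ys →
  T (all (λ { (x′ , y′) → (x <ᵇ x′) eqb (y <ᵇ y′) }) (zip xs ys))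
zip-complete [] = tt
zip-complete {x} {y} {x′ ∷ _} (e ∷ pw) = Equivalence.from T-∧
  (subst (λ z → T ((x <ᵇ x′) eqb z)) e (eqb-complete (x <ᵇ x′)) , zip-complete pw)

sameOrder-sound : ∀ s q → T (sameOrder s q) → Iso s q
sameOrder-sound [] [] _ = []
sameOrder-sound (x ∷ s) (y ∷ q) t with h , r ← Equivalence.to T-∧ t with i ← sameOrder-sound s q r
  = zip-sound x y s q (Iso-length i) h ∷ i

sameOrder-complete : ∀ {s q} → Iso s q → T (sameOrder s q)
sameOrder-complete [] = tt
sameOrder-complete (pw ∷ i) = Equivalence.from T-∧ (zip-complete pw , sameOrder-complete i)

contains-sound : ∀ p q → T (contains p q) → ∃[ s ] (s ⊆ p × Iso s q)
contains-sound p q t with s , s∈ , so ← find (any⁻ _ (subseqs (length q) p) t)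
  = s , proj₁ (subseqs-sound (length q) p s∈) , sameOrder-sound s q so

contains-complete : ∀ {s} p q → s ⊆ p → Iso s q → T (contains p q)
contains-complete {s} p q τ i = any⁺ _ (lose (subst (λ k → s ∈ subseqs k p) (Iso-length i) (subseqs-complete τ)) (sameOrder-complete i))

-- An occurrence described layer by layer, so that layers can be split off and glued. On distinct
-- entries this agrees with `Iso` to the layered word.
data Occ : List ℕ → List ℕ → Set where
  []    : Occ [] []
  layer : ∀ {a as s₁ s₂} → length s₁ ≡ a → AllPairs _>_ s₁ → All (λ x → All (x <_) s₂) s₁ → Occ as s₂ →
          Occ (a ∷ as) (s₁ ++ s₂)

Avoids : List ℕ → List ℕ → Set
Avoids p as = ∀ {s} → s ⊆ p → ¬ Occ as s

<ᵇ-true : ∀ {m n} → m < n → (m <ᵇ n) ≡ true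
<ᵇ-true lt = Equivalence.to T-≡ (<⇒<ᵇ lt)

<ᵇ-false : ∀ {m n} → ¬ m < n → (m <ᵇ n) ≡ false
<ᵇ-false {m} {n} ¬lt with m <ᵇ n in e
... | false = refl
... | true = ⊥-elim (¬lt (<ᵇ⇒< m n (Equivalence.from T-≡ e)))

<ᵇ-true⁻ : ∀ {m n} → (m <ᵇ n) ≡ true → m < n
<ᵇ-true⁻ {m} {n} e = <ᵇ⇒< m n (Equivalence.from T-≡ e)

<ᵇ-false⁻ : ∀ {m n} → (m <ᵇ n) ≡ false → ¬ m < n
<ᵇ-false⁻ e lt with () ← trans (sym e) (<ᵇ-true lt)

Pointwise-halves : ∀ x y {s₁ s₂ q₁ q₂} → All (y <_) q₂ → Pointwise (λ x′ y′ → (x <ᵇ x′) ≡ (y <ᵇ y′)) (s₁ ++ s₂) (q₁ ++ q₂) →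
  Iso s₁ q₁ → Pointwise (λ x′ y′ → (x <ᵇ x′) ≡ (y <ᵇ y′)) s₁ q₁ × All (x <_) s₂
Pointwise-halves x y y< pw [] = [] , go y< pw
  where
  go : ∀ {s₂ q₂} → All (y <_) q₂ → Pointwise (λ x′ y′ → (x <ᵇ x′) ≡ (y <ᵇ y′)) s₂ q₂ → All (x <_) s₂
  go _ [] = []
  go (lt ∷ al) (e ∷ pw) = <ᵇ-true⁻ (trans e (<ᵇ-true lt)) ∷ go al pw
Pointwise-halves x y y< (e ∷ pw) (_ ∷ i) with pw₁ , x< ← Pointwise-halves x y y< pw i = e ∷ pw₁ , x<

Iso-split : ∀ {s} q₁ {q₂} → All (λ y → All (y <_) q₂) q₁ → Iso s (q₁ ++ q₂) →
  ∃[ s₁ ] ∃[ s₂ ] (s ≡ s₁ ++ s₂ × Iso s₁ q₁ × Iso s₂ q₂ × All (λ x → All (x <_) s₂) s₁)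
Iso-split [] [] i = [] , _ , refl , [] , i , []
Iso-split (y ∷ q₁) (y< ∷ lt) (_∷_ {x} pw i) with s₁ , s₂ , refl , i₁ , i₂ , lt′ ← Iso-split q₁ lt i
  with pw₁ , x< ← Pointwise-halves x y y< pw i₁
  = x ∷ s₁ , s₂ , refl , pw₁ ∷ i₁ , i₂ , x< ∷ lt′

Iso-join : ∀ {s₁ s₂ q₁ q₂} → All (λ y → All (y <_) q₂) q₁ → All (λ x → All (x <_) s₂) s₁ →
  Iso s₁ q₁ → Iso s₂ q₂ → Iso (s₁ ++ s₂) (q₁ ++ q₂)
Iso-join _ _ [] i₂ = i₂
Iso-join {q₂ = q₂} (y< ∷ yl) (x< ∷ xl) (_∷_ {x} {y} pw i) i₂ = glue pw ∷ Iso-join yl xl i i₂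
  where
  cross : ∀ {s₂ q₂} → length s₂ ≡ length q₂ → All (x <_) s₂ → All (y <_) q₂ →
    Pointwise (λ x′ y′ → (x <ᵇ x′) ≡ (y <ᵇ y′)) s₂ q₂
  cross {q₂ = []} _ [] [] = []
  cross e (l ∷ al) (m ∷ bl) = trans (<ᵇ-true l) (sym (<ᵇ-true m)) ∷ cross (suc-injective e) al bl
  glue : ∀ {xs ys} → Pointwise (λ x′ y′ → (x <ᵇ x′) ≡ (y <ᵇ y′)) xs ys →
    Pointwise (λ x′ y′ → (x <ᵇ x′) ≡ (y <ᵇ y′)) (xs ++ _) (ys ++ q₂)
  glue [] = cross (Iso-length i₂) x< y<
  glue (e ∷ pw) = e ∷ glue pw

Iso-decreasing⁻ : ∀ {s q} → AllPairs _>_ q → Unique s → Iso s q → AllPairs _>_ s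
Iso-decreasing⁻ [] _ [] = []
Iso-decreasing⁻ (y> ∷ d) (x∉ ∷ u) (_∷_ {x} {y} pw i) = go x∉ y> pw ∷ Iso-decreasing⁻ d u i
  where
  go : ∀ {s q} → All (x ≢_) s → All (y >_) q → Pointwise (λ x′ y′ → (x <ᵇ x′) ≡ (y <ᵇ y′)) s q → All (x >_) s
  go _ _ [] = []
  go (ne ∷ x∉) (y>y′ ∷ y>) (e ∷ pw) =
    ≤∧≢⇒< (≮⇒≥ (<ᵇ-false⁻ (trans e (<ᵇ-false (<⇒≯ y>y′))))) (ne ∘ sym) ∷ go x∉ y> pw

Iso-decreasing⁺ : ∀ {s q} → length s ≡ length q → AllPairs _>_ s → AllPairs _>_ q → Iso s q
Iso-decreasing⁺ {[]} {[]} _ _ _ = []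
Iso-decreasing⁺ {x ∷ _} {y ∷ _} e (x> ∷ ds) (y> ∷ dq) = go (suc-injective e) x> y> ∷ Iso-decreasing⁺ (suc-injective e) ds dq
  where
  go : ∀ {s q} → length s ≡ length q → All (x >_) s → All (y >_) q → Pointwise (λ x′ y′ → (x <ᵇ x′) ≡ (y <ᵇ y′)) s q
  go {q = []} _ [] [] = []
  go e (l ∷ al) (m ∷ bl) = trans (<ᵇ-false (<⇒≯ l)) (sym (<ᵇ-false (<⇒≯ m))) ∷ go (suc-injective e) al bl

layerAt : ℕ → ℕ → List ℕ
layerAt n a = map (λ j → n + suc j) (applyDownFrom (λ j → j) a)

layerAt-length : ∀ n a → length (layerAt n a) ≡ a
layerAt-length n a = trans (length-map _ (applyDownFrom (λ j → j) a)) (length-applyDownFrom _ a)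

layerAt-decreasing : ∀ n a → AllPairs _>_ (layerAt n a)
layerAt-decreasing n a = AllPairsₚ.map⁺ (AllPairsₚ.applyDownFrom⁺₁ (λ j → j) a (λ j<i _ → +-monoʳ-< n (s≤s j<i)))

layerAt-bounded : ∀ n a → All (_≤ n + a) (layerAt n a)
layerAt-bounded n a = Allₚ.map⁺ (Allₚ.applyDownFrom⁺₁ (λ j → j) a (λ i<a → +-monoʳ-≤ n i<a))

layeredFrom-above : ∀ n as → All (n <_) (layeredFrom n as)
layeredFrom-above n [] = []
layeredFrom-above n (a ∷ as) = Allₚ.++⁺
  (Allₚ.map⁺ (Allₚ.applyDownFrom⁺₁ (λ j → j) a (λ {i} _ → m<m+n n (s≤s z≤n))))
  (All.map (≤-<-trans (m≤m+n n a)) (layeredFrom-above (n + a) as))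

layer-below : ∀ n a as → All (λ y → All (y <_) (layeredFrom (n + a) as)) (layerAt n a)
layer-below n a as = All.map (λ y≤ → All.map (≤-<-trans y≤) (layeredFrom-above (n + a) as)) (layerAt-bounded n a)

unique-++⁻ : ∀ (xs : List ℕ) {ys} → Unique (xs ++ ys) → Unique xs × Unique ys
unique-++⁻ [] u = [] , u
unique-++⁻ (x ∷ xs) (x∉ ∷ u) with u₁ , u₂ ← unique-++⁻ xs u = Allₚ.++⁻ˡ xs x∉ ∷ u₁ , u₂

-- Distinctness matters: `sameOrder` asks only which comparisons `<ᵇ` hold, so equal entries would
-- pass for a descent.
Iso⇒Occ : ∀ n as {s} → Unique s → Iso s (layeredFrom n as) → Occ as s
Iso⇒Occ n [] u [] = []
Iso⇒Occ n (a ∷ as) u i with s₁ , s₂ , refl , i₁ , i₂ , lt ← Iso-split (layerAt n a) (layer-below n a as) i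
  with u₁ , u₂ ← unique-++⁻ s₁ u
  = layer (trans (Iso-length i₁) (layerAt-length n a)) (Iso-decreasing⁻ (layerAt-decreasing n a) u₁ i₁) lt
      (Iso⇒Occ (n + a) as u₂ i₂)

Occ⇒Iso : ∀ n {as s} → Occ as s → Iso s (layeredFrom n as)
Occ⇒Iso n [] = []
Occ⇒Iso n (layer {a} {as} e d lt o) = Iso-join (layer-below n a as) lt
  (Iso-decreasing⁺ (trans e (sym (layerAt-length n a))) d (layerAt-decreasing n a)) (Occ⇒Iso (n + a) o)

avoids-sound : ∀ {p as} → T (avoids p (layered as)) → Avoids p as
avoids-sound {p} {as} t τ o with contains p (layered as) | contains-complete p (layered as) τ (Occ⇒Iso 0 o)
avoids-sound () τ o | true | _

avoids-complete : ∀ {p as} → Unique p → Avoids p as → T (avoids p (layered as))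
avoids-complete {p} {as} u av with contains p (layered as) in e
... | false = tt
... | true with s , τ , i ← contains-sound p (layered as) (Equivalence.from T-≡ e)
  = av τ (Iso⇒Occ 0 as (AllPairs-⊆ τ u) i)

avoiders : ℕ → List ℕ → List (List ℕ)
avoiders n as = filterᵇ (λ p → avoids p (layered as)) (perms n)

perm-unique : ∀ {n p} → p ↭ downs n → Unique p
perm-unique {n} p↭ = unique-↭ (↭-sym p↭) (downs-unique n)

avoiders-unique : ∀ n as → Unique (avoiders n as)
avoiders-unique n as = Uniqueₚ.filter⁺ (λ p → T? (avoids p (layered as))) (perms-unique n)

avoiders-sound : ∀ n as {p} → p ∈ avoiders n as → p ↭ downs n × Avoids p as
avoiders-sound n as p∈ with q , t ← ∈-filter⁻ (λ p → T? (avoids p (layered as))) {xs = perms n} p∈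
  = perms-sound n q , avoids-sound t

avoiders-complete : ∀ n as {p} → p ↭ downs n → Avoids p as → p ∈ avoiders n as
avoiders-complete n as {p} p↭ av = ∈-filter⁺ (λ p → T? (avoids p (layered as))) (perms-complete n p↭)
  (avoids-complete (perm-unique p↭) av)

-- Straightening the first layer

Above : List ℕ → List ℕ → ℕ → Set
Above q r v = ∃[ s ] (s ⊆ r × All (v <_) s × Iso s q)

above-antitone : ∀ {q r u v} → u ≤ v → Above q r v → Above q r u
above-antitone u≤v (s , τ , al , i) = s , τ , All.map (≤-<-trans u≤v) al , i

above-∷ : ∀ {q r v} x → Above q r v → Above q (x ∷ r) v
above-∷ x (s , τ , rest) = s , x ∷ʳ τ , rest

⊆-filter : ∀ {v s r} → s ⊆ r → All (v <_) s → s ⊆ filter (v <?_) r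
⊆-filter [] [] = []
⊆-filter {v} (y ∷ʳ τ) al with v <ᵇ y
... | true = y ∷ʳ ⊆-filter τ al
... | false = ⊆-filter τ al
⊆-filter {v} {x ∷ s} (refl ∷ τ) (lt ∷ al) rewrite <ᵇ-true lt = refl ∷ ⊆-filter τ al

above? : ∀ q r v → Dec (Above q r v)
above? q r v with T? (contains (filter (v <?_) r) q)
... | yes t with s , τ , i ← contains-sound (filter (v <?_) r) q t =
      yes (s , ⊆-trans τ (filter-⊆ (v <?_) r) , All-resp-⊆ τ (Allₚ.all-filter (v <?_) r) , i)
... | no ¬t = no λ { (s , τ , al , i) → ¬t (contains-complete (filter (v <?_) r) q (⊆-filter τ al) i) }

abstract
  -- The height of a column of the Ferrers board. The search runs downwards from `N`, which suffices
  -- because `Above` is antitone in the value; it is abstract because only soundness, completeness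
  -- and monotonicity matter afterwards.
  bound : ℕ → List ℕ → List ℕ → ℕ
  bound N q r with above? q r N
  bound N q r | yes _ = suc N
  bound zero q r | no _ = zero
  bound (suc N) q r | no _ = bound N q r

  bound-sound : ∀ N {q r v} → v < bound N q r → Above q r v
  bound-sound N {q} {r} lt with above? q r N
  bound-sound N lt | yes a = above-antitone (≤-pred lt) a
  bound-sound (suc N) lt | no _ = bound-sound N lt

  bound-complete : ∀ N {q r v} → v ≤ N → Above q r v → v < bound N q r
  bound-complete N {q} {r} v≤ a with above? q r N
  bound-complete N v≤ a | yes _ = s≤s v≤
  bound-complete zero z≤n a | no ¬a = ⊥-elim (¬a a)
  bound-complete (suc N) v≤ a | no ¬a = bound-complete N (≤-pred (≤∧≢⇒< v≤ (λ { refl → ¬a a }))) a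

  bound-≤ : ∀ N q r → bound N q r ≤ suc N
  bound-≤ N q r with above? q r N
  bound-≤ N q r | yes _ = ≤-refl
  bound-≤ zero q r | no _ = z≤n
  bound-≤ (suc N) q r | no _ = m≤n⇒m≤1+n (bound-≤ N q r)

  bound-mono : ∀ N q x r → bound N q r ≤ bound N q (x ∷ r)
  bound-mono N q x r with bound N q r in e
  ... | zero = z≤n
  ... | suc v = bound-complete N {q} {x ∷ r} (≤-pred (subst (_≤ suc N) e (bound-≤ N q r)))
                  (above-∷ x (bound-sound N {q} {r} (subst (v <_) (sym e) ≤-refl)))

module Colours (N : ℕ) (q : List ℕ) where

  θ : List ℕ → ℕ
  θ = bound N q

  -- An entry is blue (true) if q occurs above it among the red entries to its
  -- right.  Blue entries may be rearranged below their bounds without affecting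
  -- the colours.
  data Coloured : List ℕ → List Bool → List ℕ → List ℕ → List ℕ → Set where
    []   : Coloured [] [] [] [] []
    red  : ∀ {v p w r ys θs} → ¬ v < θ r → Coloured p w r ys θs → Coloured (v ∷ p) (false ∷ w) (v ∷ r) ys θs
    blue : ∀ {v p w r ys θs} → v < θ r → Coloured p w r ys θs → Coloured (v ∷ p) (true ∷ w) r (v ∷ ys) (θ r ∷ θs)

  colour : ∀ p → ∃[ w ] ∃[ r ] ∃[ ys ] ∃[ θs ] Coloured p w r ys θs
  colour [] = _ , _ , _ , _ , []
  colour (v ∷ p) with w , r , ys , θs , c ← colour p with v <? θ r
  ... | yes lt = _ , _ , _ , _ , blue lt c
  ... | no ¬lt = _ , _ , _ , _ , red ¬lt c

  colour-unique : ∀ {p w r ys θs w′ r′ ys′ θs′} → Coloured p w r ys θs → Coloured p w′ r′ ys′ θs′ →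
    w ≡ w′ × r ≡ r′ × ys ≡ ys′ × θs ≡ θs′
  colour-unique [] [] = refl , refl , refl , refl
  colour-unique (red _ c) (red _ d) with refl , refl , refl , refl ← colour-unique c d = refl , refl , refl , refl
  colour-unique (blue _ c) (blue _ d) with refl , refl , refl , refl ← colour-unique c d = refl , refl , refl , refl
  colour-unique (red ¬lt c) (blue lt d) with refl , refl , refl , refl ← colour-unique c d = ⊥-elim (¬lt lt)
  colour-unique (blue lt c) (red ¬lt d) with refl , refl , refl , refl ← colour-unique c d = ⊥-elim (¬lt lt)

  uncolour-unique : ∀ {p p′ w r ys θs} → Coloured p w r ys θs → Coloured p′ w r ys θs → p ≡ p′
  uncolour-unique [] [] = refl
  uncolour-unique (red _ c) (red _ d) = cong (_ ∷_) (uncolour-unique c d)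
  uncolour-unique (blue _ c) (blue _ d) = cong (_ ∷_) (uncolour-unique c d)

  recolour : ∀ {p w r ys θs ys′} → Coloured p w r ys θs → Pointwise _<_ ys′ θs → ∃[ p′ ] Coloured p′ w r ys′ θs
  recolour [] [] = [] , []
  recolour (red ¬lt c) pw with p′ , c′ ← recolour c pw = _ , red ¬lt c′
  recolour (blue _ c) (lt ∷ pw) with p′ , c′ ← recolour c pw = _ , blue lt c′

  coloured-↭ : ∀ {p w r ys θs} → Coloured p w r ys θs → p ↭ r ++ ys
  coloured-↭ [] = ↭-refl
  coloured-↭ (red {v} _ c) = prep v (coloured-↭ c)
  coloured-↭ (blue {v} {r = r} {ys} _ c) = ↭-trans (prep v (coloured-↭ c)) (↭-sym (shift v r ys))

  coloured-bounded : ∀ {p w r ys θs} → Coloured p w r ys θs → Pointwise _<_ ys θs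
  coloured-bounded [] = []
  coloured-bounded (red _ c) = coloured-bounded c
  coloured-bounded (blue lt c) = lt ∷ coloured-bounded c

  bounds-below : ∀ {p w r ys θs} → Coloured p w r ys θs → All (_≤ θ r) θs
  bounds-below [] = []
  bounds-below (red {v} {r = r} _ c) = All.map (λ le → ≤-trans le (bound-mono N q v r)) (bounds-below c)
  bounds-below (blue _ c) = ≤-refl ∷ bounds-below c

  bounds-descending : ∀ {p w r ys θs} → Coloured p w r ys θs → AllPairs (λ x y → y ≤ x) θs
  bounds-descending [] = []
  bounds-descending (red _ c) = bounds-descending c
  bounds-descending (blue _ c) = bounds-below c ∷ bounds-descending c

  reds-⊆ : ∀ {p w r ys θs} → Coloured p w r ys θs → r ⊆ p
  reds-⊆ [] = []
  reds-⊆ (red _ c) = refl ∷ reds-⊆ c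
  reds-⊆ (blue _ c) = _ ∷ʳ reds-⊆ c

  red-or-blue : ∀ {p w r ys θs s} → Coloured p w r ys θs → s ⊆ p → s ⊆ r ⊎ Any (Above q r) s
  red-or-blue [] [] = inj₁ []
  red-or-blue (red {v} _ c) (_ ∷ʳ τ) with red-or-blue c τ
  ... | inj₁ σ = inj₁ (v ∷ʳ σ)
  ... | inj₂ a = inj₂ (Any.map (above-∷ v) a)
  red-or-blue (red {v} _ c) (refl ∷ τ) with red-or-blue c τ
  ... | inj₁ σ = inj₁ (refl ∷ σ)
  ... | inj₂ a = inj₂ (there (Any.map (above-∷ v) a))
  red-or-blue (blue _ c) (_ ∷ʳ τ) = red-or-blue c τ
  red-or-blue (blue lt c) (refl ∷ τ) = inj₂ (here (bound-sound N lt))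

  -- If the copy of `q` uses a blue entry z, then z has by definition a copy of `q` in red above it,
  -- and z itself is above v.
  above-reds : ∀ {p w r ys θs v} → Coloured p w r ys θs → Above q p v → Above q r v
  above-reds c (s , τ , al , i) with red-or-blue c τ
  ... | inj₁ σ = s , σ , al , i
  ... | inj₂ a with z , z∈ , ab ← find a = above-antitone (<⇒≤ (All.lookup al z∈)) ab

  -- The last entry of the chain is both its rightmost and its largest, and being blue it has a copy
  -- of `q` above and to the right. So increasing chains of blue entries lie in the board
  -- automatically; decreasing ones need not.
  extend-increasing : ∀ {p w r ys θs x c} → Coloured p w r ys θs → x ∷ c ⊆ ys → AllPairs _<_ (x ∷ c) →
    ∃[ s ] ((x ∷ c) ++ s ⊆ p × Iso s q × All (λ z → All (z <_) s) (x ∷ c))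
  extend-increasing (red {v} _ c) τ asc with s , σ , rest ← extend-increasing c τ asc = s , v ∷ʳ σ , rest
  extend-increasing (blue {v} _ c) (_ ∷ʳ τ) asc with s , σ , rest ← extend-increasing c τ asc = s , v ∷ʳ σ , rest
  extend-increasing {c = []} (blue lt c) (refl ∷ τ) asc with s , σ , al , i ← bound-sound N lt
    = s , refl ∷ ⊆-trans σ (reds-⊆ c) , i , al ∷ []
  extend-increasing {c = y ∷ _} (blue _ c) (refl ∷ τ) ((x<y ∷ _) ∷ asc)
    with s , σ , i , (y<s ∷ al) ← extend-increasing c τ asc
    = s , refl ∷ σ , i , All.map (<-trans x<y) y<s ∷ y<s ∷ al

  -- Bounds descend from left to right, so only the last column of the chain is compared with the
  -- maximum `m`: this is the corner of the chain's rectangle.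
  data Corner (m : ℕ) : List ℕ → List ℕ → List ℕ → Set where
    last : ∀ {θ₀ θs y ys} → m < θ₀ → Corner m [ y ] (θ₀ ∷ θs) (y ∷ ys)
    keep : ∀ {θ₀ θs y ys c} → Corner m c θs ys → Corner m (y ∷ c) (θ₀ ∷ θs) (y ∷ ys)
    skip : ∀ {θ₀ θs y ys c} → Corner m c θs ys → Corner m c (θ₀ ∷ θs) (y ∷ ys)

  corner : ∀ {p w r ys θs x s₁ s₂ m} → Coloured p w r ys θs → (x ∷ s₁) ++ s₂ ⊆ p → Iso s₂ q →
    m ≤ N → All (_≤ m) (x ∷ s₁) → All (m <_) s₂ → Corner m (x ∷ s₁) θs ys
  corner (red _ c) (_ ∷ʳ τ) i m≤ le lt = corner c τ i m≤ le lt
  -- An entry of the layer cannot be red: the copy of `q` above `m` has a red replacement to its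
  -- right.
  corner {s₁ = s₁} (red ¬lt c) (refl ∷ τ) i m≤ (x≤m ∷ _) lt =
    ⊥-elim (¬lt (≤-<-trans x≤m (bound-complete N m≤ (above-reds c (_ , ⊆-trans (⊆-++⁺ˡ s₁ ⊆-refl) τ , lt , i)))))
  corner (blue _ c) (_ ∷ʳ τ) i m≤ le lt = skip (corner c τ i m≤ le lt)
  corner {s₁ = []} (blue _ c) (refl ∷ τ) i m≤ le lt = last (bound-complete N m≤ (above-reds c (_ , τ , lt , i)))
  corner {s₁ = _ ∷ _} (blue _ c) (refl ∷ τ) i m≤ (_ ∷ le) lt = keep (corner c τ i m≤ le lt)

  push-violation : ∀ {b θs ys θs′ ys′} → Pointwise _<_ ys θs → Violation b θs′ ys′ → Violation b (θs ʳ++ θs′) (ys ʳ++ ys′)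
  push-violation [] v = v
  push-violation (_ ∷ pw) v = push-violation pw (there v)

  violation-length : ∀ {b b′ θs ys} → b ≡ b′ → Violation b θs ys → Violation b′ θs ys
  violation-length refl v = v

  corner-violation : ∀ {m c θs ys θs′ ys′ acc} → Pointwise _<_ ys θs → Corner m c θs ys → AllPairs _>_ c → All (_≤ m) c →
    acc ⊆ ys′ → AllPairs _<_ acc → All (_≤ m) acc → All (λ x → All (x <_) acc) c →
    Violation (length c + length acc) (θs ʳ++ θs′) (ys ʳ++ ys′)
  corner-violation (_ ∷ pw) (last m<θ) _ (y≤m ∷ _) τ asc le (y< ∷ _) =
    push-violation pw (here τ (y< ∷ asc) (≤-<-trans y≤m m<θ ∷ All.map (λ z≤m → ≤-<-trans z≤m m<θ) le) refl)
  corner-violation {acc = acc} (_ ∷ pw) (keep {θs = θs} {y} {ys} {c} k) (y> ∷ d) (y≤m ∷ cm) τ asc le (y< ∷ lts) =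
    violation-length (+-suc (length c) (length acc))
      (corner-violation pw k d cm (refl ∷ τ) (y< ∷ asc) (y≤m ∷ le) (All.zipWith (λ { (p , r) → p ∷ r }) (y> , lts)))
  corner-violation (_ ∷ pw) (skip k) d cm τ asc le lts = corner-violation pw k d cm (_ ∷ʳ τ) asc le lts

AllPairs-reverse : ∀ {R : ℕ → ℕ → Set} {xs} → AllPairs R xs → AllPairs (λ x y → R y x) (reverse xs)
AllPairs-reverse {xs = []} [] = []
AllPairs-reverse {R} {x ∷ xs} (p ∷ ps) = subst (AllPairs _) (sym (unfold-reverse x xs))
  (AllPairsₚ.++⁺ (AllPairs-reverse ps) ([] ∷ []) (All.map (_∷ []) (All-resp-↭ (↭-sym (↭-reverse xs)) p)))

Occ-ones : ∀ {as c s k} → length c ≡ k → AllPairs _<_ c → All (λ x → All (x <_) s) c → Occ as s →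
  Occ (replicate k 1 ++ as) (c ++ s)
Occ-ones refl [] [] o = o
Occ-ones refl (x<c ∷ asc) (x<s ∷ al) o = layer refl ([] ∷ []) (Allₚ.++⁺ x<c x<s ∷ []) (Occ-ones refl asc al o)

-- Blue entries are read from right to left, so that the bounds ascend. This reversal turns the
-- missing increasing chains into missing decreasing ones, as `partner-avoids` requires, and turns
-- its conclusion back into the absence of a decreasing layer below a copy of the rest.
S-straighten : ∀ n a as → S n (layered (replicate a 1 ++ as)) ≤ S n (layered (a ∷ as))
S-straighten n zero as = ≤-refl
S-straighten n a@(suc _) as = inject-length _∼_ (avoiders-unique n ones) partner-of injective
  where
  ones = replicate a 1 ++ as
  open Colours n (layered as)

  _∼_ : List ℕ → List ℕ → Set
  p ∼ p′ = ∃[ w ] ∃[ r ] ∃[ ys ] ∃[ θs ] ∃[ zs ]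
    (Coloured p w r ys θs × Partner (reverse θs) (reverse ys) zs × Coloured p′ w r (reverse zs) θs)

  injective : ∀ {p₁ p₂ p′} → p₁ ∈ avoiders n ones → p₂ ∈ avoiders n ones → p₁ ∼ p′ → p₂ ∼ p′ → p₁ ≡ p₂
  injective _ _ (_ , _ , ys₁ , _ , zs₁ , c₁ , q₁ , d₁) (_ , _ , ys₂ , _ , zs₂ , c₂ , q₂ , d₂)
    with refl , refl , e , refl ← colour-unique d₁ d₂
    with refl ← reverse-injective {x = zs₁} {zs₂} e
    with refl ← reverse-injective {x = ys₁} {ys₂} (partner-injective q₁ q₂)
    = uncolour-unique c₁ c₂

  no-increasing : ∀ {p w r ys θs} → Unique p → Avoids p ones → Coloured p w r ys θs → NoIncreasing a ys
  no-increasing u av c {_ ∷ _} τ asc e with s , σ , i , al ← extend-increasing c τ asc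
    = av σ (Occ-ones e asc al (Iso⇒Occ 0 as (AllPairs-⊆ (⊆-trans (⊆-++⁺ˡ _ ⊆-refl) σ) u) i))

  no-decreasing : ∀ {ys} → NoIncreasing a ys → NoDecreasing a (reverse ys)
  no-decreasing {ys} ni {c} τ d e = ni (subst (reverse c ⊆_) (reverse-involutive ys) (reverse⁺ τ))
    (AllPairs-reverse d) (trans (length-reverse c) e)

  avoids-layer : ∀ {p w r ys θs} → All (_≤ n) p → Coloured p w r ys θs →
    ¬ Violation a (reverse θs) (reverse ys) → Avoids p (a ∷ as)
  avoids-layer p≤n c ¬v τ (layer {s₁ = x ∷ s₁} e d@(x> ∷ _) (x< ∷ lt) o) = ¬v
    (violation-length (trans (+-identityʳ _) e)
      (corner-violation (coloured-bounded c)
        (corner c τ (Occ⇒Iso 0 o) (All.lookup p≤n (Any-resp-⊆ τ (here refl))) (≤-refl ∷ All.map <⇒≤ x>) x<)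
        d (≤-refl ∷ All.map <⇒≤ x>) [] [] [] (All.universal (λ _ → []) (x ∷ s₁))))

  partner-of : ∀ {p} → p ∈ avoiders n ones → ∃[ p′ ] (p′ ∈ avoiders n (a ∷ as) × p ∼ p′)
  partner-of {p} p∈
    with p↭ , av ← avoiders-sound n ones p∈
    with w , r , ys , θs , c ← colour p
    with u ← unique-++⁻ r (unique-↭ (coloured-↭ c) (perm-unique p↭))
    with urev ← unique-↭ (↭-sym (↭-reverse ys)) (proj₂ u)
    with zs , pt ← partner-exists urev (Pointwiseₚ.reverse⁺ (coloured-bounded c))
    with pw ← partner-bounded (AllPairs⇒Linked (AllPairs-reverse (bounds-descending c))) pt
    with p′ , c′ ← recolour c (subst (Pointwise _<_ (reverse zs)) (reverse-involutive θs) (Pointwiseₚ.reverse⁺ pw))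
    = p′ , avoiders-complete n (a ∷ as) p′↭ (avoids-layer (All-resp-↭ (↭-sym p′↭) (All.map proj₂ (downs-bounded n))) c′
        (subst (λ z → ¬ Violation a (reverse θs) z) (sym (reverse-involutive zs))
          (partner-avoids urev pt (no-decreasing (no-increasing (perm-unique p↭) av c)))))
    , w , r , ys , θs , zs , c , pt , c′
    where
    p′↭ : p′ ↭ downs n
    p′↭ = ↭-trans (coloured-↭ c′) (↭-trans (++⁺ˡ r (↭-trans (↭-reverse zs) (↭-trans (partner-↭ pt) (↭-reverse ys))))
            (↭-trans (↭-sym (coloured-↭ c)) p↭))

-- Reverse complementation

applyDownFrom-cong : ∀ {f g : ℕ → ℕ} n → (∀ {i} → i < n → f i ≡ g i) → applyDownFrom f n ≡ applyDownFrom g n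
applyDownFrom-cong zero e = refl
applyDownFrom-cong (suc n) e = cong₂ _∷_ (e ≤-refl) (applyDownFrom-cong n (e ∘ m<n⇒m<1+n))

applyDownFrom-reflect : ∀ (f : ℕ → ℕ) n → applyDownFrom (λ i → f (n ∸ suc i)) n ≡ applyUpTo f n
applyDownFrom-reflect f zero = refl
applyDownFrom-reflect f (suc n) = cong₂ _∷_ (cong f (n∸n≡0 n))
  (trans (applyDownFrom-cong n (λ i<n → cong f (+-∸-assoc 1 i<n))) (applyDownFrom-reflect (f ∘ suc) n))

reverseComplement : ℕ → List ℕ → List ℕ
reverseComplement n p = map (suc n ∸_) (reverse p)

reverseComplement-↭ : ∀ n {p} → p ↭ downs n → reverseComplement n p ↭ downs n
reverseComplement-↭ n {p} p↭ = ↭-trans (map⁺ (suc n ∸_) (↭-trans (↭-reverse p) p↭)) (↭-trans (↭-reflexive flipped) (↭-reverse (downs n)))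
  where
  flipped : map (suc n ∸_) (downs n) ≡ reverse (downs n)
  flipped = trans (map-applyDownFrom suc (suc n ∸_) n) (trans (applyDownFrom-cong n (λ i<n → +-∸-assoc 1 i<n))
    (trans (applyDownFrom-reflect suc n) (sym (reverse-applyDownFrom suc n))))

reverseComplement-involutive : ∀ n {p} → All (_≤ n) p → reverseComplement n (reverseComplement n p) ≡ p
reverseComplement-involutive n {p} p≤ = begin
  map (suc n ∸_) (reverse (map (suc n ∸_) (reverse p)))   ≡⟨ cong (map (suc n ∸_)) (reverse-map (suc n ∸_) (reverse p)) ⟨
  map (suc n ∸_) (map (suc n ∸_) (reverse (reverse p)))   ≡⟨ cong (map (suc n ∸_) ∘ map (suc n ∸_)) (reverse-involutive p) ⟩
  map (suc n ∸_) (map (suc n ∸_) p)                       ≡⟨ map-∘ p ⟨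
  map (λ x → suc n ∸ (suc n ∸ x)) p                       ≡⟨ map-id-local (All.map (λ x≤n → m∸[m∸n]≡n (m≤n⇒m≤1+n x≤n)) p≤) ⟩
  p                                                       ∎
  where open ≡-Reasoning

S-reverseComplement : ∀ n b → S n (layered (b ∷ 1 ∷ [])) ≤ S n (layered (1 ∷ b ∷ []))
S-reverseComplement n b = inject-length (λ p p′ → p′ ≡ reverseComplement n p) (avoiders-unique n (b ∷ 1 ∷ [])) image injective
  where
  at-most : ∀ {p} → p ∈ avoiders n (b ∷ 1 ∷ []) → All (_≤ n) p
  at-most p∈ = All-resp-↭ (↭-sym (proj₁ (avoiders-sound n (b ∷ 1 ∷ []) p∈))) (All.map proj₂ (downs-bounded n))

  injective : ∀ {p q r} → p ∈ avoiders n (b ∷ 1 ∷ []) → q ∈ avoiders n (b ∷ 1 ∷ []) →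
    r ≡ reverseComplement n p → r ≡ reverseComplement n q → p ≡ q
  injective {p} {q} p∈ q∈ refl e = trans (sym (reverseComplement-involutive n (at-most p∈)))
    (trans (cong (reverseComplement n) e) (reverseComplement-involutive n (at-most q∈)))

  complement-< : ∀ {x y} → y ≤ n → x < y → suc n ∸ y < suc n ∸ x
  complement-< y≤n x<y = ∸-monoʳ-< x<y (m≤n⇒m≤1+n y≤n)

  complement-increasing : ∀ {xs} → All (_≤ n) xs → AllPairs _<_ xs → AllPairs (λ x y → suc n ∸ x > suc n ∸ y) xs
  complement-increasing [] [] = []
  complement-increasing (_ ∷ al) (x< ∷ asc) =
    All.zipWith (λ { (y≤ , x<y) → complement-< y≤ x<y }) (al , x<) ∷ complement-increasing al asc

  flipped : ∀ {z s} → length s ≡ b → AllPairs _>_ s → All (z <_) s → All (_≤ n) s →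
    Occ (b ∷ 1 ∷ []) (reverseComplement n (z ∷ s))
  flipped {z} {s} e d lt le rewrite unfold-reverse z s | map-++ (suc n ∸_) (reverse s) [ z ] =
    layer (trans (length-map _ (reverse s)) (trans (length-reverse s) e))
      (AllPairsₚ.map⁺ (complement-increasing (reversed le) (AllPairs-reverse d)))
      (Allₚ.map⁺ (All.zipWith (λ { (y≤ , z<y) → complement-< y≤ z<y ∷ [] }) (reversed le , reversed lt)))
      (layer {s₁ = [ suc n ∸ z ]} refl ([] ∷ []) ([] ∷ []) [])
    where
    reversed : ∀ {P : ℕ → Set} → All P s → All P (reverse s)
    reversed = All-resp-↭ (↭-sym (↭-reverse s))

  image : ∀ {p} → p ∈ avoiders n (b ∷ 1 ∷ []) → ∃[ p′ ] (p′ ∈ avoiders n (1 ∷ b ∷ []) × p′ ≡ reverseComplement n p)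
  image {p} p∈ with p↭ , av ← avoiders-sound n (b ∷ 1 ∷ []) p∈
    = _ , avoiders-complete n (1 ∷ b ∷ []) p′↭ av′ , refl
    where
    p′↭ = reverseComplement-↭ n p↭
    p′≤ : All (_≤ n) (reverseComplement n p)
    p′≤ = All-resp-↭ (↭-sym p′↭) (All.map proj₂ (downs-bounded n))
    av′ : Avoids (reverseComplement n p) (1 ∷ b ∷ [])
    av′ τ (layer {s₁ = z ∷ []} refl _ (z< ∷ []) (layer {s₁ = s} {[]} e d _ [])) =
      av (subst (reverseComplement n (z ∷ s) ⊆_) (reverseComplement-involutive n (at-most p∈))
            (map⁺-⊆ (suc n ∸_) (reverse⁺ (subst (λ t → z ∷ t ⊆ _) (++-identityʳ s) τ))))
        (flipped e d (Allₚ.++⁻ˡ s z<) (Allₚ.++⁻ˡ s (All.tail (All-resp-⊆ τ p′≤))))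

-- Merging left-to-right minima into an avoider

⊆-split : ∀ {s : List ℕ} xs {ys} → s ⊆ xs ++ ys → ∃[ s₁ ] ∃[ s₂ ] (s ≡ s₁ ++ s₂ × s₁ ⊆ xs × s₂ ⊆ ys)
⊆-split [] τ = [] , _ , refl , [] , τ
⊆-split (x ∷ xs) (_ ∷ʳ τ) with s₁ , s₂ , e , σ , ρ ← ⊆-split xs τ = s₁ , s₂ , e , x ∷ʳ σ , ρ
⊆-split (x ∷ xs) (refl ∷ τ) with s₁ , s₂ , e , σ , ρ ← ⊆-split xs τ = x ∷ s₁ , s₂ , cong (x ∷_) e , refl ∷ σ , ρ

Exceeds : List ℕ → List ℕ → Set
Exceeds xs ys = All (λ x → All (x >_) ys) xs

-- `not-split` excludes skew sums. `not-descending` makes monotone pieces, the empty one included,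
-- available as avoiders.
record Indecomposable (as : List ℕ) : Set where
  field
    not-descending : ∀ {s} → AllPairs _>_ s → ¬ Occ as s
    not-split      : ∀ {x xs y ys} → Occ as ((x ∷ xs) ++ (y ∷ ys)) → ¬ Exceeds (x ∷ xs) (y ∷ ys)
open Indecomposable

common-suffix : ∀ (xs : List ℕ) {xs′ u v us vs} → xs ++ u ∷ us ≡ xs′ ++ v ∷ vs → ∃[ w ] (w ∈ u ∷ us × w ∈ v ∷ vs)
common-suffix [] {xs′} {v = v} e = v , subst (v ∈_) (sym e) (∈-++⁺ʳ xs′ (here refl)) , here refl
common-suffix (x ∷ xs) {[]} {u} e = u , here refl , subst (u ∈_) e (∈-++⁺ʳ (x ∷ xs) (here refl))
common-suffix (x ∷ xs) {x′ ∷ xs′} e = common-suffix xs (∷-injectiveʳ e)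

-- The first entry of an occurrence is below its last one, which belongs to a later layer; in a skew
-- sum the first entry would exceed the last.
indecomposable : ∀ {a as} → ¬ Occ as [] → Indecomposable (suc a ∷ as)
indecomposable {a} {as} ne .not-descending {s} d o with o
... | layer {s₁ = x ∷ s₁} {[]} _ _ _ o′ = ne o′
... | layer {s₁ = x ∷ s₁} {y ∷ s₂} _ _ ((x<y ∷ _) ∷ _) _ with x> ∷ _ ← d
  = <-asym x<y (All.lookup x> (∈-++⁺ʳ s₁ (here refl)))
indecomposable {a} {as} ne .not-split {x} {xs} {y} {ys} o (x>ys ∷ _) = go o refl
  where
  go : ∀ {s} → Occ (suc a ∷ as) s → ¬ s ≡ (x ∷ xs) ++ (y ∷ ys)
  go (layer {s₁ = z ∷ s₁} {[]} _ _ _ o′) e = ne o′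
  go (layer {s₁ = z ∷ s₁} {w ∷ s₂} _ _ (z< ∷ _) _) e with refl ← ∷-injectiveˡ e
    with v , v∈ , v∈′ ← common-suffix s₁ {xs} (∷-injectiveʳ e) = <-asym (All.lookup z< v∈) (All.lookup x>ys v∈′)

avoids-++ : ∀ {as xs ys} → Indecomposable as → Avoids xs as → Avoids ys as → Exceeds xs ys → Avoids (xs ++ ys) as
avoids-++ {xs = xs} ind avx avy ex τ o with ⊆-split xs τ
... | [] , s₂ , refl , _ , ρ = avy ρ o
... | s₁@(_ ∷ _) , [] , refl , σ , _ = avx (subst (_⊆ xs) (sym (++-identityʳ s₁)) σ) o
... | (_ ∷ _) , (_ ∷ _) , refl , σ , ρ = ind .not-split o (All.map (All-resp-⊆ ρ) (All-resp-⊆ σ ex))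

-- p is an interleaving, prescribed by u, of its left-to-right minima ds (those
-- below the current minimum m) and its remaining entries bs.
data Minima : ℕ → List Bool → List ℕ → List ℕ → List ℕ → Set where
  []   : ∀ {m} → Minima m [] [] [] []
  low  : ∀ {m d u ds bs p} → d < m → Minima d u ds bs p → Minima m (true ∷ u) (d ∷ ds) bs (d ∷ p)
  high : ∀ {m b u ds bs p} → m < b → Minima m u ds bs p → Minima m (false ∷ u) ds (b ∷ bs) (b ∷ p)

minima-unique : ∀ {m u ds bs p u′ ds′ bs′} → Minima m u ds bs p → Minima m u′ ds′ bs′ p → u ≡ u′ × ds ≡ ds′ × bs ≡ bs′
minima-unique [] [] = refl , refl , refl
minima-unique (low _ x) (low _ y) with refl , refl , refl ← minima-unique x y = refl , refl , refl
minima-unique (high _ x) (high _ y) with refl , refl , refl ← minima-unique x y = refl , refl , refl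
minima-unique (low d<m _) (high m<d _) = ⊥-elim (<-asym d<m m<d)
minima-unique (high m<d _) (low d<m _) = ⊥-elim (<-asym d<m m<d)

minima-↭ : ∀ {m u ds bs p} → Minima m u ds bs p → p ↭ ds ++ bs
minima-↭ [] = ↭-refl
minima-↭ (low {d = d} _ x) = prep d (minima-↭ x)
minima-↭ (high {b = b} {ds = ds} {bs} _ x) = ↭-trans (prep b (minima-↭ x)) (↭-sym (shift b ds bs))

minima-above : ∀ {m u ds bs p s} → Minima m u ds bs p → s ⊆ p → All (m <_) s → s ⊆ bs
minima-above [] [] [] = []
minima-above (low d<m x) (_ ∷ʳ τ) al = minima-above x τ (All.map (<-trans d<m) al)
minima-above (low d<m x) (refl ∷ τ) (m<d ∷ _) = ⊥-elim (<-asym d<m m<d)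
minima-above (high _ x) (_ ∷ʳ τ) al = _ ∷ʳ minima-above x τ al
minima-above (high _ x) (refl ∷ τ) (_ ∷ al) = refl ∷ minima-above x τ al

-- After `x` the running minimum is at most `x`, so larger entries to its right are never new
-- minima.
minima-dominated : ∀ {m u ds bs p x s} → Minima m u ds bs p → x ∷ s ⊆ p → All (x <_) s → s ⊆ bs
minima-dominated (low _ y) (_ ∷ʳ τ) al = minima-dominated y τ al
minima-dominated (low _ y) (refl ∷ τ) al = minima-above y τ al
minima-dominated (high _ y) (_ ∷ʳ τ) al = _ ∷ʳ minima-dominated y τ al
minima-dominated (high m<b y) (refl ∷ τ) al = _ ∷ʳ minima-above y τ (All.map (<-trans m<b) al)

minima-avoids : ∀ {as m u ds bs p} → Minima m u ds bs p → Avoids bs as → Avoids p (1 ∷ as)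
minima-avoids x av τ (layer {s₁ = _ ∷ []} refl _ (lt ∷ []) o) = av (minima-dominated x τ lt) o

data Fits : List Bool → List ℕ → List ℕ → Set where
  []   : Fits [] [] []
  low  : ∀ {d u ds bs} → Fits u ds bs → Fits (true ∷ u) (d ∷ ds) bs
  high : ∀ {b u ds bs} → Fits u ds bs → Fits (false ∷ u) ds (b ∷ bs)

-- The running minimum at the end of a block is the last minimum placed there, or `m` if there is
-- none. The continuation therefore accepts any `m′` within the bounds that both cases satisfy.
minima-++ : ∀ {k u ds bs m u′ ds′ bs′} → Fits u ds bs → AllPairs _>_ ds → All (_< m) ds → All (k <_) ds → k < m → All (m <_) bs →
  (∀ {m′} → k < m′ → m′ ≤ m → (∀ {d} → d ∈ ds → m′ ≤ d) → ∃[ p ] Minima m′ u′ ds′ bs′ p) →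
  ∃[ p ] Minima m (u ++ u′) (ds ++ ds′) (bs ++ bs′) p
minima-++ [] _ _ _ k<m _ next = next k<m ≤-refl (λ ())
minima-++ {k} (low {d} f) (d> ∷ desc) (d<m ∷ lt) (k<d ∷ kd) _ al next
  with p , x ← minima-++ f desc d> kd k<d (All.map (<-trans d<m) al)
         (λ k<m′ m′≤d le → next k<m′ (≤-trans m′≤d (<⇒≤ d<m)) λ { (here refl) → m′≤d ; (there z) → le z })
  = d ∷ p , low d<m x
minima-++ (high {b} f) desc lt kd k<m (m<b ∷ al) next with p , x ← minima-++ f desc lt kd k<m al next = b ∷ p , high m<b x

-- Binary words, and copies of a permutation on given values

trues : List Bool → ℕ
trues [] = 0
trues (true ∷ u) = suc (trues u)
trues (false ∷ u) = trues u

allWords : ℕ → List (List Bool)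
allWords zero = [ [] ]
allWords (suc n) = map (true ∷_) (allWords n) ++ map (false ∷_) (allWords n)

words : ℕ → ℕ → List (List Bool)
words n i = filter (λ w → trues w ≟ i) (allWords n)

allWords-length : ∀ n {w} → w ∈ allWords n → length w ≡ n
allWords-length zero (here refl) = refl
allWords-length (suc n) m with ∈-++⁻ (map (true ∷_) (allWords n)) m
... | inj₁ m′ with w , w∈ , refl ← ∈-map⁻ (true ∷_) m′ = cong suc (allWords-length n w∈)
... | inj₂ m′ with w , w∈ , refl ← ∈-map⁻ (false ∷_) m′ = cong suc (allWords-length n w∈)

allWords-unique : ∀ n → Unique (allWords n)
allWords-unique zero = [] ∷ []
allWords-unique (suc n) = Uniqueₚ.++⁺ (Uniqueₚ.map⁺ ∷-injectiveʳ (allWords-unique n)) (Uniqueₚ.map⁺ ∷-injectiveʳ (allWords-unique n)) disjoint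
  where
  disjoint : ∀ {w} → w ∈ map (true ∷_) (allWords n) × w ∈ map (false ∷_) (allWords n) → ⊥
  disjoint (m , m′) with _ , _ , refl ← ∈-map⁻ (true ∷_) m with _ , _ , () ← ∈-map⁻ (false ∷_) m′

words-sound : ∀ n i {w} → w ∈ words n i → length w ≡ n × trues w ≡ i
words-sound n i w∈ with m , e ← ∈-filter⁻ (λ w → trues w ≟ i) {xs = allWords n} w∈ = allWords-length n m , e

words-unique : ∀ n i → Unique (words n i)
words-unique n i = Uniqueₚ.filter⁺ (λ w → trues w ≟ i) (allWords-unique n)

fits : ∀ {u ds bs} → trues u ≡ length ds → length u ≡ length ds + length bs → Fits u ds bs
fits {[]} {[]} {[]} _ _ = []
fits {true ∷ u} {d ∷ ds} e f = low (fits (suc-injective e) (suc-injective f))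
fits {false ∷ u} {ds} {[]} e f = ⊥-elim (<-irrefl (trans e (sym (trans f (+-identityʳ _)))) (s≤s (trues≤ u)))
  where
  trues≤ : ∀ u → trues u ≤ length u
  trues≤ [] = z≤n
  trues≤ (true ∷ u) = s≤s (trues≤ u)
  trues≤ (false ∷ u) = m≤n⇒m≤1+n (trues≤ u)
fits {false ∷ u} {ds} {b ∷ bs} e f = high (fits e (suc-injective (trans f (+-suc (length ds) (length bs)))))

pick : Bool → List Bool → List ℕ → List ℕ
pick b (true ∷ w) (v ∷ vs) = if b then v ∷ pick b w vs else pick b w vs
pick b (false ∷ w) (v ∷ vs) = if b then pick b w vs else v ∷ pick b w vs
pick b _ _ = []

pick-⊆ : ∀ b w vs → pick b w vs ⊆ vs
pick-⊆ b [] vs = minimum vs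
pick-⊆ b (true ∷ w) [] = []
pick-⊆ b (false ∷ w) [] = []
pick-⊆ true (true ∷ w) (v ∷ vs) = refl ∷ pick-⊆ true w vs
pick-⊆ false (true ∷ w) (v ∷ vs) = v ∷ʳ pick-⊆ false w vs
pick-⊆ true (false ∷ w) (v ∷ vs) = v ∷ʳ pick-⊆ true w vs
pick-⊆ false (false ∷ w) (v ∷ vs) = refl ∷ pick-⊆ false w vs

pick-fits : ∀ w vs → length w ≡ length vs → Fits w (pick true w vs) (pick false w vs)
pick-fits [] [] _ = []
pick-fits (true ∷ w) (v ∷ vs) e = low (pick-fits w vs (suc-injective e))
pick-fits (false ∷ w) (v ∷ vs) e = high (pick-fits w vs (suc-injective e))

fits-lengths : ∀ {u ds bs} → Fits u ds bs → length ds ≡ trues u × length ds + length bs ≡ length u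
fits-lengths [] = refl , refl
fits-lengths (low f) with e , g ← fits-lengths f = cong suc e , cong suc g
fits-lengths (high {ds = ds} f) with e , g ← fits-lengths f = e , trans (+-suc (length ds) _) (cong suc g)

pick-↭ : ∀ w vs → length w ≡ length vs → pick true w vs ++ pick false w vs ↭ vs
pick-↭ [] [] _ = ↭-refl
pick-↭ (true ∷ w) (v ∷ vs) e = prep v (pick-↭ w vs (suc-injective e))
pick-↭ (false ∷ w) (v ∷ vs) e = ↭-trans (shift v (pick true w vs) (pick false w vs)) (prep v (pick-↭ w vs (suc-injective e)))

pick-injective : ∀ {w w′} vs → Unique vs → length w ≡ length vs → length w′ ≡ length vs → pick true w vs ≡ pick true w′ vs → w ≡ w′
pick-injective {[]} {[]} [] _ _ _ _ = refl
pick-injective {true ∷ w} {true ∷ w′} (v ∷ vs) (_ ∷ u) e f g = cong (true ∷_) (pick-injective vs u (suc-injective e) (suc-injective f) (∷-injectiveʳ g))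
pick-injective {false ∷ w} {false ∷ w′} (v ∷ vs) (_ ∷ u) e f g = cong (false ∷_) (pick-injective vs u (suc-injective e) (suc-injective f) g)
pick-injective {true ∷ w} {false ∷ w′} (v ∷ vs) (v∉ ∷ u) e f g =
  ⊥-elim (All.lookup v∉ (Any-resp-⊆ (pick-⊆ true w′ vs) (subst (v ∈_) g (here refl))) refl)
pick-injective {false ∷ w} {true ∷ w′} (v ∷ vs) (v∉ ∷ u) e f g =
  ⊥-elim (All.lookup v∉ (Any-resp-⊆ (pick-⊆ true w vs) (subst (v ∈_) (sym g) (here refl))) refl)

-- Counted from the end, starting at 1; the value is 0 out of range.
nth : List ℕ → ℕ → ℕ
nth [] j = 0
nth (v ∷ vs) j = if does (j ≟ suc (length vs)) then v else nth vs j

nth-last : ∀ v vs → nth (v ∷ vs) (suc (length vs)) ≡ v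
nth-last v vs rewrite dec-true (suc (length vs) ≟ suc (length vs)) refl = refl

nth-earlier : ∀ v vs {j} → j ≤ length vs → nth (v ∷ vs) j ≡ nth vs j
nth-earlier v vs {j} j≤ rewrite dec-false (j ≟ suc (length vs)) (λ { refl → <-irrefl refl j≤ }) = refl

nth-∈ : ∀ vs {j} → 1 ≤ j → j ≤ length vs → nth vs j ∈ vs
nth-∈ [] 1≤j j≤ = ⊥-elim (<⇒≱ 1≤j j≤)
nth-∈ (v ∷ vs) {j} 1≤j j≤ with j ≟ suc (length vs)
... | yes refl = here (nth-last v vs)
... | no ne = there (subst (_∈ vs) (sym (nth-earlier v vs j≤′)) (nth-∈ vs 1≤j j≤′))
  where j≤′ = ≤-pred (≤∧≢⇒< j≤ ne)

nth-mono : ∀ {vs} → AllPairs _>_ vs → ∀ {j k} → 1 ≤ j → j < k → k ≤ length vs → nth vs j < nth vs k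
nth-mono [] 1≤j j<k k≤ = ⊥-elim (<⇒≱ (≤-<-trans z≤n j<k) k≤)
nth-mono {v ∷ vs} (v> ∷ d) {j} {k} 1≤j j<k k≤ with k ≟ suc (length vs)
... | yes refl = subst₂ _<_ (sym (nth-earlier v vs (≤-pred j<k))) (sym (nth-last v vs)) (All.lookup v> (nth-∈ vs 1≤j (≤-pred j<k)))
... | no ne = subst₂ _<_ (sym (nth-earlier v vs (≤-trans (<⇒≤ j<k) k≤′))) (sym (nth-earlier v vs k≤′)) (nth-mono d 1≤j j<k k≤′)
  where k≤′ = ≤-pred (≤∧≢⇒< k≤ ne)

nth-downs : ∀ vs → map (nth vs) (downs (length vs)) ≡ vs
nth-downs [] = refl
nth-downs (v ∷ vs) = cong₂ _∷_ (nth-last v vs) (trans (map-cong-local-nth (length vs) ≤-refl) (nth-downs vs))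
  where
  map-cong-local-nth : ∀ n → n ≤ length vs → map (nth (v ∷ vs)) (downs n) ≡ map (nth vs) (downs n)
  map-cong-local-nth zero _ = refl
  map-cong-local-nth (suc n) n≤ = cong₂ _∷_ (nth-earlier v vs n≤) (map-cong-local-nth n (<⇒≤ n≤))

⊆-map-split : ∀ (f : ℕ → ℕ) {s} xs → s ⊆ map f xs → ∃[ s′ ] (s ≡ map f s′ × s′ ⊆ xs)
⊆-map-split f [] [] = [] , refl , []
⊆-map-split f (x ∷ xs) (_ ∷ʳ τ) with s′ , e , σ ← ⊆-map-split f xs τ = s′ , e , x ∷ʳ σ
⊆-map-split f (x ∷ xs) (refl ∷ τ) with s′ , e , σ ← ⊆-map-split f xs τ = x ∷ s′ , cong (f x ∷_) e , refl ∷ σ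

Iso-unmap : ∀ {f : ℕ → ℕ} {P : ℕ → Set} → (∀ {x y} → P x → P y → (f x <ᵇ f y) ≡ (x <ᵇ y)) →
  ∀ {s q} → All P s → Iso (map f s) q → Iso s q
Iso-unmap emb [] [] = []
Iso-unmap {f} {P} emb {x ∷ s} (px ∷ al) (_∷_ {y = y} pw i) = go al pw ∷ Iso-unmap emb al i
  where
  go : ∀ {s q} → All P s → Pointwise (λ x′ y′ → (f x <ᵇ x′) ≡ (y <ᵇ y′)) (map f s) q →
    Pointwise (λ x′ y′ → (x <ᵇ x′) ≡ (y <ᵇ y′)) s q
  go [] [] = []
  go (pz ∷ al) (e ∷ pw) = trans (sym (emb px pz)) e ∷ go al pw

-- For descending `vs`, `nth vs j` is the j-th smallest value, so this is the copy of the
-- permutation β on the values `vs`.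
arrange : List ℕ → List ℕ → List ℕ
arrange β vs = map (nth vs) β

module _ {vs : List ℕ} (desc : AllPairs _>_ vs) where

  InRange : ℕ → Set
  InRange v = 1 ≤ v × v ≤ length vs

  nth-<ᵇ : ∀ {x y} → InRange x → InRange y → (nth vs x <ᵇ nth vs y) ≡ (x <ᵇ y)
  nth-<ᵇ {x} {y} (1≤x , x≤) (1≤y , y≤) with <-cmp x y
  ... | tri< x<y _ _ = trans (<ᵇ-true (nth-mono desc 1≤x x<y y≤)) (sym (<ᵇ-true x<y))
  ... | tri≈ _ refl _ = trans (<ᵇ-false {nth vs x} (<-irrefl refl)) (sym (<ᵇ-false {x} (<-irrefl refl)))
  ... | tri> _ _ y<x = trans (<ᵇ-false (<⇒≯ (nth-mono desc 1≤y y<x x≤))) (sym (<ᵇ-false (<⇒≯ y<x)))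

  nth-injective : ∀ {x y} → InRange x → InRange y → nth vs x ≡ nth vs y → x ≡ y
  nth-injective {x} {y} (1≤x , x≤) (1≤y , y≤) e with <-cmp x y
  ... | tri< x<y _ _ = ⊥-elim (<-irrefl e (nth-mono desc 1≤x x<y y≤))
  ... | tri≈ _ eq _ = eq
  ... | tri> _ _ y<x = ⊥-elim (<-irrefl (sym e) (nth-mono desc 1≤y y<x x≤))

  in-range : ∀ {β} → β ↭ downs (length vs) → All InRange β
  in-range β↭ = All-resp-↭ (↭-sym β↭) (downs-bounded (length vs))

  arrange-↭ : ∀ {β} → β ↭ downs (length vs) → arrange β vs ↭ vs
  arrange-↭ β↭ = ↭-trans (map⁺ (nth vs) β↭) (↭-reflexive (nth-downs vs))

  arrange-avoids : ∀ {β} as → β ↭ downs (length vs) → Avoids β as → Avoids (arrange β vs) as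
  arrange-avoids {β} as β↭ av τ o with s′ , refl , σ ← ⊆-map-split (nth vs) β τ =
    av σ (Iso⇒Occ 0 as (AllPairs-⊆ σ (perm-unique β↭))
      (Iso-unmap nth-<ᵇ (All-resp-⊆ σ (in-range β↭)) (Occ⇒Iso 0 o)))

  arrange-injective : ∀ {β γ} → β ↭ downs (length vs) → γ ↭ downs (length vs) → arrange β vs ≡ arrange γ vs → β ≡ γ
  arrange-injective β↭ γ↭ = go (in-range β↭) (in-range γ↭)
    where
    go : ∀ {β γ} → All InRange β → All InRange γ → map (nth vs) β ≡ map (nth vs) γ → β ≡ γ
    go [] [] _ = refl
    go (p ∷ ps) (r ∷ rs) e = cong₂ _∷_ (nth-injective p r (∷-injectiveˡ e)) (go ps rs (∷-injectiveʳ e))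

-- Tuples of codes and intervals of values

tuples : ∀ {A : Set} → ℕ → List A → List (List A)
tuples zero xs = [ [] ]
tuples (suc n) xs = cartesianProductWith _∷_ xs (tuples n xs)

length-cartesianProductWith : ∀ {A B C : Set} (f : A → B → C) xs ys → length (cartesianProductWith f xs ys) ≡ length xs * length ys
length-cartesianProductWith f [] ys = refl
length-cartesianProductWith f (x ∷ xs) ys =
  trans (length-++ (map (f x) ys)) (cong₂ _+_ (length-map (f x) ys) (length-cartesianProductWith f xs ys))

tuples-count : ∀ {A : Set} n (xs : List A) → length (tuples n xs) ≡ length xs ^ n
tuples-count zero xs = refl
tuples-count (suc n) xs = trans (length-cartesianProductWith _∷_ xs (tuples n xs)) (cong (length xs *_) (tuples-count n xs))

tuples-unique : ∀ {A : Set} n {xs : List A} → Unique xs → Unique (tuples n xs)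
tuples-unique zero u = [] ∷ []
tuples-unique (suc n) u = Uniqueₚ.cartesianProductWith⁺ _∷_ ∷-injective u (tuples-unique n u)

tuples-sound : ∀ {A : Set} n (xs : List A) {t} → t ∈ tuples n xs → length t ≡ n × All (_∈ xs) t
tuples-sound zero xs (here refl) = refl , []
tuples-sound (suc n) xs m with x , t , x∈ , t∈ , refl ← ∈-cartesianProductWith⁻ _∷_ xs (tuples n xs) m
  with e , al ← tuples-sound n xs t∈ = cong suc e , x∈ ∷ al

downs-descending : ∀ n → AllPairs _>_ (downs n)
downs-descending n = AllPairsₚ.applyDownFrom⁺₁ suc n (λ j<i _ → s≤s j<i)

downs-length : ∀ n → length (downs n) ≡ n
downs-length n = length-applyDownFrom suc n

interval : ℕ → ℕ → List ℕ
interval k m = map (k +_) (downs m)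

downs-+ : ∀ m k → downs (m + k) ≡ interval k m ++ downs k
downs-+ zero k = refl
downs-+ (suc m) k = cong₂ _∷_ (trans (cong suc (+-comm m k)) (sym (+-suc k m))) (downs-+ m k)

interval-descending : ∀ k m → AllPairs _>_ (interval k m)
interval-descending k m = AllPairsₚ.map⁺ (AllPairs.map (+-monoʳ-< k) (downs-descending m))

interval-length : ∀ k m → length (interval k m) ≡ m
interval-length k m = trans (length-map (k +_) (downs m)) (downs-length m)

interval-bounds : ∀ k m → All (λ v → k < v × v ≤ m + k) (interval k m)
interval-bounds k m = Allₚ.map⁺ (All.map (λ { {v} (1≤v , v≤m) →
  m<m+n k 1≤v , subst (k + v ≤_) (+-comm k m) (+-monoʳ-≤ k v≤m) }) (downs-bounded m))

++-injective : ∀ {A : Set} (xs xs′ : List A) {ys ys′} → length xs ≡ length xs′ → xs ++ ys ≡ xs′ ++ ys′ → xs ≡ xs′ × ys ≡ ys′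
++-injective [] [] _ e = refl , e
++-injective (x ∷ xs) (x′ ∷ xs′) l e with refl , e′ ← ++-injective xs xs′ (suc-injective l) (∷-injectiveʳ e) = cong (_∷ xs) (∷-injectiveˡ e) , e′

all-from : ∀ {P : ℕ → Set} {xs ys} → xs ↭ ys → All P ys → All P xs
all-from p = All-resp-↭ (↭-sym p)

descending-unique : ∀ {vs} → AllPairs _>_ vs → Unique vs
descending-unique = AllPairs.map (λ x>y e → <-irrefl (sym e) x>y)

-- The values below G + base are cut into consecutive blocks of H + 1 values, as
-- are the positions.  In every block i + 1 entries are left-to-right minima
-- (one of them, the first, is forced).  The minima chosen from a block of values
-- are placed one block of positions earlier, the other entries one block later,
-- so every other entry lies above and to the right of some minimum.
module Blocks (i G : ℕ) (as : List ℕ) (ind : Indecomposable as) where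

  H : ℕ
  H = i + G

  Code : Set
  Code = List Bool × List Bool × List ℕ

  codes : List Code
  codes = cartesianProduct (words H i) (cartesianProduct (words H i) (avoiders G as))

  codes-count : length codes ≡ length (words H i) * (length (words H i) * length (avoiders G as))
  codes-count = trans (length-cartesianProductWith _,_ (words H i) (cartesianProduct (words H i) (avoiders G as)))
    (cong (length (words H i) *_) (length-cartesianProductWith _,_ (words H i) (avoiders G as)))

  base : List Code → ℕ
  base [] = suc i
  base (_ ∷ cs) = suc H + base cs

  lows highs : List Bool → ℕ → List ℕ
  lows w k = pick true (true ∷ w) (interval k (suc H))
  highs w k = pick false (true ∷ w) (interval k (suc H))

  positions : List Bool → List Code → List Bool
  positions u [] = (true ∷ u) ++ replicate G false
  positions u ((u′ , _) ∷ cs) = (true ∷ u) ++ positions u′ cs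

  minima : List Code → List ℕ
  minima [] = downs (suc i)
  minima ((_ , w , _) ∷ cs) = lows w (base cs) ++ minima cs

  others : List ℕ → List ℕ → List Code → List ℕ
  others X Y [] = X ++ Y
  others X Y ((_ , w , β) ∷ cs) = X ++ others Y (arrange β (highs w (base cs))) cs

  record Valid (c : Code) : Set where
    constructor valid
    field
      position-ok : length (proj₁ c) ≡ H × trues (proj₁ c) ≡ i
      value-ok    : length (proj₁ (proj₂ c)) ≡ H × trues (proj₁ (proj₂ c)) ≡ i
      perm-ok     : proj₂ (proj₂ c) ↭ downs G
      avoids-ok   : Avoids (proj₂ (proj₂ c)) as
  open Valid

  codes-valid : ∀ {c} → c ∈ codes → Valid c
  codes-valid c∈ with u∈ , wβ∈ ← ∈-cartesianProduct⁻ (words H i) _ c∈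
    with w∈ , β∈ ← ∈-cartesianProduct⁻ (words H i) (avoiders G as) wβ∈
    with β↭ , av ← avoiders-sound G as β∈
    = valid (words-sound H i u∈) (words-sound H i w∈) β↭ av

  length-block : ∀ {w} → length w ≡ H → ∀ k → length (true ∷ w) ≡ length (interval k (suc H))
  length-block e k = trans (cong suc e) (sym (interval-length k (suc H)))

  lows-length : ∀ {w} → length w ≡ H × trues w ≡ i → ∀ k → length (lows w k) ≡ suc i
  lows-length {w} (e , t) k = trans (proj₁ (fits-lengths (pick-fits (true ∷ w) (interval k (suc H)) (length-block {w} e k)))) (cong suc t)

  highs-length : ∀ {w} → length w ≡ H × trues w ≡ i → ∀ k → length (highs w k) ≡ G
  highs-length {w} (e , t) k = +-cancelˡ-≡ (suc i) _ _ (trans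
    (cong (_+ length (highs w k)) (sym (lows-length {w} (e , t) k)))
    (trans (proj₂ (fits-lengths (pick-fits (true ∷ w) (interval k (suc H)) (length-block {w} e k)))) (cong suc e)))

  highs-descending : ∀ w k → AllPairs _>_ (highs w k)
  highs-descending w k = AllPairs-⊆ (pick-⊆ false (true ∷ w) _) (interval-descending k (suc H))

  module Arranged {u w β} (v : Valid (u , w , β)) (k : ℕ) where
    private
      vs = highs w k
      w-ok = v .value-ok
      β↭ : β ↭ downs (length vs)
      β↭ = subst (λ n → β ↭ downs n) (sym (highs-length {w} w-ok k)) (v .perm-ok)
      d = highs-descending w k

    avoid : Avoids (arrange β vs) as
    avoid = arrange-avoids d as β↭ (v .avoids-ok)

    perm : arrange β vs ↭ vs
    perm = arrange-↭ d β↭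

    size : length (arrange β vs) ≡ G
    size = trans (↭-length perm) (highs-length {w} w-ok k)

    bounds : All (λ v → k < v × v ≤ suc H + k) (arrange β vs)
    bounds = all-from perm (All-resp-⊆ (pick-⊆ false (true ∷ w) _) (interval-bounds k (suc H)))

  arranged-unique : ∀ {u u′ w β γ} → Valid (u , w , β) → Valid (u′ , w , γ) → ∀ k →
    arrange β (highs w k) ≡ arrange γ (highs w k) → β ≡ γ
  arranged-unique {w = w} {β} {γ} (valid _ ok β↭ _) (valid _ _ γ↭ _) k =
    arrange-injective (highs-descending w k) (subst (λ n → β ↭ downs n) e β↭) (subst (λ n → γ ↭ downs n) e γ↭)
    where e = sym (highs-length {w} ok k)

  others-perm : ∀ {cs} X Y → All Valid cs → minima cs ++ others X Y cs ↭ downs (base cs) ++ (X ++ Y)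
  others-perm X Y [] = ↭-refl
  others-perm {(u , w , β) ∷ cs} X Y (v ∷ vs) = ↭-trans (rearrange (lows w k) (minima cs) X (others Y B cs))
    (↭-trans (++⁺ˡ (lows w k ++ X) (others-perm Y B vs))
    (↭-trans (rearrange′ (lows w k) X (downs k) Y B)
      (++⁺ʳ (X ++ Y) (↭-trans (++⁺ʳ (downs k)
        (↭-trans (++⁺ˡ (lows w k) (Arranged.perm v k)) (pick-↭ (true ∷ w) _ (length-block {w} (proj₁ (v .value-ok)) k))))
        (↭-reflexive (sym (downs-+ (suc H) k)))))))
    where
    k = base cs
    B = arrange β (highs w k)
    open CommutativeMonoidSolver (++-commutativeMonoid {A = ℕ})
    rearrange : ∀ a b c d → (a ++ b) ++ (c ++ d) ↭ (a ++ c) ++ (b ++ d)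
    rearrange a b c d = prove 4 ((x ⊕ y) ⊕ (z ⊕ t)) ((x ⊕ z) ⊕ (y ⊕ t)) (a Vec.∷ b Vec.∷ c Vec.∷ d Vec.∷ Vec.[])
      where x = var (# 0) ; y = var (# 1) ; z = var (# 2) ; t = var (# 3)
    rearrange′ : ∀ a b c d e → (a ++ b) ++ (c ++ (d ++ e)) ↭ ((a ++ e) ++ c) ++ (b ++ d)
    rearrange′ a b c d e = prove 5 ((x ⊕ y) ⊕ (z ⊕ (t ⊕ s))) (((x ⊕ s) ⊕ z) ⊕ (y ⊕ t)) (a Vec.∷ b Vec.∷ c Vec.∷ d Vec.∷ e Vec.∷ Vec.[])
      where x = var (# 0) ; y = var (# 1) ; z = var (# 2) ; t = var (# 3) ; s = var (# 4)

  others-below : ∀ {x cs X Y} → All Valid cs → All (x >_) X → All (x >_) Y → base cs < x → All (x >_) (others X Y cs)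
  others-below [] x>X x>Y _ = Allₚ.++⁺ x>X x>Y
  others-below {x} {(u , w , β) ∷ cs} (v ∷ vs) x>X x>Y lt = Allₚ.++⁺ x>X
    (others-below vs x>Y (All.map (λ b → ≤-<-trans (proj₂ b) lt) (Arranged.bounds v (base cs)))
      (≤-<-trans (m≤n+m (base cs) (suc H)) lt))

  -- Later blocks of other entries come from lower blocks of values, so the whole is an iterated
  -- skew sum of avoiders.
  others-avoids : ∀ {cs X Y} → All Valid cs → Avoids X as → Avoids Y as → Exceeds X Y →
    All (base cs <_) X → All (base cs <_) Y → Avoids (others X Y cs) as
  others-avoids [] avX avY ex _ _ = avoids-++ ind avX avY ex
  others-avoids {(u , w , β) ∷ cs} (v ∷ vs) avX avY ex k<X k<Y =
    avoids-++ ind avX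
      (others-avoids vs avY (Arranged.avoid v k)
        (All.map (λ lt → All.map (λ b → ≤-<-trans (proj₂ b) lt) bs) k<Y)
        (All.map (≤-<-trans (m≤n+m k (suc H))) k<Y) (All.map proj₁ bs))
      (All.zipWith (λ { (x>Y , lt) → others-below vs x>Y (All.map (λ b → ≤-<-trans (proj₂ b) lt) bs) (≤-<-trans (m≤n+m k (suc H)) lt) }) (ex , k<X))
    where
    k = base cs
    bs = Arranged.bounds v k

  highs-only : ∀ {m Y} → All (m <_) Y → ∀ {n} → length Y ≡ n → ∃[ p ] Minima m (replicate n false) [] Y p
  highs-only [] refl = [] , []
  highs-only (lt ∷ al) refl with p , x ← highs-only al refl = _ , high lt x

  build : ∀ {cs u X Y m} → All Valid cs → trues u ≡ i → length u ≡ i + length X → length Y ≡ G →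
    base cs < m → All (m <_) X → All (base cs <_) Y → ∃[ p ] Minima m (positions u cs) (minima cs) (others X Y cs) p
  build {[]} {u} {X} {Y} {m} [] t l eY k<m m<X k<Y = subst (λ z → ∃[ p ] Minima m (positions u []) z (X ++ Y) p) (++-identityʳ (downs (suc i)))
    (minima-++ {0} (fits (trans (cong suc t) (sym (downs-length (suc i)))) (trans (cong suc l) (cong (_+ length X) (sym (downs-length (suc i))))))
      (downs-descending (suc i)) (All.map (λ b → ≤-<-trans (proj₂ b) k<m) (downs-bounded (suc i))) (All.map proj₁ (downs-bounded (suc i)))
      (≤-<-trans z≤n k<m) m<X
      (λ _ _ le → highs-only (All.map (≤-<-trans (le (here refl))) k<Y) eY))
  build {(u′ , w , β) ∷ cs} {u} {X} {Y} (v ∷ vs) t l eY k<m m<X k<Y =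
    minima-++ {base cs} (fits (trans (cong suc t) (sym eL)) (trans (cong suc l) (cong (_+ length X) (sym eL))))
      (AllPairs-⊆ sub (interval-descending k (suc H)))
      (All.map (λ b → ≤-<-trans (proj₂ b) k<m) bs) (All.map proj₁ bs) (≤-<-trans (m≤n+m k (suc H)) k<m) m<X
      (λ k<m′ _ le → build vs (proj₂ (v .position-ok)) (trans (proj₁ (v .position-ok)) (cong (i +_) (sym eY)))
        (Arranged.size v k) k<m′
        -- The forced minimum is the top value of its block, so the running minimum has dropped
        -- below all of `Y`, whose values come from above this block.
        (All.map (≤-<-trans (≤-trans (le (here refl)) (≤-reflexive (+-comm k (suc H))))) k<Y) (All.map proj₁ (Arranged.bounds v k)))
    where
    k = base cs
    sub = pick-⊆ true (true ∷ w) (interval k (suc H))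
    eL = lows-length {w} (v .value-ok) k
    bs = All-resp-⊆ sub (interval-bounds k (suc H))

  -- The other entries of a value block surface two position blocks after its minima. The recursion
  -- therefore returns equality of the pending lists `X` and `Y` as well, and the inner `Y`
  -- identifies the permutation in the current code.
  decode : ∀ {cs ds u u′ X X′ Y Y′} → All Valid cs → All Valid ds → length cs ≡ length ds →
    length u ≡ length u′ → length X ≡ length X′ → length Y ≡ G → length Y′ ≡ G →
    positions u cs ≡ positions u′ ds → minima cs ≡ minima ds → others X Y cs ≡ others X′ Y′ ds →
    X ≡ X′ × Y ≡ Y′ × u ≡ u′ × cs ≡ ds
  decode {u = u} {u′} {X} {X′} [] [] _ lu lX _ _ eu _ eo =
    proj₁ (++-injective X X′ lX eo) , proj₂ (++-injective X X′ lX eo) , proj₁ (++-injective u u′ lu (∷-injectiveʳ eu)) , refl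
  decode {(_ , w , β) ∷ cs} {(_ , w′ , β′) ∷ ds} {u} {u′} {X} {X′} (v@(valid (lc , _) w-ok _ _) ∷ vs) (v′@(valid (lc′ , _) w′-ok _ _) ∷ vs′) lcs lu lX lY lY′ eu em eo
    with refl , eu′ ← ++-injective (true ∷ u) (true ∷ u′) (cong suc lu) eu
    with eX , eo′ ← ++-injective X X′ lX eo
    with elow , em′ ← ++-injective (lows w (base cs)) (lows w′ (base ds))
           (trans (lows-length {w} w-ok (base cs)) (sym (lows-length {w′} w′-ok (base ds)))) em
    with eY , eB , refl , refl ← decode vs vs′ (suc-injective lcs) (trans lc (sym lc′)) (trans lY (sym lY′))
           (Arranged.size v (base cs)) (Arranged.size v′ (base ds)) eu′ em′ eo′
    with refl ← ∷-injectiveʳ (pick-injective {true ∷ w} {true ∷ w′} _ (descending-unique (interval-descending (base cs) (suc H)))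
           (length-block {w} (proj₁ w-ok) (base cs)) (length-block {w′} (proj₁ w′-ok) (base cs)) elow)
    with refl ← arranged-unique {w = w} v v′ (base cs) eB
    = eX , eY , refl , refl

  base-length : ∀ cs → base cs ≡ length cs * suc H + suc i
  base-length [] = refl
  base-length (c ∷ cs) = trans (cong (suc H +_) (base-length cs)) (sym (+-assoc (suc H) (length cs * suc H) (suc i)))

  trues-replicate : ∀ n → trues (replicate n true) ≡ n
  trues-replicate zero = refl
  trues-replicate (suc n) = cong suc (trues-replicate n)

  S-blocks : ∀ M → length codes ^ M ≤ S (suc M * suc H) (layered (1 ∷ as))
  S-blocks M = subst₂ _≤_ (tuples-count M codes) (cong (λ n → S n (layered (1 ∷ as))) size)
    (inject-length _∼_ (tuples-unique M codes-unique) image injective)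
    where
    codes-unique : Unique codes
    codes-unique = Uniqueₚ.cartesianProduct⁺ (words-unique H i) (Uniqueₚ.cartesianProduct⁺ (words-unique H i) (avoiders-unique G as))

    K n : ℕ
    K = M * suc H + suc i
    n = G + K

    size : n ≡ suc M * suc H
    size = trans (+-comm G K) (trans (+-assoc (M * suc H) (suc i) G) (+-comm (M * suc H) (suc H)))

    -- Boundary data: the first position block consists of i + 1 minima alone, and the top `G`
    -- values in decreasing order, which contain no occurrence of `as`, replace the missing earlier
    -- block.
    u₀ : List Bool
    u₀ = replicate i true

    Y₀ : List ℕ
    Y₀ = interval K G

    _∼_ : List Code → List ℕ → Set
    cs ∼ p = Minima (suc n) (positions u₀ cs) (minima cs) (others [] Y₀ cs) p

    tuple-base : ∀ {cs} → cs ∈ tuples M codes → base cs ≡ K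
    tuple-base {cs} cs∈ = trans (base-length cs) (cong (λ l → l * suc H + suc i) (proj₁ (tuples-sound M codes cs∈)))

    tuple-valid : ∀ {cs} → cs ∈ tuples M codes → All Valid cs
    tuple-valid cs∈ = All.map codes-valid (proj₂ (tuples-sound M codes cs∈))

    above-base : ∀ {cs} → cs ∈ tuples M codes → All (base cs <_) Y₀
    above-base cs∈ = All.map (λ b → ≤-<-trans (≤-reflexive (tuple-base cs∈)) (proj₁ b)) (interval-bounds K G)

    image : ∀ {cs} → cs ∈ tuples M codes → ∃[ p ] (p ∈ avoiders n (1 ∷ as) × cs ∼ p)
    image {cs} cs∈
      with p , x ← build {X = []} (tuple-valid cs∈) (trues-replicate i) (trans (length-replicate i) (sym (+-identityʳ i)))
             (interval-length K G) (s≤s (≤-trans (≤-reflexive (tuple-base cs∈)) (m≤n+m K G))) [] (above-base cs∈)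
      = p , avoiders-complete n (1 ∷ as)
          (↭-trans (minima-↭ x) (↭-trans (others-perm [] Y₀ (tuple-valid cs∈))
            (↭-trans (++-comm (downs (base cs)) Y₀) (↭-reflexive (trans (cong (λ k → Y₀ ++ downs k) (tuple-base cs∈)) (sym (downs-+ G K)))))))
          (minima-avoids x (others-avoids (tuple-valid cs∈) (λ { [] o → ind .not-descending [] o })
            (λ τ → ind .not-descending (AllPairs-⊆ τ (interval-descending K G))) [] [] (above-base cs∈)))
      , x

    injective : ∀ {cs ds p} → cs ∈ tuples M codes → ds ∈ tuples M codes → cs ∼ p → ds ∼ p → cs ≡ ds
    injective cs∈ ds∈ x y with eu , em , eo ← minima-unique x y =
      proj₂ (proj₂ (proj₂ (decode {X = []} {[]} (tuple-valid cs∈) (tuple-valid ds∈)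
        (trans (proj₁ (tuples-sound M codes cs∈)) (sym (proj₁ (tuples-sound M codes ds∈))))
        refl refl (interval-length K G) (interval-length K G) eu em eo)))

Occ-singleton : ∀ {as s} → Occ (1 ∷ as) s → ∃[ x ] ∃[ s′ ] (s ≡ x ∷ s′ × All (x <_) s′ × Occ as s′)
Occ-singleton (layer {s₁ = x ∷ []} {s₂} refl _ (lt ∷ []) o) = x , s₂ , refl , lt , o

-- A new maximum put in front cannot play the leading 1, since something larger would have to follow
-- it.
S-suc : ∀ {as} → ¬ Occ as [] → ∀ n → S n (layered (1 ∷ as)) ≤ S (suc n) (layered (1 ∷ as))
S-suc {as} ne n = inject-length (λ p p′ → p′ ≡ suc n ∷ p) (avoiders-unique n (1 ∷ as))
  (λ p∈ → _ , extend p∈ , refl) (λ { _ _ refl refl → refl })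
  where
  extend : ∀ {p} → p ∈ avoiders n (1 ∷ as) → suc n ∷ p ∈ avoiders (suc n) (1 ∷ as)
  extend {p} p∈ with p↭ , av ← avoiders-sound n (1 ∷ as) p∈ = avoiders-complete (suc n) (1 ∷ as) (prep (suc n) p↭) av′
    where
    av′ : Avoids (suc n ∷ p) (1 ∷ as)
    av′ (_ ∷ʳ τ) o = av τ o
    av′ (refl ∷ τ) o with Occ-singleton o
    ... | _ , [] , refl , _ , o′ = ne o′
    ... | _ , y ∷ _ , refl , n<y ∷ _ , _ =
      <⇒≱ n<y (m≤n⇒m≤1+n (proj₂ (All.lookup (downs-bounded n) (∈-resp-↭ p↭ (Any-resp-⊆ τ (here refl))))))

-- Growth rates

module _ {A : Set} (key f : A → ℕ) where

  class : ℕ → List A → List A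
  class i = filter (λ w → key w ≟ i)

  weight : List A → ℕ
  weight ws = sum (map f ws)

  weight-class : ∀ i ws → weight ws ≡ weight (class i ws) + weight (filter (¬? ∘ λ w → key w ≟ i) ws)
  weight-class i [] = refl
  weight-class i (w ∷ ws) with key w ≟ i
  ... | yes e rewrite dec-true (key w ≟ i) e = trans (cong (f w +_) (weight-class i ws)) (sym (+-assoc (f w) _ _))
  ... | no ne rewrite dec-false (key w ≟ i) ne = trans (cong (f w +_) (weight-class i ws)) (left-comm (f w) (weight (class i ws)) _)
    where
    left-comm : ∀ x y z → x + (y + z) ≡ y + (x + z)
    left-comm = solve-∀

  weight-class-filter : ∀ {P : A → Set} (P? : ∀ w → Dec (P w)) i ws → weight (class i (filter P? ws)) ≤ weight (class i ws)
  weight-class-filter P? i [] = z≤n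
  weight-class-filter P? i (w ∷ ws) with P? w
  ... | no _ = ≤-trans (weight-class-filter P? i ws) (grow (key w ≟ i))
    where
    grow : Dec (key w ≡ i) → weight (class i ws) ≤ weight (class i (w ∷ ws))
    grow (yes e) rewrite dec-true (key w ≟ i) e = m≤n+m _ (f w)
    grow (no ne) rewrite dec-false (key w ≟ i) ne = ≤-refl
  ... | yes _ with key w ≟ i
  ...   | yes e rewrite dec-true (key w ≟ i) e = +-monoʳ-≤ (f w) (weight-class-filter P? i ws)
  ...   | no ne rewrite dec-false (key w ≟ i) ne = weight-class-filter P? i ws

  heaviest-class : ∀ N ws → All (λ w → key w ≤ N) ws → ∃[ i ] (i ≤ N × weight ws ≤ suc N * weight (class i ws))
  heaviest-class zero ws al = 0 , z≤n , ≤-reflexive (trans (cong weight (sym (filter-all (λ w → key w ≟ 0) (All.map n≤0⇒n≡0 al)))) (sym (*-identityˡ (weight (class 0 ws)))))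
  heaviest-class (suc N) ws al
    with i , i≤N , le ← heaviest-class N (filter (¬? ∘ λ w → key w ≟ suc N) ws)
           (All.zipWith (λ { (ne , le) → ≤-pred (≤∧≢⇒< le ne) })
             (Allₚ.all-filter (¬? ∘ λ w → key w ≟ suc N) ws , Allₚ.filter⁺ (¬? ∘ λ w → key w ≟ suc N) al))
    with le′ ← ≤-trans (≤-reflexive (weight-class (suc N) ws))
                 (+-monoʳ-≤ (weight (class (suc N) ws)) (≤-trans le (*-monoʳ-≤ (suc N) (weight-class-filter (¬? ∘ λ w → key w ≟ suc N) i ws))))
    with ≤-total (weight (class (suc N) ws)) (weight (class i ws))
  ... | inj₁ x≤y = i , m≤n⇒m≤1+n i≤N , ≤-trans le′ (+-monoˡ-≤ _ x≤y)
  ... | inj₂ y≤x = suc N , ≤-refl , ≤-trans le′ (+-monoʳ-≤ (weight (class (suc N) ws)) (*-monoʳ-≤ (suc N) y≤x))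

falses : List Bool → ℕ
falses [] = 0
falses (true ∷ w) = falses w
falses (false ∷ w) = suc (falses w)

trues+falses : ∀ w → trues w + falses w ≡ length w
trues+falses [] = refl
trues+falses (true ∷ w) = cong suc (trues+falses w)
trues+falses (false ∷ w) = trans (+-suc (trues w) (falses w)) (cong suc (trues+falses w))

weight-allWords : ∀ g n → sum (map (λ w → g ^ falses w) (allWords n)) ≡ suc g ^ n
weight-allWords g zero = refl
weight-allWords g (suc n) = begin
  sum (map f (map (true ∷_) ws ++ map (false ∷_) ws))          ≡⟨ cong sum (map-++ f (map (true ∷_) ws) (map (false ∷_) ws)) ⟩
  sum (map f (map (true ∷_) ws) ++ map f (map (false ∷_) ws))  ≡⟨ sum-++ (map f (map (true ∷_) ws)) _ ⟩
  sum (map f (map (true ∷_) ws)) + sum (map f (map (false ∷_) ws)) ≡⟨ cong₂ (λ x y → sum x + sum y) (sym (map-∘ ws)) (sym (map-∘ ws)) ⟩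
  sum (map f ws) + sum (map (λ w → g * f w) ws)                ≡⟨ cong (sum (map f ws) +_) (scale ws) ⟩
  sum (map f ws) + g * sum (map f ws)                          ≡⟨ cong (suc g *_) (weight-allWords g n) ⟩
  suc g ^ suc n                                                ∎
  where
  open ≡-Reasoning
  f = λ w → g ^ falses w
  ws = allWords n
  scale : ∀ ws → sum (map (λ w → g * f w) ws) ≡ g * sum (map f ws)
  scale [] = sym (*-zeroʳ g)
  scale (w ∷ ws) = trans (cong (g * f w +_) (scale ws)) (sym (*-distribˡ-+ g (f w) _))

sum-constant : ∀ {A : Set} (f : A → ℕ) c {ws} → All (λ w → f w ≡ c) ws → sum (map f ws) ≡ length ws * c
sum-constant f c [] = refl
sum-constant f c (e ∷ al) = cong₂ _+_ e (sum-constant f c al)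

-- By the binomial theorem the weights `g ^ falses w` add up to `suc g ^ H`, and there are only H +
-- 1 possible numbers of minima. The lost factor H + 1, squared, is the quadratic that `poly<exp`
-- beats.
heaviest-words : ∀ g H → ∃[ i ] ∃[ G ] (i + G ≡ H × suc g ^ H ≤ suc H * (length (words H i) * g ^ G))
heaviest-words g H = i , H ∸ i , m+[n∸m]≡n (proj₁ (proj₂ heavy)) ,
    subst₂ (λ x y → x ≤ suc H * y) (weight-allWords g H) (sum-constant (λ w → g ^ falses w) (g ^ (H ∸ i)) (All.tabulate (same i))) (proj₂ (proj₂ heavy))
  where
  bounded : ∀ {w} → w ∈ allWords H → trues w ≤ H
  bounded {w} w∈ = ≤-trans (m≤m+n (trues w) (falses w)) (≤-reflexive (trans (trues+falses w) (allWords-length H w∈)))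
  heavy = heaviest-class trues (λ w → g ^ falses w) H (allWords H) (All.tabulate bounded)
  i = proj₁ heavy
  same : ∀ i {w} → w ∈ words H i → g ^ falses w ≡ g ^ (H ∸ i)
  same i {w} w∈ with l , t ← words-sound H i w∈ = cong (g ^_) (sym (trans (cong₂ _∸_ (sym (trans (trues+falses w) l)) (sym t)) (m+n∸m≡n (trues w) (falses w))))

-- Exponential estimates

^-distribʳ-* : ∀ m n o → (m * n) ^ o ≡ m ^ o * n ^ o
^-distribʳ-* m n zero = refl
^-distribʳ-* m n (suc o) = trans (cong ((m * n) *_) (^-distribʳ-* m n o)) (interchange m n (m ^ o) (n ^ o))
  where
  interchange : ∀ a b c d → (a * b) * (c * d) ≡ (a * c) * (b * d)
  interchange = solve-∀

n<2^n : ∀ n → n < 2 ^ n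
n<2^n zero = s≤s z≤n
n<2^n (suc n) = ≤-trans (+-mono-≤ (≤-trans (s≤s z≤n) (n<2^n n)) (n<2^n n)) (≤-reflexive (cong (2 ^ n +_) (sym (+-identityʳ (2 ^ n)))))

-- The first two terms of the binomial expansion of (z + 1)^(m + 1).
power-step : ∀ z m → z ^ suc m + suc m * z ^ m ≤ suc z ^ suc m
power-step z zero = ≤-reflexive (one z)
  where
  one : ∀ z → z * 1 + 1 * 1 ≡ (1 + z) * 1
  one = solve-∀
power-step z (suc m) = ≤-trans (m≤m+n _ (suc m * z ^ m))
  (≤-trans (≤-reflexive (expand z m (z ^ m))) (*-monoʳ-≤ (suc z) (power-step z m)))
  where
  expand : ∀ z m p → (z * (z * p) + (2 + m) * (z * p)) + (1 + m) * p ≡ (1 + z) * (z * p + (1 + m) * p)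
  expand = solve-∀

doubling : ∀ z → 0 < z → 2 * z ^ z ≤ suc z ^ z
doubling (suc y) _ = ≤-trans (≤-reflexive (two (suc y ^ y) y)) (power-step (suc y) y)
  where
  two : ∀ p y → 2 * ((1 + y) * p) ≡ (1 + y) * p + (1 + y) * p
  two = solve-∀

-- By `doubling`, every z steps gain a factor 2, so h = z t leaves `2 ^ t` against a quadratic in t.
poly<exp : ∀ K z → 0 < z → ∃[ h ] K * (suc h * suc h) * z ^ h ≤ suc z ^ h
poly<exp K z z>0 = z * t , (begin
  K * (suc (z * t) * suc (z * t)) * z ^ (z * t)  ≤⟨ *-monoˡ-≤ (z ^ (z * t)) poly ⟩
  2 ^ t * z ^ (z * t)                            ≡⟨ cong (2 ^ t *_) (^-*-assoc z z t) ⟨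
  2 ^ t * (z ^ z) ^ t                            ≡⟨ ^-distribʳ-* 2 (z ^ z) t ⟨
  (2 * z ^ z) ^ t                                ≤⟨ ^-monoˡ-≤ t (doubling z z>0) ⟩
  (suc z ^ z) ^ t                                ≡⟨ ^-*-assoc (suc z) z t ⟩
  suc z ^ (z * t)                                ∎)
  where
  open ≤-Reasoning
  K′ = K * (suc z * suc z)
  -- Of the three factors `2 ^ s` in `2 ^ t`, two absorb the square of `suc s` and the third absorbs
  -- `9 * K′`; the 9 is the square of the 3 in `t`.
  s = 9 * K′
  t = 3 * s
  small : suc (z * t) ≤ suc z * (3 * suc s)
  small = ≤-trans (m≤m+n (suc (z * t)) _) (≤-reflexive (gap z s))
    where
    gap : ∀ z s → (1 + z * (3 * s)) + (2 + 3 * s + 3 * z) ≡ (1 + z) * (3 * (1 + s))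
    gap = solve-∀
  cube : (2 ^ s * 2 ^ s) * 2 ^ s ≡ 2 ^ t
  cube = trans (cong (_* 2 ^ s) (sym (^-distribˡ-+-* 2 s s))) (trans (sym (^-distribˡ-+-* 2 (s + s) s)) (cong (2 ^_) (three s)))
    where
    three : ∀ s → s + s + s ≡ 3 * s
    three = solve-∀
  poly : K * (suc (z * t) * suc (z * t)) ≤ 2 ^ t
  poly = begin
    K * (suc (z * t) * suc (z * t))                                 ≤⟨ *-monoʳ-≤ K (*-mono-≤ small small) ⟩
    K * ((suc z * (3 * suc s)) * (suc z * (3 * suc s)))             ≡⟨ collect K z s ⟩
    (suc s * suc s) * (9 * (K * (suc z * suc z)))                   ≤⟨ *-mono-≤ (*-mono-≤ (n<2^n s) (n<2^n s)) (<⇒≤ (n<2^n s)) ⟩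
    (2 ^ s * 2 ^ s) * 2 ^ s                                         ≡⟨ cube ⟩
    2 ^ t                                                           ∎
    where
    collect : ∀ K z s → K * (((1 + z) * (3 * (1 + s))) * ((1 + z) * (3 * (1 + s)))) ≡ ((1 + s) * (1 + s)) * (9 * (K * ((1 + z) * (1 + z))))
    collect = solve-∀

-- The growth rate of the class is at least g².
record Growth (g : ℕ) (as : List ℕ) : Set where
  constructor growing
  field
    eventually-≤ : ∀ a b → 0 < b → a < (g ^ 2) * b → ∃[ N ] (∀ n → N ≤ n → a ^ n ≤ (b ^ n) * S n (layered as))
open Growth

module _ (s : ℕ → ℕ) (s-suc : ∀ n → s n ≤ s (suc n)) where

  monotone-+ : ∀ m k → s m ≤ s (k + m)
  monotone-+ m zero = ≤-refl
  monotone-+ m (suc k) = ≤-trans (monotone-+ m k) (s-suc (k + m))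

  monotone : ∀ {m n} → m ≤ n → s m ≤ s n
  monotone {m} {n} m≤n = subst (λ k → s m ≤ s k) (m∸n+n≡m m≤n) (monotone-+ m (n ∸ m))

  eventually : ∀ a b L X → .{{NonZero a}} → .{{NonZero b}} → .{{NonZero L}} → (∀ M → X ^ M ≤ s (suc M * L)) →
    2 * a ^ L ≤ X * b ^ L → ∃[ N ] (∀ n → N ≤ n → a ^ n ≤ b ^ n * s n)
  eventually a b L X blocks gain = suc τ * L , bound-at
    where
    -- Rounding n up and dropping to M blocks costs `a ^ (2 * L)`. The spare factor 2 in each block
    -- repays it once M is at least τ, because `2 ^ M` exceeds M.
    τ = a ^ (2 * L)
    bound-at : ∀ n → suc τ * L ≤ n → a ^ n ≤ b ^ n * s n
    bound-at n N≤n = go (n / L) refl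
      where
      n≡ : n ≡ n % L + n / L * L
      n≡ = m≡m%n+[m/n]*n n L
      n<  : n < suc (n / L) * L
      n< = subst (_< suc (n / L) * L) (sym n≡) (+-monoˡ-< (n / L * L) (m%n<n n L))
      τ< : τ < n / L
      τ< = ≤-pred (*-cancelʳ-< L (suc τ) (suc (n / L)) (≤-<-trans N≤n n<))
      go : ∀ q → q ≡ n / L → a ^ n ≤ b ^ n * s n
      go zero e = ⊥-elim (n≮0 (subst (τ <_) (sym e) τ<))
      go (suc M) e = begin
        a ^ n                         ≤⟨ ^-monoʳ-≤ a (<⇒≤ (subst (λ q → n < suc q * L) (sym e) n<)) ⟩
        a ^ (suc (suc M) * L)         ≡⟨ cong (a ^_) (regroup L M) ⟩
        a ^ (2 * L + L * M)           ≡⟨ ^-distribˡ-+-* a (2 * L) (L * M) ⟩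
        τ * a ^ (L * M)               ≤⟨ *-monoˡ-≤ (a ^ (L * M)) (≤-trans (≤-pred (subst (τ <_) (sym e) τ<)) (<⇒≤ (n<2^n M))) ⟩
        2 ^ M * a ^ (L * M)           ≡⟨ cong (2 ^ M *_) (^-*-assoc a L M) ⟨
        2 ^ M * (a ^ L) ^ M           ≡⟨ ^-distribʳ-* 2 (a ^ L) M ⟨
        (2 * a ^ L) ^ M               ≤⟨ ^-monoˡ-≤ M gain ⟩
        (X * b ^ L) ^ M               ≡⟨ ^-distribʳ-* X (b ^ L) M ⟩
        X ^ M * (b ^ L) ^ M           ≡⟨ cong (X ^ M *_) (^-*-assoc b L M) ⟩
        X ^ M * b ^ (L * M)           ≤⟨ *-mono-≤ (≤-trans (blocks M) (monotone used)) (^-monoʳ-≤ b (≤-trans (≤-reflexive (*-comm L M)) (≤-trans (m≤n+m (M * L) L) used))) ⟩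
        s n * b ^ n                   ≡⟨ *-comm (s n) (b ^ n) ⟩
        b ^ n * s n                   ∎
        where
        open ≤-Reasoning
        used : suc M * L ≤ n
        used = ≤-trans (≤-reflexive (cong (_* L) e)) (≤-trans (m≤n+m _ (n % L)) (≤-reflexive (sym n≡)))
        regroup : ∀ L M → (2 + M) * L ≡ 2 * L + L * M
        regroup = solve-∀

S-positive : ∀ {as} → Indecomposable as → ∀ n → 0 < S n (layered as)
S-positive {as} ind n = ∈-length (avoiders-complete n as ↭-refl
  (λ τ → ind .not-descending (AllPairs-⊆ τ (downs-descending n))))

-- With E = c + 1 = g²(a + 2), the class of as grows at least like (c / (a + 2))^n
-- up to a constant κ, and ((g + 1)² c b)^H eventually beats every quadratic
-- multiple of (a E)^H; this leaves a factor 2 to spare in each block.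
module Step {as : List ℕ} (ind : Indecomposable as) (ne : ¬ Occ as []) (g : ℕ) (g>0 : 0 < g)
  (growth : Growth g as) (a b : ℕ) (a>0 : 0 < a) (b>0 : 0 < b) (a<gb : a < (suc g ^ 2) * b) where

  e E c : ℕ
  e = 2 + a
  E = g ^ 2 * e
  c = E ∸ 1

  instance
    e≢0 : NonZero e
    e≢0 = >-nonZero (s≤s z≤n)
    g≢0 : NonZero g
    g≢0 = >-nonZero g>0
    a≢0 : NonZero a
    a≢0 = >-nonZero a>0
    b≢0 : NonZero b
    b≢0 = >-nonZero b>0

  e≤E : e ≤ E
  e≤E = ≤-trans (≤-reflexive (sym (*-identityˡ e))) (*-monoˡ-≤ e (m^n>0 g 2))

  E≡ : E ≡ suc c
  E≡ = sym (trans (+-comm 1 c) (m∸n+n≡m (≤-trans (s≤s z≤n) e≤E)))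

  c>a : a < c
  c>a = ≤-pred (subst (2 + a ≤_) E≡ e≤E)

  instance
    c≢0 : NonZero c
    c≢0 = >-nonZero (≤-<-trans z≤n c>a)
    E≢0 : NonZero E
    E≢0 = >-nonZero (≤-trans (s≤s z≤n) e≤E)

  limit = growth .eventually-≤ c e (s≤s z≤n) (subst (c <_) (sym E≡) ≤-refl)

  κ : ℕ
  κ = c ^ proj₁ limit

  -- `G` comes from the pigeonhole choice and may be small, so a bound for every `G` is needed:
  -- below the threshold `κ` alone outweighs `c ^ G`, as at least one permutation avoids the
  -- pattern.
  S-lower : ∀ G → c ^ G ≤ κ * (e ^ G * S G (layered as))
  S-lower G with ≤-total (proj₁ limit) G
  ... | inj₁ N≤G = ≤-trans (proj₂ limit G N≤G) (≤-trans (≤-reflexive (sym (*-identityˡ _))) (*-monoˡ-≤ _ (m^n>0 c (proj₁ limit))))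
  ... | inj₂ G≤N = ≤-trans (^-monoʳ-≤ c G≤N) (≤-trans (≤-reflexive (sym (*-identityʳ κ)))
        (*-monoʳ-≤ κ (*-mono-≤ (m^n>0 e G) (S-positive ind G))))

  Y Z : ℕ
  Y = (suc g ^ 2 * b) * c
  Z = a * E

  -- This dictates e = a + 2: it gives c > a, hence a (c + 1) < (a + 1) c, and a + 1 is at most (g +
  -- 1)² b.
  Z<Y : suc Z ≤ Y
  Z<Y = begin
    suc (a * E)      ≡⟨ cong (λ z → suc (a * z)) E≡ ⟩
    suc (a * suc c)  ≡⟨ cong suc (*-suc a c) ⟩
    suc a + a * c    ≤⟨ +-monoˡ-≤ (a * c) c>a ⟩
    c + a * c        ≤⟨ *-monoˡ-≤ c a<gb ⟩
    Y                ∎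
    where open ≤-Reasoning

  beaten = poly<exp (2 * a * κ) Z (>-nonZero⁻¹ Z {{m*n≢0 a E}})

  H : ℕ
  H = proj₁ beaten

  heavy = heaviest-words g H
  i = proj₁ heavy
  G = proj₁ (proj₂ heavy)

  i+G : i + G ≡ H
  i+G = proj₁ (proj₂ (proj₂ heavy))

  W SG X : ℕ
  W = length (words H i)
  SG = S G (layered as)
  X = W * (W * SG)

  words-lower : suc g ^ H ≤ suc H * (W * g ^ G)
  words-lower = proj₂ (proj₂ (proj₂ heavy))

  c^H : c ^ H ≤ (κ * (e ^ G * SG)) * E ^ i
  c^H = begin
    c ^ H                           ≡⟨ cong (c ^_) (trans (sym i+G) (+-comm i G)) ⟩
    c ^ (G + i)                     ≡⟨ ^-distribˡ-+-* c G i ⟩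
    c ^ G * c ^ i                   ≤⟨ *-mono-≤ (S-lower G) (^-monoˡ-≤ i (≤-trans (n≤1+n c) (≤-reflexive (sym E≡)))) ⟩
    (κ * (e ^ G * SG)) * E ^ i      ∎
    where open ≤-Reasoning

  E^H : E ^ i * ((g ^ G * g ^ G) * e ^ G) ≡ E ^ H
  E^H = begin
    E ^ i * ((g ^ G * g ^ G) * e ^ G)  ≡⟨ cong (λ z → E ^ i * (z * e ^ G)) (^-distribʳ-* g g G) ⟨
    E ^ i * ((g * g) ^ G * e ^ G)      ≡⟨ cong (E ^ i *_) (^-distribʳ-* (g * g) e G) ⟨
    E ^ i * (g * g * e) ^ G            ≡⟨ cong (λ z → E ^ i * (z * e) ^ G) (cong (g *_) (sym (*-identityʳ g))) ⟩
    E ^ i * E ^ G                      ≡⟨ ^-distribˡ-+-* E i G ⟨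
    E ^ (i + G)                        ≡⟨ cong (E ^_) i+G ⟩
    E ^ H                              ∎
    where open ≡-Reasoning

  -- `words-lower` enters twice, for positions and for values. The remaining powers recombine into
  -- `E ^ H`: i factors are E itself, and the other G are assembled as g² e.
  Y^H : Y ^ H ≤ (suc H * suc H * κ) * (X * b ^ H * E ^ H)
  Y^H = begin
    Y ^ H                                        ≡⟨ ^-distribʳ-* (suc g ^ 2 * b) c H ⟩
    (suc g ^ 2 * b) ^ H * c ^ H                  ≡⟨ cong (_* c ^ H) (^-distribʳ-* (suc g ^ 2) b H) ⟩
    (suc g ^ 2) ^ H * b ^ H * c ^ H              ≡⟨ cong (λ z → z * b ^ H * c ^ H) square ⟩
    (suc g ^ H * suc g ^ H) * b ^ H * c ^ H      ≤⟨ *-mono-≤ (*-monoˡ-≤ (b ^ H) (*-mono-≤ words-lower words-lower)) c^H ⟩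
    ((suc H * (W * g ^ G)) * (suc H * (W * g ^ G))) * b ^ H * ((κ * (e ^ G * SG)) * E ^ i)
                                                 ≡⟨ collect (suc H) W (g ^ G) (b ^ H) κ (e ^ G) SG (E ^ i) ⟩
    (suc H * suc H * κ) * (X * b ^ H * (E ^ i * ((g ^ G * g ^ G) * e ^ G)))
                                                 ≡⟨ cong (λ z → (suc H * suc H * κ) * (X * b ^ H * z)) E^H ⟩
    (suc H * suc H * κ) * (X * b ^ H * E ^ H)    ∎
    where
    open ≤-Reasoning
    square : (suc g ^ 2) ^ H ≡ suc g ^ H * suc g ^ H
    square = trans (cong (λ z → (suc g * z) ^ H) (*-identityʳ (suc g))) (^-distribʳ-* (suc g) (suc g) H)
    collect : ∀ h w p β k q s t → ((h * (w * p)) * (h * (w * p))) * β * ((k * (q * s)) * t) ≡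
      (h * h * k) * ((w * (w * s)) * β * (t * ((p * p) * q)))
    collect = solve-∀

  -- A block has H + 1 values because of its forced minimum. The extra factor a, the spare 2 and `κ`
  -- form the constant given to `poly<exp`.
  gain : 2 * a ^ suc H ≤ X * b ^ suc H
  gain = ≤-trans (*-cancelˡ-≤ (suc H * suc H * κ * E ^ H) {{m*n≢0 _ _ {{m*n≢0 (suc H * suc H) κ {{_}} {{m^n≢0 c (proj₁ limit)}}}} {{m^n≢0 E H}}}} scaled)
    (*-monoʳ-≤ X (≤-trans (≤-reflexive (sym (*-identityˡ (b ^ H)))) (*-monoˡ-≤ (b ^ H) b>0)))
    where
    open ≤-Reasoning
    scaled : (suc H * suc H * κ * E ^ H) * (2 * a ^ suc H) ≤ (suc H * suc H * κ * E ^ H) * (X * b ^ H)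
    scaled = begin
      (suc H * suc H * κ * E ^ H) * (2 * (a * a ^ H))            ≡⟨ front (suc H) κ (E ^ H) a (a ^ H) ⟩
      (2 * a * κ) * (suc H * suc H) * (a ^ H * E ^ H)            ≡⟨ cong ((2 * a * κ) * (suc H * suc H) *_) (^-distribʳ-* a E H) ⟨
      (2 * a * κ) * (suc H * suc H) * Z ^ H                      ≤⟨ proj₂ beaten ⟩
      suc Z ^ H                                                  ≤⟨ ^-monoˡ-≤ H Z<Y ⟩
      Y ^ H                                                      ≤⟨ Y^H ⟩
      (suc H * suc H * κ) * (X * b ^ H * E ^ H)                  ≡⟨ back (suc H) κ X (b ^ H) (E ^ H) ⟩
      (suc H * suc H * κ * E ^ H) * (X * b ^ H)                  ∎
      where
      front : ∀ h k ε α p → (h * h * k * ε) * (2 * (α * p)) ≡ (2 * α * k) * (h * h) * (p * ε)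
      front = solve-∀
      back : ∀ h k x β ε → (h * h * k) * (x * β * ε) ≡ (h * h * k * ε) * (x * β)
      back = solve-∀

  blocks : ∀ M → X ^ M ≤ S (suc M * suc H) (layered (1 ∷ as))
  blocks M = subst₂ _≤_ (cong (_^ M) (trans (Blocks.codes-count i G as ind) (cong (λ h → length (words h i) * (length (words h i) * SG)) i+G)))
    (cong (λ h → S (suc M * suc h) (layered (1 ∷ as))) i+G) (Blocks.S-blocks i G as ind M)

  conclusion : ∃[ N ] (∀ n → N ≤ n → a ^ n ≤ b ^ n * S n (layered (1 ∷ as)))
  conclusion = eventually (λ n → S n (layered (1 ∷ as))) (S-suc ne) a b (suc H) X blocks gain

growth-step : ∀ {g as} → Indecomposable as → ¬ Occ as [] → 0 < g → Growth g as → Growth (suc g) (1 ∷ as)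
growth-step {g} {as} ind ne g>0 gr .eventually-≤ = go
  where
  go : ∀ a b → 0 < b → a < (suc g ^ 2) * b → ∃[ N ] (∀ n → N ≤ n → a ^ n ≤ (b ^ n) * S n (layered (1 ∷ as)))
  -- Since 0 ^ 0 = 1, the bound starts at n = 1.
  go zero b b>0 _ = 1 , λ { (suc n) _ → z≤n }
  go (suc a) b b>0 lt = Step.conclusion ind ne g g>0 gr (suc a) b (s≤s z≤n) b>0 lt

growth-≤ : ∀ {g as bs} → (∀ n → S n (layered as) ≤ S n (layered bs)) → Growth g as → Growth g bs
growth-≤ le gr .eventually-≤ a b b>0 lt with N , f ← gr .eventually-≤ a b b>0 lt =
  N , λ n N≤n → ≤-trans (f n N≤n) (*-monoʳ-≤ (b ^ n) (le n))

-- Assembling a layered pattern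

growth-straighten : ∀ {g} a as → Growth g (replicate a 1 ++ as) → Growth g (a ∷ as)
growth-straighten a as = growth-≤ {as = replicate a 1 ++ as} {a ∷ as} (λ n → S-straighten n a as)

growth-reverse : ∀ {g} b → Growth g (b ∷ 1 ∷ []) → Growth g (1 ∷ b ∷ [])
growth-reverse b = growth-≤ {as = b ∷ 1 ∷ []} {1 ∷ b ∷ []} (λ n → S-reverseComplement n b)

no-empty-occurrence : ∀ {a as} → ¬ Occ (suc a ∷ as) []
no-empty-occurrence o = go o refl
  where
  go : ∀ {a as s} → Occ (suc a ∷ as) s → s ≢ []
  go (layer {s₁ = _ ∷ _} _ _ _ _) ()

-- With two nonempty layers behind the ones, each pattern to which a 1 is prepended begins with a
-- layer and continues with another, so it is not a skew sum.
growth-ones-++ : ∀ {g a b as} j → 0 < g → Growth g (suc a ∷ suc b ∷ as) → Growth (j + g) (replicate j 1 ++ suc a ∷ suc b ∷ as)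
growth-ones-++ zero g>0 gr = gr
growth-ones-++ (suc zero) g>0 gr = growth-step (indecomposable no-empty-occurrence) no-empty-occurrence g>0 gr
growth-ones-++ (suc (suc j)) g>0 gr =
  growth-step (indecomposable (ones-occur j)) no-empty-occurrence (s≤s z≤n) (growth-ones-++ (suc j) g>0 gr)
  where
  ones-occur : ∀ j {a as} → ¬ Occ (replicate j 1 ++ suc a ∷ as) []
  ones-occur zero = no-empty-occurrence
  ones-occur (suc j) = no-empty-occurrence

-- The induction starts at the pattern 12 because `growth-step` needs g > 0; the decreasing
-- permutation alone gives rate 1.
growth-11 : Growth 1 (1 ∷ 1 ∷ [])
growth-11 .eventually-≤ a b b>0 lt = 0 , λ n _ → ≤-trans (^-monoˡ-≤ n (≤-trans (<⇒≤ lt) (≤-reflexive (+-identityʳ b))))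
  (≤-trans (≤-reflexive (sym (*-identityʳ (b ^ n)))) (*-monoʳ-≤ (b ^ n) (S-positive {1 ∷ 1 ∷ []} (indecomposable no-empty-occurrence) n)))

growth-zero : ∀ {as} → Growth 0 as
growth-zero .eventually-≤ a b b>0 ()

replicate-snoc : ∀ n (x : ℕ) xs → replicate n x ++ x ∷ xs ≡ x ∷ replicate n x ++ xs
replicate-snoc zero x xs = refl
replicate-snoc (suc n) x xs = cong (x ∷_) (replicate-snoc n x xs)

growth-ones : ∀ k → Growth k (replicate (suc k) 1)
growth-ones zero = growth-zero
growth-ones (suc k) = subst₂ Growth (+-comm k 1) ones (growth-ones-++ k (s≤s z≤n) growth-11)
  where
  ones : replicate k 1 ++ 1 ∷ 1 ∷ [] ≡ replicate (suc (suc k)) 1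
  ones = trans (replicate-snoc k 1 [ 1 ]) (cong (1 ∷_) (trans (replicate-snoc k 1 []) (cong (1 ∷_) (++-identityʳ (replicate k 1)))))

-- Stripping the last entry of the first layer would leave a single decreasing layer, a skew sum as
-- soon as it has two entries. Hence the detour by reversal, after which the other layer is
-- straightened as well and only ones remain.
growth-two : ∀ a b → Growth (suc (a + b)) (suc a ∷ suc b ∷ [])
growth-two a b = growth-straighten (suc a) (suc b ∷ [])
  (subst₂ Growth (+-suc a b) (replicate-snoc a 1 (suc b ∷ []))
    (growth-ones-++ a (s≤s z≤n) (growth-reverse (suc b)
      (growth-straighten (suc b) (1 ∷ [])
        (subst (Growth (suc b)) ones (growth-ones (suc b)))))))
  where
  ones : replicate (suc (suc b)) 1 ≡ replicate (suc b) 1 ++ 1 ∷ []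
  ones = sym (trans (replicate-snoc (suc b) 1 []) (cong (1 ∷_) (++-identityʳ (replicate (suc b) 1))))

growth-layered : ∀ {as} → All (0 <_) as → Growth (sum as ∸ 1) as
growth-layered [] = growth-zero
growth-layered {suc a ∷ []} (s≤s _ ∷ []) = growth-straighten (suc a) []
  (subst₂ Growth (sym (+-identityʳ a)) (sym (++-identityʳ (replicate (suc a) 1))) (growth-ones a))
growth-layered {suc a ∷ suc b ∷ []} (s≤s _ ∷ s≤s _ ∷ []) =
  subst (λ g → Growth g (suc a ∷ suc b ∷ [])) (sym (trans (+-suc a (b + 0)) (cong (λ z → suc (a + z)) (+-identityʳ b)))) (growth-two a b)
growth-layered {suc a ∷ suc b ∷ suc c ∷ as} (s≤s _ ∷ pos@(s≤s _ ∷ s≤s _ ∷ _)) = growth-straighten (suc a) (suc b ∷ suc c ∷ as)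
  (subst (λ g → Growth g (replicate (suc a) 1 ++ suc b ∷ suc c ∷ as)) (sym (+-suc a (b + suc (c + sum as))))
    (growth-ones-++ (suc a) (≤-trans (s≤s z≤n) (m≤n+m (suc (c + sum as)) b)) (growth-layered pos)))

-- `Layered` admits sizes 0; they do not affect the word, but the induction over layers wants
-- nonempty ones.
positives : List ℕ → List ℕ
positives = filter (0 <?_)

layeredFrom-positives : ∀ n as → layeredFrom n (positives as) ≡ layeredFrom n as
layeredFrom-positives n [] = refl
layeredFrom-positives n (zero ∷ as) = trans (layeredFrom-positives n as) (cong (λ k → layeredFrom k as) (sym (+-identityʳ n)))
layeredFrom-positives n (suc a ∷ as) = cong (layerAt n (suc a) ++_) (layeredFrom-positives (n + suc a) as)

layeredFrom-length : ∀ n as → length (layeredFrom n as) ≡ sum as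
layeredFrom-length n [] = refl
layeredFrom-length n (a ∷ as) = trans (length-++ (layerAt n a)) (cong₂ _+_ (layerAt-length n a) (layeredFrom-length (n + a) as))

theorem5p7 : (q : List ℕ) → Layered q →
    (a b : ℕ) → 0 < b → a < ((length q ∸ 1) ^ 2) * b →
    ∃ λ N → (n : ℕ) → N ≤ n → a ^ n ≤ (b ^ n) * S n q
theorem5p7 q (sizes , e) a b b>0 lt with trans (layeredFrom-positives 0 sizes) e
... | refl = growth-layered (Allₚ.all-filter (0 <?_) sizes) .eventually-≤ a b b>0
  (subst (λ k → a < ((k ∸ 1) ^ 2) * b) (layeredFrom-length 0 (positives sizes)) lt)
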